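{- For all integers $1\le r\le s\le t$, $$\delta_{\mathrm{VC}}(K_{r,s,t})=\begin{cases}\frac13, & r=s=1,\\[1mm] \frac{s}{2s+1}, & r=1,\ s\ge 2,\ t\ge 2s-2,\\[1mm] \frac12, & \text{otherwise.}\end{cases}$$
   Context: All graphs are finite and simple. $K_{r,s,t}$ is the complete tripartite graph with parts of sizes $r,s,t$. A graph is $H$-free if it contains no (not necessarily induced) subgraph isomorphic to $H$; it is maximal $H$-free if it is $H$-free and adding any missing edge creates a copy of $H$. $\delta(G)$ denotes minimum degree. The VC-dimension $\mathrm{VC}(G)$ of a graph $G$ is the VC-dimension of the set system $\{N_G(v):v\in V(G)\}$ on $V(G)$, i.e. the maximum size of a set $S\subseteq V(G)$ such that $\{N_G(v)\cap S: v\in V(G)\}=2^S$. The VC-dimension threshold $\delta_{\mathrm{VC}}(H)$ is the infimum of all $\gamma\ge 0$ for which there exists a constant $C=C(\gamma,H)$ such that every maximal $H$-free graph $G$ with $\delta(G)\ge\gamma|V(G)|$ satisfies $\mathrm{VC}(G)\le C$. -}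

module Defs where

open import Data.Bool.Base using (Bool; true; false; _∧_; _∨_; not)
open import Data.Bool.Properties using (∧-comm; ∨-comm) renaming (_≟_ to _≟ᵇ_)
open import Data.Empty using (⊥-elim)
open import Data.Fin.Base using (Fin; zero; suc; splitAt)
open import Data.Fin.Properties using (any?) renaming (_≟_ to _≟ᶠ_)
open import Data.Fin.Subset using (Subset; _⊆_; _∩_; ∣_∣)
open import Data.Fin.Subset.Properties using (anySubset?; _⊆?_)
open import Data.Integer.Base using (+_)
open import Data.List.Base using (map; filter; upTo; allFin)
open import Data.List.Extrema.Nat using (max; min)
open import Data.Nat.Base as ℕ using (ℕ)
import Data.Nat.Properties as ℕ
open import Data.Product.Base using (Σ; ∃; _×_; _,_)
open import Data.Rational.Base as ℚ using (ℚ; 0ℚ; 1ℚ)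
import Data.Rational.Properties as ℚ
open import Data.Sum.Base using (_⊎_; inj₁; inj₂; [_,_]′)
open import Data.Vec.Base using (tabulate)
open import Data.Vec.Properties using (≡-dec)
open import Function.Base using (const)
open import Function.Definitions using (Injective)
open import Relation.Binary.PropositionalEquality using (_≡_; _≢_; refl; sym; trans; cong; cong₂; subst)
open import Relation.Nullary using (¬_; Dec; yes; no)
open import Relation.Nullary.Decidable using (⌊_⌋; map′; ¬?; _×-dec_; _→-dec_; decidable-stable)

record ℝ : Set₁ where
  field
    lower upper     : ℚ → Set
    lower-inhabited : ∃ lower
    upper-inhabited : ∃ upper
    lower-closed    : ∀ {p q} → p ℚ.< q → lower q → lower p
    upper-closed    : ∀ {p q} → p ℚ.< q → upper p → upper q
    lower-open      : ∀ {p} → lower p → ∃ λ q → p ℚ.< q × lower q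
    upper-open      : ∀ {q} → upper q → ∃ λ p → p ℚ.< q × upper p
    disjoint        : ∀ {q} → ¬ (lower q × upper q)
    located         : ∀ {p q} → p ℚ.< q → lower p ⊎ upper q

open ℝ public

infix 4 _≤ᴿ_

_≤ᴿ_ : ℝ → ℝ → Set
x ≤ᴿ y = ∀ {q} → lower x q → lower y q

fromℚ : ℚ → ℝ
fromℚ x = record
  { lower           = ℚ._< x
  ; upper           = x ℚ.<_
  ; lower-inhabited = x ℚ.- 1ℚ , subst (x ℚ.- 1ℚ ℚ.<_) (ℚ.+-identityʳ x) (ℚ.+-monoʳ-< x (ℚ.negative⁻¹ (ℚ.- 1ℚ)))
  ; upper-inhabited = x ℚ.+ 1ℚ , subst (ℚ._< x ℚ.+ 1ℚ) (ℚ.+-identityʳ x) (ℚ.+-monoʳ-< x (ℚ.positive⁻¹ 1ℚ))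
  ; lower-closed    = ℚ.<-trans
  ; upper-closed    = λ p<q x<p → ℚ.<-trans x<p p<q
  ; lower-open      = λ p<x → let q , p<q , q<x = ℚ.<-dense p<x in q , p<q , q<x
  ; upper-open      = λ x<q → let p , x<p , p<q = ℚ.<-dense x<q in p , p<q , x<p
  ; disjoint        = λ (q<x , x<q) → ℚ.<-asym q<x x<q
  ; located         = loc
  }
  where
  loc : ∀ {p q} → p ℚ.< q → p ℚ.< x ⊎ x ℚ.< q
  loc {p} p<q with p ℚ.<? x
  ... | yes p<x = inj₁ p<x
  ... | no  p≮x = inj₂ (ℚ.≤-<-trans (ℚ.≮⇒≥ p≮x) p<q)

fromℕ : ℕ → ℚ
fromℕ n = + n ℚ./ 1

-- The inequality γ·n ≤ d between reals: as n ≥ 0, it holds iff q·n ≤ d for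
-- every rational q < γ.
infix 4 _·_≤ⁿ_

_·_≤ⁿ_ : ℝ → ℕ → ℕ → Set
γ · n ≤ⁿ d = ∀ {q} → lower γ q → q ℚ.* fromℕ n ℚ.≤ fromℕ d

record IsInfimum (P : ℝ → Set) (x : ℝ) : Set₁ where
  field
    lowerBound : ∀ γ → P γ → x ≤ᴿ γ
    greatest   : ∀ y → (∀ γ → P γ → y ≤ᴿ γ) → y ≤ᴿ x

record Graph (n : ℕ) : Set where
  field
    adj        : Fin n → Fin n → Bool
    adj-sym    : ∀ u v → adj u v ≡ adj v u
    adj-irrefl : ∀ v → adj v v ≡ false

open Graph public

Contains : ∀ {m n} → Graph m → Graph n → Set
Contains {m} {n} H G = Σ (Fin m → Fin n) λ f →
  Injective _≡_ _≡_ f × (∀ u v → adj H u v ≡ true → adj G (f u) (f v) ≡ true)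

_-Free_ : ∀ {m n} → Graph m → Graph n → Set
H -Free G = ¬ Contains H G

addEdge : ∀ {n} → Graph n → (u v : Fin n) → u ≢ v → Graph n
addEdge {n} G u v u≢v = record
  { adj        = λ x y → adj G x y ∨ (is u x ∧ is v y) ∨ (is v x ∧ is u y)
  ; adj-sym    = λ x y → cong₂ _∨_ (adj-sym G x y)
      (trans (∨-comm (is u x ∧ is v y) (is v x ∧ is u y))
             (cong₂ _∨_ (∧-comm (is v x) (is u y)) (∧-comm (is u x) (is v y))))
  ; adj-irrefl = λ x → cong₂ _∨_ (adj-irrefl G x) (notBoth x)
  }
  where
  is : Fin n → Fin n → Bool
  is w x = ⌊ x ≟ᶠ w ⌋

  notBoth : ∀ x → (is u x ∧ is v x) ∨ (is v x ∧ is u x) ≡ false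
  notBoth x with x ≟ᶠ u | x ≟ᶠ v
  ... | yes x≡u | yes x≡v = ⊥-elim (u≢v (trans (sym x≡u) x≡v))
  ... | yes _   | no  _   = refl
  ... | no  _   | yes _   = refl
  ... | no  _   | no  _   = refl

record MaximalFree {m n : ℕ} (H : Graph m) (G : Graph n) : Set where
  field
    free    : H -Free G
    maximal : ∀ u v (u≢v : u ≢ v) → adj G u v ≡ false → Contains H (addEdge G u v u≢v)

K : (r s t : ℕ) → Graph (r ℕ.+ s ℕ.+ t)
K r s t = record
  { adj        = λ u v → not ⌊ part u ≟ᶠ part v ⌋
  ; adj-sym    = λ u v → cong not (≟-sym (part u) (part v))
  ; adj-irrefl = λ v → cong not (≟-refl (part v))
  }
  where
  part : Fin (r ℕ.+ s ℕ.+ t) → Fin 3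
  part v = [ (λ w → [ const zero , const (suc zero) ]′ (splitAt r w))
           , const (suc (suc zero)) ]′ (splitAt (r ℕ.+ s) v)

  ≟-sym : ∀ (i j : Fin 3) → ⌊ i ≟ᶠ j ⌋ ≡ ⌊ j ≟ᶠ i ⌋
  ≟-sym i j with i ≟ᶠ j | j ≟ᶠ i
  ... | yes _   | yes _   = refl
  ... | yes i≡j | no  j≢i = ⊥-elim (j≢i (sym i≡j))
  ... | no  i≢j | yes j≡i = ⊥-elim (i≢j (sym j≡i))
  ... | no  _   | no  _   = refl

  ≟-refl : ∀ (i : Fin 3) → ⌊ i ≟ᶠ i ⌋ ≡ true
  ≟-refl i with i ≟ᶠ i
  ... | yes _   = refl
  ... | no  i≢i = ⊥-elim (i≢i refl)

N : ∀ {n} → Graph n → Fin n → Subset n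
N G v = tabulate (adj G v)

degree : ∀ {n} → Graph n → Fin n → ℕ
degree G v = ∣ N G v ∣

-- Every degree is below n, so the default value n is only attained on the
-- empty graph, whose minimum degree is 0 by convention.
δ : ∀ {n} → Graph n → ℕ
δ {n} G = min n (map (degree G) (allFin n))

-- N G v ∩ S ⊆ S holds for every v, so only the inclusion of 2^S in
-- { N G v ∩ S } is a condition.
Shattered : ∀ {n} → Graph n → Subset n → Set
Shattered G S = ∀ T → T ⊆ S → ∃ λ v → N G v ∩ S ≡ T

shattered? : ∀ {n} (G : Graph n) (S : Subset n) → Dec (Shattered G S)
shattered? {n} G S = map′
  (λ none T → decidable-stable (realised? T) (λ ¬r → none (T , ¬r)))
  (λ all (T , ¬r) → ¬r (all T))
  (¬? (anySubset? (λ T → ¬? (realised? T))))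
  where
  realised? : ∀ T → Dec (T ⊆ S → ∃ λ v → N G v ∩ S ≡ T)
  realised? T = (T ⊆? S) →-dec any? (λ v → ≡-dec _≟ᵇ_ (N G v ∩ S) T)

HasShattered : ∀ {n} → Graph n → ℕ → Set
HasShattered G k = ∃ λ S → ∣ S ∣ ≡ k × Shattered G S

hasShattered? : ∀ {n} (G : Graph n) k → Dec (HasShattered G k)
hasShattered? G k = anySubset? (λ S → (∣ S ∣ ℕ.≟ k) ×-dec shattered? G S)

-- In a nonempty graph the empty set is shattered, so the default value 0 only
-- matters for the empty graph.
VC : ∀ {n} → Graph n → ℕ
VC {n} G = max 0 (filter (hasShattered? G) (upTo (ℕ.suc n)))

VCBoundedAt : ∀ {m} → Graph m → ℝ → Set
VCBoundedAt H γ = ∃ λ C → ∀ n (G : Graph n) → MaximalFree H G → γ · n ≤ⁿ δ G → VC G ℕ.≤ C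

-- δ-VC H ≐ x states that the VC-dimension threshold of H is x.  It is a
-- relation because infima of sets of Dedekind reals need not exist
-- constructively; by antisymmetry of _≤ᴿ_ the value x is unique.
infix 4 δ-VC_≐_

δ-VC_≐_ : ∀ {m} → Graph m → ℝ → Set₁
δ-VC H ≐ x = IsInfimum (λ γ → fromℚ 0ℚ ≤ᴿ γ × VCBoundedAt H γ) x

{-# OPTIONS --safe #-}
-- Write δ for the minimum degree and n for the order.
--
-- Upper bounds.  Beyond n/2 the graph contains K r s t once n is large
-- (Erdős–Stone), so only finitely many orders remain.  For K 1 1 t, an edge
-- has fewer than t common neighbours, while a nonadjacent pair u, v of a
-- maximal graph has a common neighbour w whose neighbourhood almost avoids
-- those of u and v, so |N(u) ∩ N(v)| ≥ 3δ - n - O(1); hence the private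
-- common neighbourhoods attached to a shattered set bound its size.  For
-- K 1 s t with s ≥ 2, δ > 2n/5 rules out pentagons without edges of large
-- codegree, which makes G nearly bipartite; δ > s n/(2s+1) then bounds the
-- degrees inside the two sides by s - 1, and for t ≥ 2s - 2 maximality makes
-- the bipartite graph between the sides complete.
--
-- Lower bounds.  Start from a large complete bipartite graph and plant small
-- gadgets on both sides, joined up to a few missing edges, so that adding a
-- missing edge between selected vertices xᵢ and y_w creates K r s t.  These
-- nonedges persist in any maximal extension, which therefore shatters
-- {x₁, …, x_d}.
module Submission where

import Algebra.Properties.Semiring.Sum
open import Defs
open import Data.Bool.Base using (Bool; true; false; _∧_; not; T; if_then_else_)
open import Data.Bool.Properties using (∧-conicalˡ; ∧-conicalʳ; ∧-comm; ∧-idem; ∧-identityʳ; ∧-zeroʳ; ∨-zeroʳ; T-∧; T-≡; not-injective; not-involutive) renaming (_≟_ to _≟ᵇ_)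
open import Data.Empty using (⊥; ⊥-elim)
open import Data.Fin.Base using (Fin; zero; suc; splitAt; join; inject≤; fromℕ<; _↑ˡ_; _↑ʳ_; finToFun; funToFin; remQuot; combine; punchIn)
open import Data.Fin.Properties using (any?; all?; injective⇒≤; inject≤-injective; 0≢1+n; suc-injective; ↑ˡ-injective; ↑ʳ-injective; splitAt-↑ˡ; splitAt-↑ʳ; join-splitAt; +↔⊎; *↔×; finToFun-funToFin; combine-injective; combine-remQuot; remQuot-combine; punchIn-injective; punchInᵢ≢i) renaming (_≟_ to _≟ᶠ_)
open import Data.Fin.Subset using (Subset; _⊆_; ∣_∣) renaming (_∩_ to _∩ˢ_)
open import Data.Fin.Subset.Properties using (∣p∣≤n)
open import Data.Integer.Base as ℤ using (+_; -[1+_])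
import Data.Integer.Properties as ℤ
open import Data.List.Base using (List; []; _∷_; upTo; allFin; cartesianProduct)
open import Data.List.Extrema.Nat using (min≤xs; v≤min⁺; max≤v⁺; xs≤max)
open import Data.List.Membership.Propositional using () renaming (_∈_ to _∈ˡ_)
open import Data.List.Membership.Propositional.Properties using (∈-filter⁺; ∈-upTo⁺; ∈-allFin; ∈-cartesianProduct⁺; ∈-map⁺)
import Data.List.Relation.Unary.All as All
import Data.List.Relation.Unary.All.Properties as All
open import Data.List.Relation.Unary.Any using (here; there)
open import Data.Nat.Base as ℕ hiding (_/_)
open import Data.Nat.Coprimality using (Coprime)
open import Data.Nat.DivMod using (m/n*n≤m; m≡m%n+[m/n]*n; m%n<n)
open import Data.Nat.Properties hiding (suc-injective; 0≢1+n)
open import Data.Nat.Tactic.RingSolver using (solve-∀)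
open import Data.Product.Base using (∃; ∃₂; _×_; _,_; proj₁; proj₂)
open import Data.Rational.Base as ℚ using (ℚ; mkℚ; 0ℚ; ↥_; ↧ₙ_; toℚᵘ; _/_)
import Data.Rational.Properties as ℚ
open import Data.Rational.Unnormalised.Base as ℚᵘ using (mkℚᵘ)
import Data.Rational.Unnormalised.Properties as ℚᵘ
open import Data.Sum.Base using (_⊎_; inj₁; inj₂; [_,_]′; map₁)
open import Data.Sum.Function.Propositional using (_⊎-↔_)
open import Data.Sum.Properties using (inj₁-injective; inj₂-injective)
open import Data.Unit.Base using (tt)
open import Data.Vec.Base using (tabulate; lookup)
open import Data.Vec.Properties using (lookup∘tabulate; []=⇒lookup; lookup⇒[]=; lookup-zipWith; tabulate∘lookup; tabulate-cong)
open import Function.Base using (_∘_; const; id)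
open import Function.Bundles using (_↔_; Equivalence; Inverse)
open import Function.Definitions using (Injective)
open import Function.Properties.Inverse using (↔-refl; ↔-trans)
open import Relation.Binary.Definitions using (tri<; tri≈; tri>)
open import Relation.Binary.PropositionalEquality using (_≡_; _≢_; refl; sym; trans; cong; cong₂; subst; subst₂; module ≡-Reasoning)
open import Relation.Nullary using (¬_; Dec; yes; no)
open import Relation.Nullary.Decidable using (⌊_⌋; map′; ¬?; _×-dec_; _→-dec_; decidable-stable)
open Algebra.Properties.Semiring.Sum +-*-semiring using (sum; sum-cong-≗; ∑-distrib-+; ∑-comm; *-distribʳ-sum)

-- Each lower bound has to let the pairs `xᵢ y_w` follow every pattern without creating a copy. To
-- this end any two gadgets `i` and `w` (for the star, together with the `t - 1` vertices that see
-- every gadget of the first side) are one edge short of `K r s t`. If `i ∉ w`, the missing edge is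
-- `xᵢ y_w`; if `i ∈ w`, the defect moves to an equivalent place, the other value of `omitted`, and
-- `xᵢ y_w` becomes an edge. So the planted graph is free whatever the pattern, while each wanted
-- nonedge is forced. The case `s = 1` needs its own upper bound because the pentagon argument
-- starts at density 2/5: `s/(2s+1)` is at least 2/5 from `s = 2` on, but 1/3 is below it. The bound
-- `2s - 2` comes from a count. When degrees inside the sides are at most `s - 1`, a copy created by
-- a cross edge has, besides its centre, at most `3(s - 1)` vertices. This rules it out exactly when
-- `s + t > 3(s - 1)`; for smaller `t` there is room for the gadgets of `Thin`.

private variable
  k m n : ℕ

-- Counting in Fin n

⟦_⟧ : Bool → ℕ
⟦ true ⟧  = 1
⟦ false ⟧ = 0

-- Sets are Boolean predicates and sizes are sums of indicators, so that counting inequalities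
-- reduce to pointwise ones and double counting to exchanging two sums.
# : (Fin n → Bool) → ℕ
# p = sum (λ i → ⟦ p i ⟧)

_⊑_ : (p q : Fin n → Bool) → Set
p ⊑ q = ∀ i → p i ≡ true → q i ≡ true

infix 4 _⊑_
infixr 7 _∩_

_∩_ : (p q : Fin n → Bool) → Fin n → Bool
(p ∩ q) i = p i ∧ q i

true≢false : ∀ {b} → b ≡ true → b ≡ false → ⊥
true≢false refl ()

≢true⇒false : ∀ {b} → ¬ (b ≡ true) → b ≡ false
≢true⇒false {true}  b≢ = ⊥-elim (b≢ refl)
≢true⇒false {false} _  = refl

sum-mono : {f g : Fin n → ℕ} → (∀ i → f i ≤ g i) → sum f ≤ sum g
sum-mono {zero}  f≤g = z≤n
sum-mono {suc n} f≤g = +-mono-≤ (f≤g zero) (sum-mono (f≤g ∘ suc))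

sum-const : ∀ n c → sum {n} (λ _ → c) ≡ n * c
sum-const zero    c = refl
sum-const (suc n) c = cong (c ℕ.+_) (sum-const n c)

⟦⟧≤1 : ∀ b → ⟦ b ⟧ ≤ 1
⟦⟧≤1 true  = ≤-refl
⟦⟧≤1 false = z≤n

#≤n : (p : Fin n → Bool) → # p ≤ n
#≤n {n} p = ≤-trans (sum-mono (λ i → ⟦⟧≤1 (p i))) (≤-reflexive (trans (sum-const n 1) (*-identityʳ n)))

#-mono : {p q : Fin n → Bool} → p ⊑ q → # p ≤ # q
#-mono {p = p} {q} p⊑q = sum-mono pointwise
  where
  pointwise : ∀ i → ⟦ p i ⟧ ≤ ⟦ q i ⟧
  pointwise i with p i in eq
  ... | false = z≤n
  ... | true rewrite p⊑q i eq = ≤-refl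

#-cong : {p q : Fin n → Bool} → (∀ i → p i ≡ q i) → # p ≡ # q
#-cong p≗q = sum-cong-≗ (λ i → cong ⟦_⟧ (p≗q i))

#-full : {p : Fin n → Bool} → (∀ i → p i ≡ true) → # p ≡ n
#-full {zero}  all = refl
#-full {suc n} all rewrite all zero = cong suc (#-full (all ∘ suc))

#-split : (p q : Fin n → Bool) → # p ≡ # (p ∩ q) + # (p ∩ (not ∘ q))
#-split {n} p q = trans (sum-cong-≗ (λ i → pointwise (p i) (q i))) (∑-distrib-+ {n} _ _)
  where
  pointwise : ∀ a b → ⟦ a ⟧ ≡ ⟦ a ∧ b ⟧ + ⟦ a ∧ not b ⟧
  pointwise false _     = refl
  pointwise true  true  = refl
  pointwise true  false = refl

#-∪ : {p q r : Fin n → Bool} → (∀ i → p i ≡ true → q i ≡ true ⊎ r i ≡ true) → # p ≤ # q + # r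
#-∪ {n} {p} {q} {r} cover = ≤-trans (sum-mono pointwise) (≤-reflexive (∑-distrib-+ {n} _ _))
  where
  pointwise : ∀ i → ⟦ p i ⟧ ≤ ⟦ q i ⟧ + ⟦ r i ⟧
  pointwise i with p i in eq
  ... | false = z≤n
  ... | true with cover i eq
  ...   | inj₁ qi rewrite qi = s≤s z≤n
  ...   | inj₂ ri rewrite ri = m≤n+m 1 _

-- Lets an inequality between indicators be settled by evaluating its truth table instead of
-- splitting into cases.
∀ᵇ : (Bool → Bool) → Bool
∀ᵇ P = P true ∧ P false

∀ᵇ-sound : ∀ P → T (∀ᵇ P) → ∀ b → T (P b)
∀ᵇ-sound P all true  = proj₁ (Equivalence.to T-∧ all)
∀ᵇ-sound P all false = proj₂ (Equivalence.to (T-∧ {P true}) all)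

sum₃ : (f g h : Fin n → ℕ) → sum (λ i → f i + (g i + h i)) ≡ sum f + (sum g + sum h)
sum₃ {n} f g h = trans (∑-distrib-+ {n} f _) (cong (sum f ℕ.+_) (∑-distrib-+ {n} g h))

sum₅ : (f g h k l : Fin n → ℕ) → sum (λ i → f i + (g i + (h i + (k i + l i)))) ≡ sum f + (sum g + (sum h + (sum k + sum l)))
sum₅ {n} f g h k l = trans (∑-distrib-+ {n} f _) (cong (sum f ℕ.+_) (trans (∑-distrib-+ {n} g _) (cong (sum g ℕ.+_) (sum₃ h k l))))

sum-const-+ : ∀ c (f : Fin n → ℕ) → sum (λ i → c + f i) ≡ c * n + sum f
sum-const-+ {n} c f = trans (∑-distrib-+ {n} (λ _ → c) f) (cong (_+ sum f) (trans (sum-const n c) (*-comm n c)))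

#-3-cycle : (p q r : Fin n → Bool) →
  # p + (# q + # r) ≤ 1 * n + (# (p ∩ q) + (# (q ∩ r) + # (r ∩ p)))
#-3-cycle {n} p q r = begin
  # p + (# q + # r)                                       ≡⟨ sum₃ {n} _ _ _ ⟨
  sum (λ i → ⟦ p i ⟧ + (⟦ q i ⟧ + ⟦ r i ⟧))              ≤⟨ sum-mono (λ i → pointwise (p i) (q i) (r i)) ⟩
  sum (λ i → 1 + (⟦ (p ∩ q) i ⟧ + (⟦ (q ∩ r) i ⟧ + ⟦ (r ∩ p) i ⟧)))  ≡⟨ sum-const-+ {n} 1 _ ⟩
  1 * n + sum (λ i → ⟦ (p ∩ q) i ⟧ + (⟦ (q ∩ r) i ⟧ + ⟦ (r ∩ p) i ⟧)) ≡⟨ cong (1 * n ℕ.+_) (sum₃ {n} _ _ _) ⟩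
  1 * n + (# (p ∩ q) + (# (q ∩ r) + # (r ∩ p)))              ∎
  where
  open ≤-Reasoning
  -- The chosen vertices of a cycle, minus the edges between them, number at most the arcs they
  -- form: at most one on a triangle, and at most two on the pentagon below.
  pointwise : ∀ a b c → ⟦ a ⟧ + (⟦ b ⟧ + ⟦ c ⟧) ≤ 1 + (⟦ a ∧ b ⟧ + (⟦ b ∧ c ⟧ + ⟦ c ∧ a ⟧))
  pointwise a b c = ≤ᵇ⇒≤ _ _ (∀ᵇ-sound (test a b) (∀ᵇ-sound (λ b → ∀ᵇ (λ c → test a b c)) (∀ᵇ-sound (λ a → ∀ᵇ (λ b → ∀ᵇ (λ c → test a b c))) tt a) b) c)
    where
    test : Bool → Bool → Bool → Bool
    test a b c = (⟦ a ⟧ + (⟦ b ⟧ + ⟦ c ⟧)) ≤ᵇ (1 + (⟦ a ∧ b ⟧ + (⟦ b ∧ c ⟧ + ⟦ c ∧ a ⟧)))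

#-5-cycle : (p q r s t : Fin n → Bool) →
  # p + (# q + (# r + (# s + # t))) ≤ 2 * n + (# (p ∩ q) + (# (q ∩ r) + (# (r ∩ s) + (# (s ∩ t) + # (t ∩ p)))))
#-5-cycle {n} p q r s t = begin
  # p + (# q + (# r + (# s + # t)))                          ≡⟨ sum₅ {n} _ _ _ _ _ ⟨
  sum (λ i → left (p i) (q i) (r i) (s i) (t i))             ≤⟨ sum-mono (λ i → pointwise (p i) (q i) (r i) (s i) (t i)) ⟩
  sum (λ i → 2 + right (p i) (q i) (r i) (s i) (t i))        ≡⟨ sum-const-+ {n} 2 _ ⟩
  2 * n + sum (λ i → right (p i) (q i) (r i) (s i) (t i))    ≡⟨ cong (2 * n ℕ.+_) (sum₅ {n} _ _ _ _ _) ⟩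
  2 * n + (# (p ∩ q) + (# (q ∩ r) + (# (r ∩ s) + (# (s ∩ t) + # (t ∩ p))))) ∎
  where
  open ≤-Reasoning
  left right : (a b c d e : Bool) → ℕ
  left  a b c d e = ⟦ a ⟧ + (⟦ b ⟧ + (⟦ c ⟧ + (⟦ d ⟧ + ⟦ e ⟧)))
  right a b c d e = ⟦ a ∧ b ⟧ + (⟦ b ∧ c ⟧ + (⟦ c ∧ d ⟧ + (⟦ d ∧ e ⟧ + ⟦ e ∧ a ⟧)))
  test : (a b c d e : Bool) → Bool
  test a b c d e = left a b c d e ≤ᵇ (2 + right a b c d e)
  pointwise : ∀ a b c d e → left a b c d e ≤ 2 + right a b c d e
  pointwise a b c d e = ≤ᵇ⇒≤ _ _ (
    ∀ᵇ-sound (test a b c d) (∀ᵇ-sound (λ d → ∀ᵇ λ e → test a b c d e) (∀ᵇ-sound (λ c → ∀ᵇ λ d → ∀ᵇ λ e → test a b c d e) (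
    ∀ᵇ-sound (λ b → ∀ᵇ λ c → ∀ᵇ λ d → ∀ᵇ λ e → test a b c d e) (
    ∀ᵇ-sound (λ a → ∀ᵇ λ b → ∀ᵇ λ c → ∀ᵇ λ d → ∀ᵇ λ e → test a b c d e) tt a) b) c) d) e)

witness : (p : Fin n → Bool) → 0 < # p → ∃ λ i → p i ≡ true
witness {suc n} p 0<#p with p zero in eq
... | true  = zero , eq
... | false = let i , pi = witness (p ∘ suc) 0<#p in suc i , pi

0<# : {p : Fin n → Bool} (i : Fin n) → p i ≡ true → 0 < # p
0<# zero    pi rewrite pi = s≤s z≤n
0<# {p = p} (suc i) pi = ≤-trans (0<# {p = p ∘ suc} i pi) (m≤n+m _ ⟦ p zero ⟧)

enumerate : (p : Fin n → Bool) → Fin (# p) → Fin n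
enumerate {suc n} p i with p zero
enumerate {suc n} p zero    | true  = zero
enumerate {suc n} p (suc i) | true  = suc (enumerate (p ∘ suc) i)
enumerate {suc n} p i       | false = suc (enumerate (p ∘ suc) i)

enumerate-∈ : (p : Fin n → Bool) (i : Fin (# p)) → p (enumerate p i) ≡ true
enumerate-∈ {suc n} p i with p zero in eq
enumerate-∈ {suc n} p zero    | true  = eq
enumerate-∈ {suc n} p (suc i) | true  = enumerate-∈ (p ∘ suc) i
enumerate-∈ {suc n} p i       | false = enumerate-∈ (p ∘ suc) i

enumerate-injective : (p : Fin n → Bool) → Injective _≡_ _≡_ (enumerate p)
enumerate-injective {suc n} p {i} {j} eq with p zero
enumerate-injective {suc n} p {zero}  {zero}  eq | true  = refl
enumerate-injective {suc n} p {suc i} {suc j} eq | true  = cong suc (enumerate-injective (p ∘ suc) (suc-injective eq))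
enumerate-injective {suc n} p {i}     {j}     eq | false = enumerate-injective (p ∘ suc) (suc-injective eq)

rank : (p : Fin n → Bool) (i : Fin n) → p i ≡ true → Fin (# p)
rank {suc n} p zero    pi = subst (λ b → Fin (⟦ b ⟧ + # (p ∘ suc))) (sym pi) zero
rank {suc n} p (suc i) pi = ⟦ p zero ⟧ ↑ʳ rank (p ∘ suc) i pi

rank-injective : (p : Fin n → Bool) (i j : Fin n) (pi : p i ≡ true) (pj : p j ≡ true) →
                 rank p i pi ≡ rank p j pj → i ≡ j
rank-injective {suc n} p zero    zero    pi pj eq = refl
rank-injective {suc n} p zero    (suc j) pi pj eq = ⊥-elim (first≢later pi _ eq)
  where
  first≢later : ∀ {b} (b≡ : b ≡ true) (x : Fin k) → subst (λ b → Fin (⟦ b ⟧ + k)) (sym b≡) zero ≢ ⟦ b ⟧ ↑ʳ x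
  first≢later refl x ()
rank-injective {suc n} p (suc i) zero    pi pj eq = sym (rank-injective p zero (suc i) pj pi (sym eq))
rank-injective {suc n} p (suc i) (suc j) pi pj eq = cong suc (rank-injective (p ∘ suc) i j pi pj (↑ʳ-injective ⟦ p zero ⟧ _ _ eq))

pick : (p : Fin n → Bool) → k ≤ # p →
       ∃ λ (f : Fin k → Fin n) → Injective _≡_ _≡_ f × (∀ i → p (f i) ≡ true)
pick p k≤ = (λ i → enumerate p (inject≤ i k≤))
  , (λ eq → inject≤-injective k≤ k≤ _ _ (enumerate-injective p eq))
  , (λ i → enumerate-∈ p (inject≤ i k≤))

#-injection : {p : Fin m → Bool} {q : Fin n → Bool} (f : Fin m → Fin n) →
              (∀ {i j} → p i ≡ true → p j ≡ true → f i ≡ f j → i ≡ j) →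
              (∀ i → p i ≡ true → q (f i) ≡ true) → # p ≤ # q
#-injection {p = p} {q} f f-inj p⇒q = injective⇒≤ {f = g} g-inj
  where
  g : Fin (# p) → Fin (# q)
  g i = rank q (f (enumerate p i)) (p⇒q _ (enumerate-∈ p i))
  g-inj : Injective _≡_ _≡_ g
  g-inj {i} {j} eq = enumerate-injective p (f-inj (enumerate-∈ p i) (enumerate-∈ p j) (rank-injective q _ _ _ _ eq))

≤# : {q : Fin n → Bool} (f : Fin k → Fin n) → Injective _≡_ _≡_ f → (∀ i → q (f i) ≡ true) → k ≤ # q
≤# {k = k} f f-inj q-f = subst (_≤ _) (#-full {k} {λ _ → true} (λ _ → refl)) (#-injection {p = λ _ → true} f (λ _ _ → f-inj) (λ i _ → q-f i))

#-+ : ∀ m {n} (p : Fin (m + n) → Bool) → # p ≡ # (λ i → p (i ↑ˡ n)) + # (λ j → p (m ↑ʳ j))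
#-+ zero    p = refl
#-+ (suc m) p = trans (cong (⟦ p zero ⟧ ℕ.+_) (#-+ m (p ∘ suc))) (sym (+-assoc ⟦ p zero ⟧ _ _))

-- Each of the `M` relations splits the current set in two, and one of the two halves keeps more
-- than half of the lower bound; this costs the factor `2 ^ M`.
homogeneous : ∀ M (R : Fin M → Fin n → Bool) (p : Fin n → Bool) c → c * 2 ^ M < # p →
  ∃ λ p′ → c < # p′ × p′ ⊑ p × (∀ i u v → p′ u ≡ true → p′ v ≡ true → R i u ≡ R i v)
homogeneous zero    R p c c<#p = p , subst (_< # p) (*-identityʳ c) c<#p , (λ _ pi → pi) , λ ()
homogeneous (suc M) R p c c<#p with c * 2 ^ M <? # (p ∩ R zero)
... | yes big =
  let p′ , c<#p′ , p′⊑ , same = homogeneous M (R ∘ suc) (p ∩ R zero) c big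
  in  p′ , c<#p′ , (λ i p′i → ∧-conicalˡ _ _ (p′⊑ i p′i)) , λ where
        zero    u v p′u p′v → trans (∧-conicalʳ (p u) _ (p′⊑ u p′u)) (sym (∧-conicalʳ (p v) _ (p′⊑ v p′v)))
        (suc i) u v p′u p′v → same i u v p′u p′v
... | no ¬big =
  let p′ , c<#p′ , p′⊑ , same = homogeneous M (R ∘ suc) (p ∩ (not ∘ R zero)) c big
  in  p′ , c<#p′ , (λ i p′i → ∧-conicalˡ _ _ (p′⊑ i p′i)) , λ where
        zero    u v p′u p′v → not-injective (trans (∧-conicalʳ (p u) _ (p′⊑ u p′u)) (sym (∧-conicalʳ (p v) _ (p′⊑ v p′v))))
        (suc i) u v p′u p′v → same i u v p′u p′v
  where
  big : c * 2 ^ M < # (p ∩ (not ∘ R zero))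
  big = +-cancelˡ-< (c * 2 ^ M) _ _ (begin-strict
    c * 2 ^ M + c * 2 ^ M       ≡⟨ cong (c * 2 ^ M ℕ.+_) (+-identityʳ (c * 2 ^ M)) ⟨
    2 * (c * 2 ^ M)             ≡⟨ trans (sym (*-assoc 2 c _)) (trans (cong (_* 2 ^ M) (*-comm 2 c)) (*-assoc c 2 _)) ⟩
    c * 2 ^ suc M               <⟨ c<#p ⟩
    # p                         ≡⟨ #-split p (R zero) ⟩
    # (p ∩ R zero) + # (p ∩ (not ∘ R zero)) ≤⟨ +-monoˡ-≤ _ (≮⇒≥ ¬big) ⟩
    c * 2 ^ M + # (p ∩ (not ∘ R zero)) ∎)
    where open ≤-Reasoning

-- The Kővári–Sós–Turán argument: average to find many points of U lying in
-- more than k of the sets, then pigeonhole on which ones.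
common-points : ∀ M (R : Fin M → Fin n → Bool) (U : Fin n → Bool) k c D →
  (∀ i → R i ⊑ U) → (∀ i → D ≤ # (R i)) → # U * k + c * 2 ^ M * M < M * D →
  ∃₂ λ (J : Fin M → Bool) (W : Fin n → Bool) → k < # J × c < # W ×
    (∀ i u → J i ≡ true → W u ≡ true → R i u ≡ true)
common-points {n} M R U k c D R⊑U D≤ large = result
  where
  mult : Fin n → ℕ
  mult u = # (λ i → R i u)

  rich : Fin n → Bool
  rich u = k <ᵇ mult u

  mult≤ : ∀ u → mult u ≤ ⟦ U u ⟧ * k + ⟦ rich u ⟧ * M
  mult≤ u with U u in Uu
  ... | false = ≤-trans (≤-reflexive (trans (#-cong {M} {λ i → R i u} {λ _ → false}
                  (λ i → ≢true⇒false (λ Riu → true≢false (R⊑U i u Riu) Uu))) (trans (sum-const M 0) (*-zeroʳ M)))) z≤n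
  ... | true with k <ᵇ mult u in eq
  ...   | true  = ≤-trans (#≤n (λ i → R i u)) (≤-trans (≤-reflexive (sym (*-identityˡ M))) (m≤n+m _ (1 * k)))
  ...   | false = ≤-trans (≮⇒≥ (λ k< → true≢false (T⇒true (<⇒<ᵇ k<)) eq)) (≤-trans (≤-reflexive (sym (*-identityˡ k))) (m≤m+n _ _))
    where
    T⇒true : ∀ {b} → T b → b ≡ true
    T⇒true {true} _ = refl

  total : M * D ≤ # U * k + # rich * M
  total = begin
    M * D                                ≡⟨ sum-const M D ⟨
    sum {M} (λ _ → D)                    ≤⟨ sum-mono D≤ ⟩
    sum {M} (λ i → # (R i))              ≡⟨ ∑-comm {M} {n} (λ i u → ⟦ R i u ⟧) ⟩
    sum {n} mult                         ≤⟨ sum-mono mult≤ ⟩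
    sum {n} (λ u → ⟦ U u ⟧ * k + ⟦ rich u ⟧ * M)  ≡⟨ ∑-distrib-+ {n} _ _ ⟩
    sum {n} (λ u → ⟦ U u ⟧ * k) + sum {n} (λ u → ⟦ rich u ⟧ * M)
      ≡⟨ cong₂ _+_ (*-distribʳ-sum {n} k _) (*-distribʳ-sum {n} M _) ⟨
    # U * k + # rich * M                 ∎
    where open ≤-Reasoning

  many-rich : c * 2 ^ M < # rich
  many-rich = ≰⇒> λ few → <-irrefl refl (<-≤-trans large (≤-trans total (+-monoʳ-≤ (# U * k) (*-monoˡ-≤ M few))))

  result : ∃₂ λ (J : Fin M → Bool) (W : Fin n → Bool) → k < # J × c < # W ×
    (∀ i u → J i ≡ true → W u ≡ true → R i u ≡ true)
  result =
    let W , c<#W , W⊑rich , same = homogeneous M R rich c many-rich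
        u₀ , Wu₀ = witness W (≤-<-trans z≤n c<#W)
    -- All points of `W` lie in the same sets, so a single point `u₀` of it determines `J`; richness
    -- of `u₀` makes `J` large.
    in  (λ i → R i u₀) , W , <ᵇ⇒< k _ (subst T (sym (W⊑rich u₀ Wu₀)) tt) , c<#W ,
        λ i u Riu₀ Wu → trans (same i u u₀ Wu Wu₀) Riu₀

-- Graphs, VC-dimension and maximal extensions

∣tabulate∣ : (p : Fin n → Bool) → ∣ tabulate p ∣ ≡ # p
∣tabulate∣ {zero}  p = refl
∣tabulate∣ {suc n} p with p zero
... | true  = cong suc (∣tabulate∣ (p ∘ suc))
... | false = ∣tabulate∣ (p ∘ suc)

δ≤# : (G : Graph n) (v : Fin n) → δ G ≤ # (adj G v)
δ≤# {n} G v = subst (δ G ≤_) (∣tabulate∣ (adj G v)) (All.lookup (min≤xs n _) (∈-map⁺ (degree G) (∈-allFin v)))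

≤δ : (G : Graph n) → k ≤ n → (∀ v → k ≤ # (adj G v)) → k ≤ δ G
≤δ {n} G k≤n k≤# = v≤min⁺ k≤n (All.map⁺ {xs = allFin n} (All.tabulate (λ {v} _ → subst (_ ≤_) (sym (∣tabulate∣ (adj G v))) (k≤# v))))

∣∣≡# : (S : Subset n) → ∣ S ∣ ≡ # (lookup S)
∣∣≡# S = trans (cong ∣_∣ (sym (tabulate∘lookup S))) (∣tabulate∣ (lookup S))

realise : (G : Graph n) {S : Subset n} → Shattered G S → (p : Fin n → Bool) →
          ∃ λ v → ∀ x → lookup S x ≡ true → adj G v x ≡ p x
realise G {S} shattered p = let v , N∩S≡ = shattered (tabulate (p ∩ lookup S)) sub in v , λ x Sx → at x Sx v N∩S≡
  where
  sub : tabulate (p ∩ lookup S) ⊆ S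
  sub {x} x∈ = lookup⇒[]= x S (∧-conicalʳ (p x) _ (trans (sym (lookup∘tabulate (p ∩ lookup S) x)) ([]=⇒lookup x∈)))
  at : ∀ x → lookup S x ≡ true → ∀ v → N G v ∩ˢ S ≡ tabulate (p ∩ lookup S) → adj G v x ≡ p x
  at x Sx v N∩S≡ = begin
    adj G v x                            ≡⟨ ∧-identityʳ _ ⟨
    adj G v x ∧ true                     ≡⟨ cong₂ _∧_ (lookup∘tabulate (adj G v) x) Sx ⟨
    lookup (N G v) x ∧ lookup S x        ≡⟨ lookup-zipWith _∧_ x (N G v) S ⟨
    lookup (N G v ∩ˢ S) x                ≡⟨ cong (λ R → lookup R x) N∩S≡ ⟩
    lookup (tabulate (p ∩ lookup S)) x   ≡⟨ lookup∘tabulate (p ∩ lookup S) x ⟩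
    p x ∧ lookup S x                     ≡⟨ cong (p x ∧_) Sx ⟩
    p x ∧ true                           ≡⟨ ∧-identityʳ _ ⟩
    p x                                  ∎
    where open ≡-Reasoning

VC≤ : (G : Graph n) → ∀ C → (∀ S → Shattered G S → ∣ S ∣ ≤ C) → VC G ≤ C
VC≤ {n} G C bound = max≤v⁺ z≤n (All.map (λ (S , ∣S∣≡k , sh) → subst (_≤ C) ∣S∣≡k (bound S sh))
  (All.all-filter (hasShattered? G) (upTo (suc n))))

VC≤n : (G : Graph n) → VC G ≤ n
VC≤n {n} G = VC≤ G n (λ S _ → ∣p∣≤n S)

≤VC : ∀ {d} (G : Graph n) (x : Fin d → Fin n) → Injective _≡_ _≡_ x →
      (∀ f → ∃ λ v → ∀ i → adj G v (x i) ≡ f i) → d ≤ VC G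
≤VC {n} {d} G x x-inj pattern′ = ≤-trans d≤∣S∣ (All.lookup (xs≤max 0 _)
  (∈-filter⁺ (hasShattered? G) (∈-upTo⁺ (s≤s (∣p∣≤n S))) (S , refl , shattered)))
  where
  inS : Fin n → Bool
  inS u = ⌊ any? (λ i → x i ≟ᶠ u) ⌋
  S : Subset n
  S = tabulate inS
  inS⇒ : ∀ {u} → inS u ≡ true → ∃ λ i → x i ≡ u
  inS⇒ {u} eq with any? (λ i → x i ≟ᶠ u)
  ... | yes p = p
  inS⇐ : ∀ i → inS (x i) ≡ true
  inS⇐ i with any? (λ j → x j ≟ᶠ x i)
  ... | yes _ = refl
  ... | no ¬p = ⊥-elim (¬p (i , refl))
  d≤∣S∣ : d ≤ ∣ S ∣
  d≤∣S∣ = subst (d ≤_) (sym (∣tabulate∣ inS)) (≤# x x-inj inS⇐)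
  shattered : Shattered G S
  shattered R R⊆S = let v , v-pattern = pattern′ (lookup R ∘ x) in v , (begin
      N G v ∩ˢ S                       ≡⟨ tabulate∘lookup _ ⟨
      tabulate (lookup (N G v ∩ˢ S))   ≡⟨ tabulate-cong (pointwise v v-pattern) ⟩
      tabulate (lookup R)              ≡⟨ tabulate∘lookup R ⟩
      R                                ∎)
    where
    open ≡-Reasoning
    pointwise : ∀ v → (∀ i → adj G v (x i) ≡ lookup R (x i)) → ∀ u → lookup (N G v ∩ˢ S) u ≡ lookup R u
    pointwise v eq u rewrite lookup-zipWith _∧_ u (N G v) S | lookup∘tabulate (adj G v) u | lookup∘tabulate inS u
      with inS u in inSu
    ... | true with i , refl ← inS⇒ {u} inSu = trans (∧-identityʳ _) (eq i)
    ... | false with lookup R u in Ru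
    ...   | false = ∧-zeroʳ _
    ...   | true  = ⊥-elim (true≢false (trans (sym (lookup∘tabulate inS u)) ([]=⇒lookup (R⊆S (lookup⇒[]= u R Ru)))) inSu)

edge-≢ : (G : Graph n) {u v : Fin n} → adj G u v ≡ true → u ≢ v
edge-≢ G {u} uv refl = true≢false uv (adj-irrefl G u)

edge-sym : (G : Graph n) {u v : Fin n} → adj G u v ≡ true → adj G v u ≡ true
edge-sym G {u} {v} uv = trans (adj-sym G v u) uv

-- Repeats the colour function local to `K` with the same body, so that `adj (K r s t)` computes
-- through it.
part : ∀ r s t → Fin (r + s + t) → Fin 3
part r s t v = [ (λ w → [ const zero , const (suc zero) ]′ (splitAt r w))
               , const (suc (suc zero)) ]′ (splitAt (r + s) v)

inPart : ∀ r s t → Fin 3 → Fin (r + s + t) → Bool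
inPart r s t c v = ⌊ part r s t v ≟ᶠ c ⌋

partSize : ℕ → ℕ → ℕ → Fin 3 → ℕ
partSize r s t zero             = r
partSize r s t (suc zero)       = s
partSize r s t (suc (suc zero)) = t

inPart⇒ : ∀ r s t {c} v → inPart r s t c v ≡ true → part r s t v ≡ c
inPart⇒ r s t {c} v eq with part r s t v ≟ᶠ c
... | yes p = p

⇒inPart : ∀ r s t {c} v → part r s t v ≡ c → inPart r s t c v ≡ true
⇒inPart r s t {c} v eq with part r s t v ≟ᶠ c
... | yes _ = refl
... | no ¬p = ⊥-elim (¬p eq)

K-edge : ∀ r s t u v → part r s t u ≢ part r s t v → adj (K r s t) u v ≡ true
K-edge r s t u v ≢ with part r s t u ≟ᶠ part r s t v
... | yes p = ⊥-elim (≢ p)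
... | no _  = refl

K-edge⁻ : ∀ r s t u v → adj (K r s t) u v ≡ true → part r s t u ≢ part r s t v
K-edge⁻ r s t u v uv with part r s t u ≟ᶠ part r s t v
... | no ¬p = ¬p

#inPart : ∀ r s t c → # (inPart r s t c) ≡ partSize r s t c
#inPart r s t c = begin
  # (inPart r s t c)
    ≡⟨ #-+ (r + s) _ ⟩
  # (λ i → inPart r s t c (i ↑ˡ t)) + # (λ i → inPart r s t c ((r + s) ↑ʳ i))
    ≡⟨ cong₂ _+_ (#-+ r _) (#-cong {t} (λ i → cong (λ w → ⌊ w ≟ᶠ c ⌋) (part₂ i))) ⟩
  # (λ i → inPart r s t c ((i ↑ˡ s) ↑ˡ t)) + # (λ i → inPart r s t c ((r ↑ʳ i) ↑ˡ t)) + # {t} (λ _ → ⌊ suc (suc zero) ≟ᶠ c ⌋)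
    ≡⟨ cong (_+ # {t} (λ _ → ⌊ suc (suc zero) ≟ᶠ c ⌋)) (cong₂ _+_ (#-cong {r} (λ i → cong (λ w → ⌊ w ≟ᶠ c ⌋) (part₀ i))) (#-cong {s} (λ i → cong (λ w → ⌊ w ≟ᶠ c ⌋) (part₁ i)))) ⟩
  # {r} (λ _ → ⌊ zero ≟ᶠ c ⌋) + # {s} (λ _ → ⌊ suc zero ≟ᶠ c ⌋) + # {t} (λ _ → ⌊ suc (suc zero) ≟ᶠ c ⌋)
    ≡⟨ total c ⟩
  partSize r s t c ∎
  where
  open ≡-Reasoning
  part₀ : ∀ i → part r s t ((i ↑ˡ s) ↑ˡ t) ≡ zero
  part₀ i rewrite splitAt-↑ˡ (r + s) (i ↑ˡ s) t | splitAt-↑ˡ r i s = refl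
  part₁ : ∀ i → part r s t ((r ↑ʳ i) ↑ˡ t) ≡ suc zero
  part₁ i rewrite splitAt-↑ˡ (r + s) (r ↑ʳ i) t | splitAt-↑ʳ r s i = refl
  part₂ : ∀ i → part r s t ((r + s) ↑ʳ i) ≡ suc (suc zero)
  part₂ i rewrite splitAt-↑ʳ (r + s) t i = refl
  all-in : ∀ n → # {n} (λ _ → true) ≡ n
  all-in n = #-full {n} (λ _ → refl)
  none-in : ∀ n → # {n} (λ _ → false) ≡ 0
  none-in zero    = refl
  none-in (suc n) = none-in n
  total : ∀ c → # {r} (λ _ → ⌊ zero ≟ᶠ c ⌋) + # {s} (λ _ → ⌊ suc zero ≟ᶠ c ⌋) + # {t} (λ _ → ⌊ suc (suc zero) ≟ᶠ c ⌋) ≡ partSize r s t c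
  total zero             rewrite all-in r | none-in s | none-in t = trans (+-identityʳ _) (+-identityʳ r)
  total (suc zero)       rewrite none-in r | all-in s | none-in t = +-identityʳ s
  total (suc (suc zero)) rewrite none-in r | none-in s | all-in t = refl

-- Injectivity is asked only within each class: vertices of different classes are joined, hence have
-- distinct images.
K-copy : ∀ {r s t} (G : Graph n) (f₀ : Fin r → Fin n) (f₁ : Fin s → Fin n) (f₂ : Fin t → Fin n) →
  Injective _≡_ _≡_ f₀ → Injective _≡_ _≡_ f₁ → Injective _≡_ _≡_ f₂ →
  (∀ i j → adj G (f₀ i) (f₁ j) ≡ true) → (∀ i j → adj G (f₀ i) (f₂ j) ≡ true) →
  (∀ i j → adj G (f₁ i) (f₂ j) ≡ true) → Contains (K r s t) G
K-copy {n} {r} {s} {t} G f₀ f₁ f₂ inj₀ inj₁′ inj₂′ e₀₁ e₀₂ e₁₂ =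
  emb ∘ locate , (λ eq → locate-inj (emb-inj _ _ eq)) , edges
  where
  Place : Set
  Place = (Fin r ⊎ Fin s) ⊎ Fin t
  locate : Fin (r + s + t) → Place
  locate v = map₁ (splitAt r) (splitAt (r + s) v)
  unlocate : Place → Fin (r + s + t)
  unlocate w = join (r + s) t (map₁ (join r s) w)
  unlocate-locate : ∀ v → unlocate (locate v) ≡ v
  unlocate-locate v with splitAt (r + s) v in eq
  ... | inj₁ w = trans (cong (_↑ˡ t) (join-splitAt r s w)) (trans (cong (join (r + s) t) (sym eq)) (join-splitAt (r + s) t v))
  ... | inj₂ w = trans (cong (join (r + s) t) (sym eq)) (join-splitAt (r + s) t v)
  locate-inj : ∀ {u v} → locate u ≡ locate v → u ≡ v
  locate-inj {u} {v} eq = trans (sym (unlocate-locate u)) (trans (cong unlocate eq) (unlocate-locate v))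
  emb : Place → Fin n
  emb (inj₁ (inj₁ i)) = f₀ i
  emb (inj₁ (inj₂ i)) = f₁ i
  emb (inj₂ i)        = f₂ i
  emb-inj : ∀ x y → emb x ≡ emb y → x ≡ y
  emb-inj (inj₁ (inj₁ i)) (inj₁ (inj₁ j)) eq = cong (inj₁ ∘ inj₁) (inj₀ eq)
  emb-inj (inj₁ (inj₁ i)) (inj₁ (inj₂ j)) eq = ⊥-elim (edge-≢ G (e₀₁ i j) eq)
  emb-inj (inj₁ (inj₁ i)) (inj₂ j)        eq = ⊥-elim (edge-≢ G (e₀₂ i j) eq)
  emb-inj (inj₁ (inj₂ i)) (inj₁ (inj₁ j)) eq = ⊥-elim (edge-≢ G (e₀₁ j i) (sym eq))
  emb-inj (inj₁ (inj₂ i)) (inj₁ (inj₂ j)) eq = cong (inj₁ ∘ inj₂) (inj₁′ eq)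
  emb-inj (inj₁ (inj₂ i)) (inj₂ j)        eq = ⊥-elim (edge-≢ G (e₁₂ i j) eq)
  emb-inj (inj₂ i)        (inj₁ (inj₁ j)) eq = ⊥-elim (edge-≢ G (e₀₂ j i) (sym eq))
  emb-inj (inj₂ i)        (inj₁ (inj₂ j)) eq = ⊥-elim (edge-≢ G (e₁₂ j i) (sym eq))
  emb-inj (inj₂ i)        (inj₂ j)        eq = cong inj₂ (inj₂′ eq)
  class : Place → Fin 3
  class (inj₁ (inj₁ _)) = zero
  class (inj₁ (inj₂ _)) = suc zero
  class (inj₂ _)        = suc (suc zero)
  part≡class : ∀ v → part r s t v ≡ class (locate v)
  part≡class v with splitAt (r + s) v
  ... | inj₂ _ = refl
  ... | inj₁ w with splitAt r w
  ...   | inj₁ _ = refl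
  ...   | inj₂ _ = refl
  emb-edge : ∀ x y → class x ≢ class y → adj G (emb x) (emb y) ≡ true
  emb-edge (inj₁ (inj₁ i)) (inj₁ (inj₁ j)) ≢ = ⊥-elim (≢ refl)
  emb-edge (inj₁ (inj₁ i)) (inj₁ (inj₂ j)) ≢ = e₀₁ i j
  emb-edge (inj₁ (inj₁ i)) (inj₂ j)        ≢ = e₀₂ i j
  emb-edge (inj₁ (inj₂ i)) (inj₁ (inj₁ j)) ≢ = edge-sym G (e₀₁ j i)
  emb-edge (inj₁ (inj₂ i)) (inj₁ (inj₂ j)) ≢ = ⊥-elim (≢ refl)
  emb-edge (inj₁ (inj₂ i)) (inj₂ j)        ≢ = e₁₂ i j
  emb-edge (inj₂ i)        (inj₁ (inj₁ j)) ≢ = edge-sym G (e₀₂ j i)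
  emb-edge (inj₂ i)        (inj₁ (inj₂ j)) ≢ = edge-sym G (e₁₂ j i)
  emb-edge (inj₂ i)        (inj₂ j)        ≢ = ⊥-elim (≢ refl)
  edges : ∀ u v → adj (K r s t) u v ≡ true → adj G (emb (locate u)) (emb (locate v)) ≡ true
  edges u v uv = emb-edge _ _ (λ eq → K-edge⁻ r s t u v uv (trans (part≡class u) (trans eq (sym (part≡class v)))))

-- A function rebuilt from its values agrees with the original only pointwise, whence `resp`.
any-function? : ∀ m {n} (P : (Fin m → Fin n) → Set) → (∀ {f g} → (∀ i → f i ≡ g i) → P f → P g) →
                (∀ f → Dec (P f)) → Dec (∃ P)
any-function? zero {n} P resp P? = map′ (λ p → empty , p) (λ (f , p) → resp (λ ()) p) (P? empty)
  where
  empty : Fin 0 → Fin n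
  empty ()
any-function? (suc m) {n} P resp P? = map′
  (λ (x , f , p) → cons x f , p)
  (λ (f , p) → f zero , f ∘ suc , resp (λ { zero → refl ; (suc i) → refl }) p)
  (any? λ x → any-function? m (P ∘ cons x) (λ f≗g → resp λ { zero → refl ; (suc i) → f≗g i }) (P? ∘ cons x))
  where
  cons : Fin n → (Fin m → Fin n) → Fin (suc m) → Fin n
  cons x f zero    = x
  cons x f (suc i) = f i

-- Decidability is what allows a maximal extension to be built by testing one pair after another.
contains? : (H : Graph m) (G : Graph n) → Dec (Contains H G)
contains? {m} H G = map′
  (λ (f , inj , hom) → f , (λ {x} {y} → inj x y) , hom)
  (λ (f , inj , hom) → f , (λ x y → inj {x} {y}) , hom)
  (any-function? m _
    (λ f≗g (inj , hom) → (λ x y eq → inj x y (trans (f≗g x) (trans eq (sym (f≗g y)))))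
                       , (λ x y xy → subst (_≡ true) (cong₂ (adj G) (f≗g x) (f≗g y)) (hom x y xy)))
    (λ f → all? (λ x → all? λ y → (f x ≟ᶠ f y) →-dec (x ≟ᶠ y))
           ×-dec all? (λ x → all? λ y → (adj H x y ≟ᵇ true) →-dec (adj G (f x) (f y) ≟ᵇ true))))

_⊆ᴳ_ : (G G′ : Graph n) → Set
G ⊆ᴳ G′ = ∀ u v → adj G u v ≡ true → adj G′ u v ≡ true

Contains-mono : (H : Graph m) {G G′ : Graph n} → G ⊆ᴳ G′ → Contains H G → Contains H G′
Contains-mono H G⊆ (f , inj , hom) = f , inj , λ u v uv → G⊆ _ _ (hom u v uv)

addEdge-⊇ : (G : Graph n) (u v : Fin n) (u≢v : u ≢ v) → G ⊆ᴳ addEdge G u v u≢v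
addEdge-⊇ G u v u≢v x y xy rewrite xy = refl

addEdge-mono : {G G′ : Graph n} → G ⊆ᴳ G′ → (u v : Fin n) (u≢v u≢v′ : u ≢ v) → addEdge G u v u≢v ⊆ᴳ addEdge G′ u v u≢v′
addEdge-mono {G = G} {G′} G⊆ u v _ _ x y eq with adj G x y in xy
... | true rewrite G⊆ x y xy = refl
... | false rewrite eq = ∨-zeroʳ (adj G′ x y)

addEdge-new : (G : Graph n) (u v : Fin n) (u≢v : u ≢ v) → adj (addEdge G u v u≢v) u v ≡ true
addEdge-new G u v u≢v with u ≟ᶠ u | v ≟ᶠ v
... | yes _ | yes _ = ∨-zeroʳ (adj G u v)
... | no ¬p | _     = ⊥-elim (¬p refl)
... | _     | no ¬p = ⊥-elim (¬p refl)

addEdge⁻ : (G : Graph n) (u v : Fin n) (u≢v : u ≢ v) → ∀ {x y} → adj (addEdge G u v u≢v) x y ≡ true →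
           adj G x y ≡ true ⊎ (x ≡ u × y ≡ v) ⊎ (x ≡ v × y ≡ u)
addEdge⁻ G u v u≢v {x} {y} eq with adj G x y | x ≟ᶠ u | y ≟ᶠ v | x ≟ᶠ v | y ≟ᶠ u
... | true  | _ | _ | _ | _ = inj₁ refl
... | false | yes p | yes q | _ | _ = inj₂ (inj₁ (p , q))
... | false | yes p | no _  | yes p′ | yes q′ = inj₂ (inj₂ (p′ , q′))
... | false | no _  | _ | yes p′ | yes q′ = inj₂ (inj₂ (p′ , q′))
... | false | yes _ | no _ | no _ | _ = ⊥-elim (true≢false eq refl)
... | false | yes _ | no _ | yes _ | no _ = ⊥-elim (true≢false eq refl)
... | false | no _ | _ | no _ | _ = ⊥-elim (true≢false eq refl)
... | false | no _ | _ | yes _ | no _ = ⊥-elim (true≢false eq refl)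

-- Greedy: a pair rejected at its turn stays rejected, as the graph only grows.
saturate : (H : Graph m) (G : Graph n) → H -Free G → (pairs : List (Fin n × Fin n)) →
  ∃ λ G′ → G ⊆ᴳ G′ × H -Free G′ ×
    (∀ {u v} → (u , v) ∈ˡ pairs → (u≢v : u ≢ v) → adj G′ u v ≡ false → Contains H (addEdge G′ u v u≢v))
saturate H G free [] = G , (λ _ _ uv → uv) , free , λ ()
saturate H G free ((u , v) ∷ pairs) with u ≟ᶠ v
... | yes u≡v =
  let G′ , G⊆ , free′ , sat = saturate H G free pairs
  in  G′ , G⊆ , free′ , λ { (here refl) u≢v → ⊥-elim (u≢v u≡v) ; (there p) → sat p }
... | no u≢v with contains? H (addEdge G u v u≢v)
...   | yes cont =
  let G′ , G⊆ , free′ , sat = saturate H G free pairs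
  in  G′ , G⊆ , free′ , λ where
        (here refl) u≢v′ _ → Contains-mono H {addEdge G u v u≢v} {addEdge G′ u v u≢v′} (addEdge-mono {G = G} {G′} G⊆ u v u≢v u≢v′) cont
        (there p)          → sat p
...   | no free⁺ =
  let G′ , G⊆ , free′ , sat = saturate H (addEdge G u v u≢v) free⁺ pairs
  in  G′ , (λ x y xy → G⊆ x y (addEdge-⊇ G u v u≢v x y xy)) , free′ , λ where
        (here refl) _ uv → ⊥-elim (true≢false (G⊆ u v (addEdge-new G u v u≢v)) uv)
        (there p)        → sat p

maximal-extension : (H : Graph m) (G : Graph n) → H -Free G → ∃ λ G′ → G ⊆ᴳ G′ × MaximalFree H G′
maximal-extension {n = n} H G free =
  let G′ , G⊆ , free′ , sat = saturate H G free (cartesianProduct (allFin n) (allFin n))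
  in  G′ , G⊆ , record { free = free′ ; maximal = λ u v → sat (∈-cartesianProduct⁺ (∈-allFin u) (∈-allFin v)) }

-- From integer bounds to the threshold

-- The degree hypothesis reads (a/b + 1/(b(m+1))) n ≤ δ with denominators cleared.
UpperBound : Graph k → ℕ → ℕ → Set
UpperBound H a b = ∀ m → ∃ λ C → ∀ n (G : Graph n) → MaximalFree H G →
  (a * suc m + 1) * n ≤ b * suc m * δ G → VC G ≤ C

-- The excess `c` does not depend on `N`, so the ratio of minimum degree to order passes every
-- number below `a/b` as `N` grows.
LowerBound : Graph k → ℕ → ℕ → Set
LowerBound H a b = ∀ d → ∃ λ c → ∀ N → ∃₂ λ n (G : Graph n) →
  MaximalFree H G × d ≤ VC G × a * N ≤ δ G × n ≤ b * N + c

toℚᵘ-fraction : ∀ a b → toℚᵘ (+ a ℚ./ suc b) ℚᵘ.≃ mkℚᵘ (+ a) b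
toℚᵘ-fraction a b = ℚ.toℚᵘ-fromℚᵘ (mkℚᵘ (+ a) b)

toℚᵘ-scaled : ∀ q n → toℚᵘ (q ℚ.* fromℕ n) ℚᵘ.≃ toℚᵘ q ℚᵘ.* mkℚᵘ (+ n) 0
toℚᵘ-scaled q n = ℚᵘ.≃-trans (ℚ.toℚᵘ-homo-* q (fromℕ n)) (ℚᵘ.*-congˡ {toℚᵘ q} (toℚᵘ-fraction n 0))

scaled≤⇒ : ∀ p m .(cop : Coprime p (suc m)) n d → mkℚ (+ p) m cop ℚ.* fromℕ n ℚ.≤ fromℕ d → p * n ≤ suc m * d
scaled≤⇒ p m cop n d le with ℚᵘ.≤-respʳ-≃ (toℚᵘ-fraction d 0) (ℚᵘ.≤-respˡ-≃ (toℚᵘ-scaled (mkℚ (+ p) m cop) n) (ℚ.toℚᵘ-mono-≤ le))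
... | ℚᵘ.*≤* le′ = subst₂ _≤_ (*-identityʳ (p * n)) (trans (cong (d *_) (*-identityʳ (suc m))) (*-comm d (suc m))) (ℤ.drop‿+≤+
  (subst₂ ℤ._≤_ (trans (cong (ℤ._* + 1) (sym (ℤ.pos-* p n))) (sym (ℤ.pos-* (p * n) 1))) (sym (ℤ.pos-* d _)) le′))

⇒scaled≤ : ∀ i m .(cop : Coprime ℤ.∣ i ∣ (suc m)) p n d → i ℤ.≤ + p → p * n ≤ suc m * d → mkℚ i m cop ℚ.* fromℕ n ℚ.≤ fromℕ d
⇒scaled≤ i m cop p n d i≤p le = ℚ.toℚᵘ-cancel-≤ (ℚᵘ.≤-respʳ-≃ (ℚᵘ.≃-sym (toℚᵘ-fraction d 0))
  (ℚᵘ.≤-respˡ-≃ (ℚᵘ.≃-sym (toℚᵘ-scaled (mkℚ i m cop) n)) (ℚᵘ.*≤* (begin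
    i ℤ.* + n ℤ.* + 1     ≡⟨ ℤ.*-identityʳ (i ℤ.* + n) ⟩
    i ℤ.* + n             ≤⟨ ℤ.*-monoʳ-≤-nonNeg (+ n) i≤p ⟩
    + p ℤ.* + n           ≡⟨ ℤ.pos-* p n ⟨
    + (p * n)             ≤⟨ ℤ.+≤+ le ⟩
    + (suc m * d)         ≡⟨ cong +_ (trans (*-comm (suc m) d) (cong (d *_) (sym (*-identityʳ (suc m))))) ⟩
    + (d * (suc m * 1))   ≡⟨ ℤ.pos-* d _ ⟩
    + d ℤ.* + (suc m * 1) ∎))))
  where open ℤ.≤-Reasoning

fraction<⇒ : ∀ a b q → + a ℚ./ suc b ℚ.< q → + a ℤ.* + ↧ₙ q ℤ.< ↥ q ℤ.* + suc b
fraction<⇒ a b q@record{} lt with ℚᵘ.<-respˡ-≃ (toℚᵘ-fraction a b) (ℚ.toℚᵘ-mono-< lt)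
... | ℚᵘ.*<* lt′ = lt′

<fraction⇒ : ∀ a b q → q ℚ.< + a ℚ./ suc b → ↥ q ℤ.* + suc b ℤ.< + a ℤ.* + ↧ₙ q
<fraction⇒ a b q@record{} lt with ℚᵘ.<-respʳ-≃ (toℚᵘ-fraction a b) (ℚ.toℚᵘ-mono-< lt)
... | ℚᵘ.*<* lt′ = lt′

numerator-bound : ∀ a b p m → + a ℤ.* + suc m ℤ.< + p ℤ.* + suc b → a * suc m < p * suc b
numerator-bound a b p m lt = ℤ.drop‿+<+ (subst₂ ℤ._<_ (sym (ℤ.pos-* a (suc m))) (sym (ℤ.pos-* p (suc b))) lt)

negative-numerator : ∀ a b p m → ¬ + a ℤ.* + suc m ℤ.< -[1+ p ] ℤ.* + suc b
negative-numerator a b p m lt with () ← subst (ℤ._< -[1+ p ] ℤ.* + suc b) (sym (ℤ.pos-* a (suc m))) lt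

-- A fraction `p/(m+1)` above `a/(b+1)` exceeds it by at least `1/((b+1)(m+1))`, exactly the slack
-- in `UpperBound`. The degree hypothesis for `q` speaks of rationals strictly below `q`, hence the
-- intermediate `q′`.
bounded-above : (H : Graph k) (a b : ℕ) → UpperBound H a (suc b) → ∀ q → + a ℚ./ suc b ℚ.< q → VCBoundedAt H (fromℚ q)
bounded-above H a b upper q x<q =
  let q′ , x<q′ , q′<q = ℚ.<-dense x<q in go q′ x<q′ q′<q
  where
  go : ∀ q′ → + a ℚ./ suc b ℚ.< q′ → q′ ℚ.< q → VCBoundedAt H (fromℚ q)
  go (mkℚ -[1+ p ] m cop) x<q′ q′<q = ⊥-elim (negative-numerator a b p m (fraction<⇒ a b _ x<q′))
  go (mkℚ (+ p) m cop) x<q′ q′<q =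
    let C , bound = upper m
    in  C , λ n G maxG dense → bound n G maxG (begin
      (a * suc m + 1) * n     ≤⟨ *-monoˡ-≤ n (≤-trans (≤-reflexive (+-comm (a * suc m) 1)) (numerator-bound a b p m (fraction<⇒ a b _ x<q′))) ⟩
      p * suc b * n           ≡⟨ trans (cong (_* n) (*-comm p (suc b))) (*-assoc (suc b) p n) ⟩
      suc b * (p * n)         ≤⟨ *-monoʳ-≤ (suc b) (scaled≤⇒ p m cop n (δ G) (dense q′<q)) ⟩
      suc b * (suc m * δ G)   ≡⟨ *-assoc (suc b) (suc m) (δ G) ⟨
      suc b * suc m * δ G     ∎)
    where open ≤-Reasoning

lower<upper : ∀ γ {p q} → lower γ p → upper γ q → p ℚ.< q
lower<upper γ {p} {q} p<γ γ<q with ℚ.<-cmp p q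
... | tri< p<q _ _ = p<q
... | tri≈ _ refl _ = ⊥-elim (disjoint γ (p<γ , γ<q))
... | tri> _ _ q<p = ⊥-elim (disjoint γ (p<γ , upper-closed γ q<p γ<q))

unbounded-below : (H : Graph k) (a b : ℕ) → 1 ≤ a → LowerBound H a (suc b) → ∀ γ q → q ℚ.< + a ℚ./ suc b → upper γ q → ¬ VCBoundedAt H γ
unbounded-below H a b 1≤a low γ q@(mkℚ i m cop) q<x γ<q (C , bound) = choose i refl
  where
  refute : ∀ p → i ℤ.≤ + p → p * suc b < a * suc m → ⊥
  refute p i≤p p/m<a/b =
    let c , family = low (suc C)
        -- With `N = p * c`, the excess `c` in the order contributes just one more `N` to `p * n`,
        -- and the strict inequality `p * suc b < a * suc m` has room for it.
        n , G , maxG , C<VC , aN≤δ , n≤ = family (p * c)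
        dense : p * n ≤ suc m * δ G
        dense = begin
          p * n                             ≤⟨ *-monoʳ-≤ p n≤ ⟩
          p * (suc b * (p * c) + c)         ≡⟨ expand p (suc b) c ⟩
          suc (p * suc b) * (p * c)         ≤⟨ *-monoˡ-≤ (p * c) p/m<a/b ⟩
          a * suc m * (p * c)               ≡⟨ rearrange a (suc m) (p * c) ⟩
          suc m * (a * (p * c))             ≤⟨ *-monoʳ-≤ (suc m) aN≤δ ⟩
          suc m * δ G                       ∎
    in  <-irrefl refl (≤-trans C<VC (bound n G maxG (λ {q′} q′<γ → ℚ.≤-trans
          (ℚ.*-monoʳ-≤-nonNeg (fromℕ n) {{ℚ.normalize-nonNeg n 1}} (ℚ.<⇒≤ (lower<upper γ q′<γ γ<q)))
          (⇒scaled≤ i m cop p n (δ G) i≤p dense))))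
    where
    open ≤-Reasoning
    expand : ∀ p b c → p * (b * (p * c) + c) ≡ suc (p * b) * (p * c)
    expand = solve-∀
    rearrange : ∀ a m x → a * m * x ≡ m * (a * x)
    rearrange = solve-∀
  choose : ∀ j → i ≡ j → ⊥
  choose (+ p) refl = refute p ℤ.≤-refl (numerator-bound p m a b (<fraction⇒ a b q q<x))
  choose -[1+ p ] refl = refute 0 ℤ.-≤+ (*-mono-≤ 1≤a (s≤s z≤n))

threshold : (H : Graph k) (a b : ℕ) (x : ℚ) → x ≡ + a ℚ./ suc b → 1 ≤ a →
            UpperBound H a (suc b) → LowerBound H a (suc b) → δ-VC H ≐ fromℚ x
threshold H a b _ refl 1≤a up low = record { lowerBound = lowerBound ; greatest = greatest }
  where
  x = + a ℚ./ suc b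
  lowerBound : ∀ γ → fromℚ 0ℚ ≤ᴿ γ × VCBoundedAt H γ → fromℚ x ≤ᴿ γ
  lowerBound γ (_ , bounded) {q} q<x =
    let q′ , q<q′ , q′<x = ℚ.<-dense q<x
    in  [ (λ q<γ → q<γ) , (λ γ<q′ → ⊥-elim (unbounded-below H a b 1≤a low γ q′ q′<x γ<q′ bounded)) ]′ (located γ q<q′)
  greatest : ∀ y → (∀ γ → fromℚ 0ℚ ≤ᴿ γ × VCBoundedAt H γ → y ≤ᴿ γ) → y ≤ᴿ fromℚ x
  -- If `q` were not below `x`, a rational `q′` with `x < q′ < y` would itself be an admissible
  -- threshold, forcing `y ≤ q′`.
  greatest y y≤ {q} q<y = decidable-stable (q ℚ.<? x) λ q≮x →
    let q′ , q<q′ , q′<y = lower-open y q<y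
        x<q′ = ℚ.≤-<-trans (ℚ.≮⇒≥ q≮x) q<q′
        0≤x  = ℚ.nonNegative⁻¹ x {{ℚ.normalize-nonNeg a (suc b)}}
    in  ℚ.<-irrefl refl (y≤ (fromℚ q′) ((λ p<0 → ℚ.<-trans p<0 (ℚ.≤-<-trans 0≤x x<q′)) , bounded-above H a b up q′ x<q′) q′<y)

-- Upper bounds

-- Orders up to `N₀` are harmless, as the VC-dimension never exceeds the order.
large⇒UpperBound : (H : Graph k) (a b : ℕ) →
  (∀ m → ∃₂ λ N₀ C → ∀ n (G : Graph n) → N₀ < n → MaximalFree H G →
    (a * suc m + 1) * n ≤ b * suc m * δ G → ∀ S → Shattered G S → ∣ S ∣ ≤ C) → UpperBound H a b
large⇒UpperBound H a b large m = let N₀ , C , bound = large m in N₀ ⊔ C , λ n G maxG dense → case N₀ C n G (bound n G) maxG dense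
  where
  case : ∀ N₀ C n (G : Graph n) → (N₀ < n → MaximalFree H G → (a * suc m + 1) * n ≤ b * suc m * δ G → ∀ S → Shattered G S → ∣ S ∣ ≤ C) →
    MaximalFree H G → (a * suc m + 1) * n ≤ b * suc m * δ G → VC G ≤ N₀ ⊔ C
  case N₀ C n G bound maxG dense with N₀ <? n
  ... | yes N₀<n = ≤-trans (VC≤ G C (bound N₀<n maxG dense)) (m≤n⊔m N₀ C)
  ... | no  N₀≮n = ≤-trans (VC≤n G) (≤-trans (≮⇒≥ N₀≮n) (m≤m⊔n N₀ C))

-- Erdős–Stone for three parts: two rounds of common-points, the first
-- producing a K M M and the second extending it.
dense⇒contains-K : ∀ {r s t₀} M → r ≤ suc t₀ → s ≤ suc t₀ → suc t₀ ≤ M → (G : Graph n) →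
  M + M + M * 2 ^ (M + M) * (M + M) < n → (M + suc t₀) * n ≤ (M + M) * δ G →
  Contains (K r s (suc t₀)) G
dense⇒contains-K {n} {r} {s} {t₀} M r≤t s≤t t≤M G N₀<n dense =
  first (common-points (M + M) (λ i → adj G (start i)) (λ _ → true) M M (δ G)
    (λ _ _ _ → refl) (λ i → δ≤# G (start i)) (room M (m<m+n M (s≤s z≤n))))
  where
  t = suc t₀

  M+M≤n : M + M ≤ n
  M+M≤n = ≤-trans (m≤m+n (M + M) _) (<⇒≤ N₀<n)
  start : Fin (M + M) → Fin n
  start i = inject≤ i M+M≤n
  start-inj : Injective _≡_ _≡_ start
  start-inj = inject≤-injective M+M≤n M+M≤n _ _

  -- By density a vertex sees on average at least `M + t` of the `2M` chosen ones. Any `l` below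
  -- that leaves a surplus of `n`, which pays for the pigeonhole term.
  room : ∀ l → suc l ≤ M + t → # {n} (λ _ → true) * l + M * 2 ^ (M + M) * (M + M) < (M + M) * δ G
  room l l< = begin-strict
    # {n} (λ _ → true) * l + M * 2 ^ (M + M) * (M + M) ≡⟨ cong (λ x → x * l + M * 2 ^ (M + M) * (M + M)) (#-full {n} (λ _ → refl)) ⟩
    n * l + M * 2 ^ (M + M) * (M + M)  <⟨ +-monoʳ-< (n * l) (≤-<-trans (m≤n+m _ (M + M)) N₀<n) ⟩
    n * l + n                          ≡⟨ trans (+-comm (n * l) n) (trans (sym (*-suc n l)) (*-comm n (suc l))) ⟩
    suc l * n                          ≤⟨ *-monoˡ-≤ n l< ⟩
    (M + t) * n                        ≤⟨ dense ⟩
    (M + M) * δ G                      ∎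
    where open ≤-Reasoning

  second : (a b : Fin M → Fin n) → Injective _≡_ _≡_ a → Injective _≡_ _≡_ b →
           (∀ i j → adj G (a i) (b j) ≡ true) → Contains (K r s t) G
  second a b a-inj b-inj ab-adj =
    second-points (common-points (M + M) (λ i → adj G (ab i)) (λ _ → true) (M + t₀) M (δ G)
      (λ _ _ _ → refl) (λ i → δ≤# G (ab i)) (room (M + t₀) (≤-reflexive (sym (+-suc M t₀)))))
    where
    ab : Fin (M + M) → Fin n
    ab i = [ a , b ]′ (splitAt M i)
    ab-left : ∀ i → ab (i ↑ˡ M) ≡ a i
    ab-left i = cong [ a , b ]′ (splitAt-↑ˡ M i M)
    ab-right : ∀ i → ab (M ↑ʳ i) ≡ b i
    ab-right i = cong [ a , b ]′ (splitAt-↑ʳ M M i)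
    -- More than `M + t₀` of the `2M` vertices are selected and each half has only `M`, so each half
    -- keeps at least `t`.
    halves : ∀ J → M + t₀ < # J → t ≤ # (λ i → J (i ↑ˡ M)) × t ≤ # (λ i → J (M ↑ʳ i))
    halves J M+t₀<#J = +-cancelˡ-≤ M t _ (begin
        M + t                  ≤⟨ M+t≤ ⟩
        # left + # right       ≤⟨ +-monoʳ-≤ (# left) (#≤n right) ⟩
        # left + M             ≡⟨ +-comm (# left) M ⟩
        M + # left             ∎)
      , +-cancelˡ-≤ M t _ (≤-trans M+t≤ (+-monoˡ-≤ (# right) (#≤n left)))
      where
      open ≤-Reasoning
      left right : Fin M → Bool
      left  i = J (i ↑ˡ M)
      right i = J (M ↑ʳ i)
      M+t≤ : M + t ≤ # left + # right
      M+t≤ = subst₂ _≤_ (sym (+-suc M t₀)) (#-+ M J) M+t₀<#J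
    choose : ∀ (J : Fin (M + M) → Bool) W → (∀ i u → J i ≡ true → W u ≡ true → adj G (ab i) u ≡ true) →
      (∃ λ (f : Fin r → Fin M) → Injective _≡_ _≡_ f × (∀ i → J (f i ↑ˡ M) ≡ true)) →
      (∃ λ (f : Fin s → Fin M) → Injective _≡_ _≡_ f × (∀ i → J (M ↑ʳ f i) ≡ true)) →
      (∃ λ (f : Fin t → Fin n) → Injective _≡_ _≡_ f × (∀ i → W (f i) ≡ true)) → Contains (K r s t) G
    choose J W all-adj (f₀ , f₀-inj , J₁f₀) (f₁ , f₁-inj , J₂f₁) (f₂ , f₂-inj , Wf₂) =
      K-copy G (a ∘ f₀) (b ∘ f₁) f₂ (f₀-inj ∘ a-inj) (f₁-inj ∘ b-inj) f₂-inj
        (λ i j → ab-adj (f₀ i) (f₁ j))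
        (λ i j → subst (λ x → adj G x (f₂ j) ≡ true) (ab-left (f₀ i)) (all-adj _ _ (J₁f₀ i) (Wf₂ j)))
        (λ i j → subst (λ x → adj G x (f₂ j) ≡ true) (ab-right (f₁ i)) (all-adj _ _ (J₂f₁ i) (Wf₂ j)))
    second-points : (∃₂ λ J W → M + t₀ < # J × M < # W × (∀ i u → J i ≡ true → W u ≡ true → adj G (ab i) u ≡ true)) →
      Contains (K r s t) G
    second-points (J , W , M+t₀<#J , M<#W , all-adj) = choose J W all-adj
      (pick _ (≤-trans r≤t (proj₁ (halves J M+t₀<#J)))) (pick _ (≤-trans s≤t (proj₂ (halves J M+t₀<#J))))
      (pick W (≤-trans t≤M (<⇒≤ M<#W)))

  first : (∃₂ λ J W → M < # J × M < # W × (∀ i u → J i ≡ true → W u ≡ true → adj G (start i) u ≡ true)) →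
    Contains (K r s t) G
  first (J , W , M<#J , M<#W , all-adj) with pick J (<⇒≤ M<#J) | pick W (<⇒≤ M<#W)
  ... | a , a-inj , Ja | b , b-inj , Wb =
    second (start ∘ a) b (a-inj ∘ start-inj) b-inj (λ i j → all-adj (a i) (b j) (Ja i) (Wb j))

upper-half : ∀ {r s t} → 1 ≤ t → r ≤ t → s ≤ t → UpperBound (K r s t) 1 2
upper-half {r} {s} {suc t₀} _ r≤t s≤t = large⇒UpperBound (K r s (suc t₀)) 1 2 λ m →
  _ , 0 , λ n G N₀<n maxG dense → ⊥-elim (MaximalFree.free maxG
    -- With `M = (m+1) t`, the required excess `t/(2M)` over one half equals the slack `1/(2(m+1))`.
    (dense⇒contains-K (suc m * suc t₀) r≤t s≤t (m≤m+n (suc t₀) _) G N₀<n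
      (subst₂ _≤_ (lhs (suc t₀) (suc m) n) (rhs (suc t₀) (suc m) (δ G)) (*-monoʳ-≤ (suc t₀) dense))))
  where
  lhs : ∀ t m n → t * ((1 * m + 1) * n) ≡ (m * t + t) * n
  lhs = solve-∀
  rhs : ∀ t m d → t * (2 * m * d) ≡ (m * t + m * t) * d
  rhs = solve-∀

third : ∀ (c d : Fin 3) → c ≢ d → ∃ λ e → e ≢ c × e ≢ d
third zero             zero             c≢d = ⊥-elim (c≢d refl)
third zero             (suc zero)       _   = suc (suc zero) , (λ ()) , (λ ())
third zero             (suc (suc zero)) _   = suc zero , (λ ()) , (λ ())
third (suc zero)       zero             _   = suc (suc zero) , (λ ()) , (λ ())
third (suc zero)       (suc zero)       c≢d = ⊥-elim (c≢d refl)
third (suc zero)       (suc (suc zero)) _   = zero , (λ ()) , (λ ())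
third (suc (suc zero)) zero             _   = suc zero , (λ ()) , (λ ())
third (suc (suc zero)) (suc zero)       _   = zero , (λ ()) , (λ ())
third (suc (suc zero)) (suc (suc zero)) c≢d = ⊥-elim (c≢d refl)

-- The copy of K r s t created by a new edge uv uses uv, and any vertex of it
-- in the remaining colour class is a common neighbour of u and v.
common-neighbour : ∀ {r s t} → 1 ≤ r → 1 ≤ s → 1 ≤ t → (G : Graph n) → MaximalFree (K r s t) G →
  ∀ {u v} → u ≢ v → adj G u v ≡ false → ∃ λ w → adj G u w ≡ true × adj G v w ≡ true
common-neighbour {n} {r} {s} {t} 1≤r 1≤s 1≤t G maxG {u} {v} u≢v uv with MaximalFree.maximal maxG u v u≢v uv
... | f , f-inj , hom with any? (λ h → any? (λ h′ → (f h ≟ᶠ u) ×-dec ((f h′ ≟ᶠ v) ×-dec (adj (K r s t) h h′ ≟ᵇ true))))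
...   | no unused = ⊥-elim (MaximalFree.free maxG (f , f-inj , λ h h′ hh′ → old h h′ hh′ (addEdge⁻ G u v u≢v (hom h h′ hh′))))
  where
  old : ∀ h h′ → adj (K r s t) h h′ ≡ true →
    adj G (f h) (f h′) ≡ true ⊎ (f h ≡ u × f h′ ≡ v) ⊎ (f h ≡ v × f h′ ≡ u) → adj G (f h) (f h′) ≡ true
  old h h′ hh′ (inj₁ e)               = e
  old h h′ hh′ (inj₂ (inj₁ (p , q))) = ⊥-elim (unused (h , h′ , p , q , hh′))
  old h h′ hh′ (inj₂ (inj₂ (p , q))) = ⊥-elim (unused (h′ , h , q , p , edge-sym (K r s t) hh′))
...   | yes (h , h′ , refl , refl , hh′) with third _ _ (K-edge⁻ r s t h h′ hh′)
...     | c , c≢h , c≢h′ with witness (inPart r s t c) (subst (0 <_) (sym (#inPart r s t c)) (size c))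
  where
  size : ∀ c → 0 < partSize r s t c
  size zero             = 1≤r
  size (suc zero)       = 1≤s
  size (suc (suc zero)) = 1≤t
...       | g , gc with inPart⇒ r s t g gc
...         | refl = f g , old (c≢h ∘ sym) (c≢h′ ∘ cong (part r s t) ∘ f-inj) (c≢h ∘ cong (part r s t) ∘ f-inj)
                        , old (c≢h′ ∘ sym) (c≢h′ ∘ cong (part r s t) ∘ f-inj) (c≢h ∘ cong (part r s t) ∘ f-inj)
  where
  old : ∀ {x} → part r s t x ≢ part r s t g → f g ≢ f h′ → f g ≢ f h → adj G (f x) (f g) ≡ true
  old {x} x≢g g≢h′ g≢h with addEdge⁻ G (f h) (f h′) u≢v (hom x g (K-edge r s t x g x≢g))
  ... | inj₁ e              = e
  ... | inj₂ (inj₁ (_ , q)) = ⊥-elim (g≢h′ q)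
  ... | inj₂ (inj₂ (_ , q)) = ⊥-elim (g≢h q)

-- Upper bound 1/3 for `K 1 1 t`: codegrees of edges and nonedges

codegree : Graph n → Fin n → Fin n → ℕ
codegree G u v = # (adj G u ∩ adj G v)

codegree-sym : (G : Graph n) (u v : Fin n) → codegree G u v ≡ codegree G v u
codegree-sym G u v = #-cong (λ w → ∧-comm (adj G u w) (adj G v w))

Fin1-injective : {f : Fin 1 → Fin n} → Injective _≡_ _≡_ f
Fin1-injective {x = zero} {y = zero} _ = refl

star-copy : ∀ {s t} (G : Graph n) (w : Fin n) (g : Fin s → Fin n) → Injective _≡_ _≡_ g →
  (∀ i → adj G w (g i) ≡ true) → (p : Fin n → Bool) → t ≤ # p →
  (∀ u → p u ≡ true → adj G w u ≡ true × (∀ i → adj G (g i) u ≡ true)) → Contains (K 1 s t) G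
star-copy G w g g-inj wg p t≤#p common with pick p t≤#p
... | f , f-inj , pf = K-copy G (const w) g f Fin1-injective g-inj f-inj (λ _ → wg)
  (λ _ j → proj₁ (common (f j) (pf j))) (λ i j → proj₂ (common (f j) (pf j)) i)

edge-codegree : ∀ {t₀} (G : Graph n) → K 1 1 (suc t₀) -Free G → ∀ {u v} → adj G u v ≡ true → codegree G u v ≤ t₀
edge-codegree {t₀ = t₀} G free {u} {v} uv = ≮⇒≥ λ t₀< → free (star-copy G u (const v) Fin1-injective (const uv) (adj G u ∩ adj G v) t₀<
  (λ w uvw → ∧-conicalˡ _ _ uvw , λ _ → ∧-conicalʳ (adj G u w) _ uvw))

-- The case `u = v` is included, with any neighbour as `w`: the vertex realising the pattern that
-- omits only `xᵢ` may be `xᵢ` itself.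
nonedge-codegree : ∀ {t₀} (G : Graph n) → MaximalFree (K 1 1 (suc t₀)) G → 1 ≤ δ G →
  ∀ {u v} → adj G u v ≡ false → 3 * δ G ≤ n + 2 * t₀ + codegree G u v
nonedge-codegree {n} {t₀} G maxG 1≤δ {u} {v} uv = go (common u v uv)
  where
  common : ∀ u v → adj G u v ≡ false → ∃ λ w → adj G u w ≡ true × adj G v w ≡ true
  common u v uv with u ≟ᶠ v
  ... | yes refl = let w , uw = witness (adj G u) (≤-trans 1≤δ (δ≤# G u)) in w , uw , uw
  ... | no u≢v   = common-neighbour (s≤s z≤n) (s≤s z≤n) (s≤s z≤n) G maxG u≢v uv
  go : (∃ λ w → adj G u w ≡ true × adj G v w ≡ true) → 3 * δ G ≤ n + 2 * t₀ + codegree G u v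
  go (w , uw , vw) = begin
    3 * δ G
      ≡⟨ cong (λ x → δ G + (δ G + x)) (+-identityʳ (δ G)) ⟩
    δ G + (δ G + δ G)
      ≤⟨ +-mono-≤ (δ≤# G u) (+-mono-≤ (δ≤# G v) (δ≤# G w)) ⟩
    # (adj G u) + (# (adj G v) + # (adj G w))
      ≤⟨ #-3-cycle (adj G u) (adj G v) (adj G w) ⟩
    1 * n + (codegree G u v + (codegree G v w + codegree G w u))
      ≤⟨ +-monoʳ-≤ (1 * n) (+-monoʳ-≤ (codegree G u v) (+-mono-≤ (edge-codegree G free vw) (edge-codegree G free (edge-sym G uw)))) ⟩
    1 * n + (codegree G u v + (t₀ + t₀))
      ≡⟨ rearrange n (codegree G u v) t₀ ⟩
    n + 2 * t₀ + codegree G u v ∎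
    where
    open ≤-Reasoning
    free = MaximalFree.free maxG
    rearrange : ∀ n c t → 1 * n + (c + (t + t)) ≡ n + 2 * t + c
    rearrange = solve-∀

-- If x₁, …, x_M are shattered and vᵢ is adjacent to all of them but xᵢ, then
-- the sets N(xᵢ) ∩ N(vᵢ) are large, while two of them meet inside
-- N(xⱼ) ∩ N(vᵢ), the common neighbourhood of an edge.
upper-third : ∀ {t} → 1 ≤ t → UpperBound (K 1 1 t) 1 3
upper-third {suc t₀} _ = large⇒UpperBound (K 1 1 (suc t₀)) 1 3 λ m →
  -- The density hypothesis gives `3δ - n ≥ n/(m+1)`, so `2(m+1)` private neighbourhoods have total
  -- size about `2n`. This is enough for two of them to share more than `t₀` vertices.
  let M = 2 * suc m in
  2 * M * t₀ + t₀ * 2 ^ M * M , M , λ n G → bound m n G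
  where
  bound : ∀ m n (G : Graph n) → let M = 2 * suc m in 2 * M * t₀ + t₀ * 2 ^ M * M < n → MaximalFree (K 1 1 (suc t₀)) G →
    (1 * suc m + 1) * n ≤ 3 * suc m * δ G → ∀ S → Shattered G S → ∣ S ∣ ≤ M
  bound m n G = bound′ (2 * suc m) refl
    where
    bound′ : ∀ M → M ≡ 2 * suc m → 2 * M * t₀ + t₀ * 2 ^ M * M < n → MaximalFree (K 1 1 (suc t₀)) G →
      (1 * suc m + 1) * n ≤ 3 * suc m * δ G → ∀ S → Shattered G S → ∣ S ∣ ≤ M
    bound′ M M≡ N₀<n maxG dense S shattered = ≮⇒≥ λ M<∣S∣ → refute (pick (lookup S) (subst (M ≤_) (∣∣≡# S) (<⇒≤ M<∣S∣)))
      where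
      free = MaximalFree.free maxG

      1≤δ : 1 ≤ δ G
      1≤δ = n≢0⇒n>0 λ δ≡0 → <⇒≱ (≤-<-trans z≤n N₀<n) (≤-trans (m≤n*m n (1 * suc m + 1))
        (≤-trans dense (≤-reflexive (trans (cong (3 * suc m *_) δ≡0) (*-zeroʳ (3 * suc m))))))

      refute : (∃ λ (x : Fin M → Fin n) → Injective _≡_ _≡_ x × (∀ i → lookup S (x i) ≡ true)) → ⊥
      refute (x , x-inj , Sx) = meet (common-points M R (λ _ → true) 1 t₀ D (λ _ _ _ → refl) D≤ large)
        where
        avoid : Fin M → Fin n → Bool
        avoid i u = not ⌊ u ≟ᶠ x i ⌋

        v : Fin M → Fin n
        v i = proj₁ (realise G shattered (avoid i))

        v-adj : ∀ i j → adj G (v i) (x j) ≡ avoid i (x j)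
        v-adj i j = proj₂ (realise G shattered (avoid i)) (x j) (Sx j)

        avoid-self : ∀ i → avoid i (x i) ≡ false
        avoid-self i with x i ≟ᶠ x i
        ... | yes _ = refl
        ... | no ¬p = ⊥-elim (¬p refl)

        avoid-other : ∀ {i j} → i ≢ j → avoid i (x j) ≡ true
        avoid-other {i} {j} i≢j with x j ≟ᶠ x i
        ... | yes p = ⊥-elim (i≢j (sym (x-inj p)))
        ... | no _  = refl

        R : Fin M → Fin n → Bool
        R i = adj G (v i) ∩ adj G (x i)

        D : ℕ
        D = 3 * δ G ∸ (n + 2 * t₀)

        D≤ : ∀ i → D ≤ # (R i)
        D≤ i = m≤n+o⇒m∸n≤o _ (n + 2 * t₀) (nonedge-codegree G maxG 1≤δ (trans (v-adj i i) (avoid-self i)))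

        large : # {n} (λ _ → true) * 1 + t₀ * 2 ^ M * M < M * D
        large = +-cancelˡ-< (M * (n + 2 * t₀)) _ _ (begin-strict
          M * (n + 2 * t₀) + (# {n} (λ _ → true) * 1 + t₀ * 2 ^ M * M)  ≡⟨ cong (λ y → M * (n + 2 * t₀) + (y * 1 + t₀ * 2 ^ M * M)) (#-full {n} (λ _ → refl)) ⟩
          M * (n + 2 * t₀) + (n * 1 + t₀ * 2 ^ M * M)     ≡⟨ shuffle M n t₀ (t₀ * 2 ^ M * M) ⟩
          M * n + n + (2 * M * t₀ + t₀ * 2 ^ M * M)       <⟨ +-monoʳ-< (M * n + n) N₀<n ⟩
          M * n + n + n                                   ≡⟨ cong (λ y → y * n + n + n) M≡ ⟩
          2 * suc m * n + n + n                           ≡⟨ double (suc m) n ⟩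
          2 * ((1 * suc m + 1) * n)                       ≤⟨ *-monoʳ-≤ 2 dense ⟩
          2 * (3 * suc m * δ G)                           ≡⟨ regroup (suc m) (δ G) ⟩
          2 * suc m * (3 * δ G)                           ≡⟨ cong (_* (3 * δ G)) M≡ ⟨
          M * (3 * δ G)                                   ≤⟨ *-monoʳ-≤ M (m≤n+m∸n (3 * δ G) (n + 2 * t₀)) ⟩
          M * (n + 2 * t₀ + D)                            ≡⟨ *-distribˡ-+ M (n + 2 * t₀) D ⟩
          M * (n + 2 * t₀) + M * D                        ∎)
          where
          open ≤-Reasoning
          shuffle : ∀ M n t y → M * (n + 2 * t) + (n * 1 + y) ≡ M * n + n + (2 * M * t + y)
          shuffle = solve-∀
          double : ∀ m n → 2 * m * n + n + n ≡ 2 * ((1 * m + 1) * n)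
          double = solve-∀
          regroup : ∀ m d → 2 * (3 * m * d) ≡ 2 * m * (3 * d)
          regroup = solve-∀

        meet : (∃₂ λ J W → 1 < # J × t₀ < # W × (∀ i u → J i ≡ true → W u ≡ true → R i u ≡ true)) → ⊥
        meet (J , W , 1<#J , t₀<#W , all-R) with pick J 1<#J
        ... | j , j-inj , Jj = <⇒≱ t₀<#W (≤-trans (#-mono W⊑) (edge-codegree G free (trans (v-adj j₀ j₁) (avoid-other (0≢1+n ∘ j-inj)))))
          where
          j₀ = j zero
          j₁ = j (suc zero)
          W⊑ : W ⊑ adj G (v j₀) ∩ adj G (x j₁)
          W⊑ u Wu = cong₂ _∧_ (∧-conicalˡ _ _ (all-R j₀ u (Jj zero) Wu)) (∧-conicalʳ (adj G (v j₁) u) _ (all-R j₁ u (Jj (suc zero)) Wu))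

-- Upper bound `s/(2s+1)` for `K 1 s t`: light pentagons and the two sides

<ᵇ-true : ∀ {a b} → a < b → (a <ᵇ b) ≡ true
<ᵇ-true a<b = Equivalence.to T-≡ (<⇒<ᵇ a<b)

<ᵇ-true⁻ : ∀ {a b} → (a <ᵇ b) ≡ true → a < b
<ᵇ-true⁻ {a} {b} eq = <ᵇ⇒< a b (Equivalence.from T-≡ eq)

<ᵇ-false⁻ : ∀ {a b} → (a <ᵇ b) ≡ false → b ≤ a
<ᵇ-false⁻ eq = ≮⇒≥ λ a<b → true≢false (<ᵇ-true a<b) eq

not-true⁻ : ∀ {b} → not b ≡ true → b ≡ false
not-true⁻ {false} _ = refl

same : Bool → Bool → Bool
same true  c = c
same false c = not c

same⇒≡ : ∀ {b c} → same b c ≡ true → b ≡ c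
same⇒≡ {true}  {true}  _ = refl
same⇒≡ {false} {false} _ = refl

≡⇒same : ∀ {b c} → b ≡ c → same b c ≡ true
≡⇒same {true}  refl = refl
≡⇒same {false} refl = refl

differ⇒same : ∀ {b c d} → same b c ≡ false → same b d ≡ false → same c d ≡ true
differ⇒same {true}  {false} {false} _ _ = refl
differ⇒same {false} {true}  {true}  _ _ = refl

differ-sym : ∀ {b c} → same b c ≡ false → same c b ≡ false
differ-sym {true}  {false} _ = refl
differ-sym {false} {true}  _ = refl

-- Each further set removes at most `# O - D` of the points common so far. The bound
-- `# O - k (# O - D)` is written without subtraction.
common-lower : ∀ k (O : Fin n → Bool) D (p : Fin k → Fin n → Bool) → (∀ i → D ≤ # (p i ∩ O)) →
  ∃ λ c → (∀ u → c u ≡ true → O u ≡ true × (∀ i → p i u ≡ true)) × # O + k * D ≤ # c + k * # O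
common-lower zero    O D p D≤ = O , (λ u Ou → Ou , λ ()) , ≤-refl
common-lower (suc k) O D p D≤ with common-lower k O D (p ∘ suc) (D≤ ∘ suc)
... | c , c-common , c-size = p zero ∩ c
    , (λ u pcu → let Ou , rest = c-common u (∧-conicalʳ (p zero u) _ pcu) in
         Ou , λ { zero → ∧-conicalˡ _ _ pcu ; (suc i) → rest i })
    , (begin
      # O + (D + k * D)                         ≡⟨ shuffle (# O) D (k * D) ⟩
      D + (# O + k * D)                         ≤⟨ +-mono-≤ (D≤ zero) c-size ⟩
      # (p zero ∩ O) + (# c + k * # O)          ≤⟨ +-monoˡ-≤ (# c + k * # O) (#-∪ {p = p zero ∩ O} {c ∩ p zero} {O∖c} cover) ⟩
      # (c ∩ p zero) + # O∖c + (# c + k * # O) ≡⟨ shuffle′ (# (c ∩ p zero)) (# O∖c) (# c) (k * # O) ⟩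
      # (c ∩ p zero) + (# c + # O∖c + k * # O) ≡⟨ cong₂ _+_ (#-cong (λ u → ∧-comm (c u) (p zero u))) (cong (_+ k * # O) (trans (cong (_+ # O∖c) c≡) (sym (#-split O c)))) ⟩
      # (p zero ∩ c) + (# O + k * # O)          ∎)
  where
  open ≤-Reasoning
  O∖c : Fin _ → Bool
  O∖c = O ∩ (not ∘ c)
  c≡ : # c ≡ # (O ∩ c)
  c≡ = ≤-antisym (#-mono (λ u cu → cong₂ _∧_ (proj₁ (c-common u cu)) cu)) (#-mono (λ u → ∧-conicalʳ (O u) (c u)))
  cover : ∀ u → (p zero ∩ O) u ≡ true → (c ∩ p zero) u ≡ true ⊎ O∖c u ≡ true
  cover u pO with c u
  ... | true  = inj₁ (∧-conicalˡ _ _ pO)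
  ... | false = inj₂ (cong₂ _∧_ (∧-conicalʳ (p zero u) _ pO) refl)
  shuffle : ∀ a b c → a + (b + c) ≡ b + (a + c)
  shuffle = solve-∀
  shuffle′ : ∀ a b c d → a + b + (c + d) ≡ a + (c + b + d)
  shuffle′ = solve-∀

heavy : Graph n → ℕ → Fin n → Fin n → Bool
heavy G e w a = adj G w a ∧ (e <ᵇ codegree G w a)

-- Otherwise `M` heavy neighbours of `w` each have more than `e` neighbours inside that of `w`;
-- averaging there yields `s` of them with `t` common ones, a `K 1 s t` centred at `w`.
few-heavy : ∀ {s₀ t₀} M (G : Graph n) e → K 1 (suc s₀) (suc t₀) -Free G → M ≤ e →
  n * s₀ + t₀ * 2 ^ M * M < M * suc e → ∀ w → # (heavy G e w) ≤ e
few-heavy {n} {s₀} {t₀} M G e free M≤e large w = ≮⇒≥ λ e< → refute (pick (heavy G e w) (≤-trans M≤e (<⇒≤ e<)))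
  where
  refute : (∃ λ (a : Fin M → Fin n) → Injective _≡_ _≡_ a × (∀ i → heavy G e w (a i) ≡ true)) → ⊥
  refute (a , a-inj , heavy-a) = found (common-points M (λ i → adj G w ∩ adj G (a i)) (adj G w) s₀ t₀ (suc e)
    (λ i u → ∧-conicalˡ _ _) (λ i → <ᵇ-true⁻ (∧-conicalʳ (adj G w (a i)) _ (heavy-a i)))
    (≤-<-trans (+-monoˡ-≤ (t₀ * 2 ^ M * M) (*-monoˡ-≤ s₀ (#≤n (adj G w)))) large))
    where
    found : (∃₂ λ J W → s₀ < # J × t₀ < # W × (∀ i u → J i ≡ true → W u ≡ true → (adj G w ∩ adj G (a i)) u ≡ true)) → ⊥
    found (J , W , s₀<#J , t₀<#W , all-adj) with pick J s₀<#J
    ... | j , j-inj , Jj = free (star-copy G w (a ∘ j) (j-inj ∘ a-inj) (λ i → ∧-conicalˡ _ _ (heavy-a (j i))) W t₀<#W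
      (λ u Wu → ∧-conicalˡ _ _ (all-adj (j zero) u (Jj zero) Wu) , λ i → ∧-conicalʳ (adj G w u) _ (all-adj (j i) u (Jj i) Wu)))

-- Call an edge light if the codegree of its ends is at most e.  The degree
-- condition excludes pentagons all of whose edges are light, as a vertex
-- adjacent to three vertices of a pentagon is adjacent to two consecutive
-- ones.  Fixing a light edge xy, any two vertices having many common
-- neighbours with x (or both with y) lie on a light pentagon unless their
-- codegree is large; this makes G nearly bipartite.
module NearlyBipartite {n : ℕ} (G : Graph n) (s₀ t₀ e D : ℕ)
  (free : K 1 (suc s₀) (suc t₀) -Free G)
  (deg : ∀ v → D + e ≤ # (adj G v))
  (heavy≤e : ∀ w → # (heavy G e w) ≤ e)
  (2n<5D : 2 * n < 5 * D) (n+2e<3D : n + 2 * e < 3 * D)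
  (sn+t≤ : suc s₀ * n + suc t₀ ≤ (2 * suc s₀ + 1) * D)
  (x : Fin n) where

  -- At most `e` of the common neighbours are heavy for `w` and at most `e` for `z`, so one is light
  -- for both and gives a light path of length two.
  light-middle : ∀ w z → 2 * e < codegree G w z →
    ∃ λ a → codegree G w a ≤ e × codegree G a z ≤ e
  light-middle w z 2e< with witness (common ∩ (not ∘ heavy G e w) ∩ (not ∘ heavy G e z)) (n≢0⇒n>0 not-none)
    where
    common = adj G w ∩ adj G z
    not-none : # (common ∩ (not ∘ heavy G e w) ∩ (not ∘ heavy G e z)) ≢ 0
    not-none none = <⇒≱ 2e< (begin
      # common
        ≤⟨ #-∪ {r = (adj G w ∩ adj G z) ∩ (not ∘ heavy G e w)} (λ u cu → split (heavy G e w u) cu) ⟩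
      # (heavy G e w) + # ((adj G w ∩ adj G z) ∩ (not ∘ heavy G e w))
        ≤⟨ +-monoʳ-≤ (# (heavy G e w)) (#-∪ {r = common ∩ (not ∘ heavy G e w) ∩ (not ∘ heavy G e z)} (λ u cu → split₂ (heavy G e z u) (common u) cu)) ⟩
      # (heavy G e w) + (# (heavy G e z) + # (common ∩ (not ∘ heavy G e w) ∩ (not ∘ heavy G e z)))
        ≤⟨ +-mono-≤ (heavy≤e w) (+-mono-≤ (heavy≤e z) (≤-reflexive none)) ⟩
      2 * e ∎)
      where
      open ≤-Reasoning
      split : ∀ {c} h → c ≡ true → h ≡ true ⊎ c ∧ not h ≡ true
      split true  c = inj₁ refl
      split false c = inj₂ (cong (_∧ true) c)
      split₂ : ∀ {h} h′ c → c ∧ not h ≡ true → h′ ≡ true ⊎ c ∧ not h ∧ not h′ ≡ true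
      split₂ true  c cu = inj₁ refl
      split₂ {h} false c cu = inj₂ (trans (cong (c ∧_) (∧-comm (not h) true)) cu)
  ... | a , eq = a , light w (∧-conicalˡ _ _ c) (not-true⁻ (∧-conicalˡ _ _ nn))
               , subst (_≤ e) (codegree-sym G z a) (light z (∧-conicalʳ (adj G w a) _ c) (not-true⁻ (∧-conicalʳ (not (heavy G e w a)) _ nn)))
    where
    c  = ∧-conicalˡ (adj G w a ∧ adj G z a) _ eq
    nn = ∧-conicalʳ (adj G w a ∧ adj G z a) _ eq
    light : ∀ v → adj G v a ≡ true → heavy G e v a ≡ false → codegree G v a ≤ e
    light v va h rewrite va = <ᵇ-false⁻ h

  no-light-pentagon : ∀ a b c d f → codegree G a b ≤ e → codegree G b c ≤ e → codegree G c d ≤ e →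
    codegree G d f ≤ e → codegree G f a ≤ e → ⊥
  no-light-pentagon a b c d f ab bc cd df fa = <⇒≱ 2n<5D (+-cancelʳ-≤ (5 * e) (5 * D) (2 * n) (begin
    5 * D + 5 * e                                     ≡⟨ shuffle D e ⟩
    D + e + (D + e + (D + e + (D + e + (D + e))))     ≤⟨ +-mono-≤ (deg a) (+-mono-≤ (deg b) (+-mono-≤ (deg c) (+-mono-≤ (deg d) (deg f)))) ⟩
    _                                                 ≤⟨ #-5-cycle (adj G a) (adj G b) (adj G c) (adj G d) (adj G f) ⟩
    _                                                 ≤⟨ +-monoʳ-≤ (2 * n) (+-mono-≤ ab (+-mono-≤ bc (+-mono-≤ cd (+-mono-≤ df fa)))) ⟩
    2 * n + (e + (e + (e + (e + e))))                 ≡⟨ cong (2 * n ℕ.+_) (shuffle′ e) ⟩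
    2 * n + 5 * e                                     ∎))
    where
    open ≤-Reasoning
    shuffle : ∀ D e → 5 * D + 5 * e ≡ D + e + (D + e + (D + e + (D + e + (D + e))))
    shuffle = solve-∀
    shuffle′ : ∀ e → e + (e + (e + (e + e))) ≡ 5 * e
    shuffle′ = solve-∀

  -- Light paths from `w` to `z` and from `z` to `w′` would be closed into a light pentagon by the
  -- pair `w w′` if its codegree were small; this pair may be nonadjacent.
  close : ∀ z {w w′} → 2 * e < codegree G w z → 2 * e < codegree G w′ z → e < codegree G w w′
  close z {w} {w′} wz w′z = ≰⇒> λ ww′ →
    let a  , wa   , az  = light-middle w z wz
        a′ , w′a′ , a′z = light-middle w′ z w′z
    in  no-light-pentagon w a z a′ w′ wa az (subst (_≤ e) (codegree-sym G a′ z) a′z) (subst (_≤ e) (codegree-sym G w′ a′) w′a′)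
          (subst (_≤ e) (codegree-sym G w w′) ww′)

  e<D : e < D
  e<D = ≰⇒> λ D≤e → <⇒≱ n+2e<3D (begin
    3 * D            ≡⟨ shuffle D ⟩
    D + 2 * D        ≤⟨ +-mono-≤ (≤-trans (m≤m+n D e) (≤-trans (deg x) (#≤n (adj G x)))) (*-monoʳ-≤ 2 D≤e) ⟩
    n + 2 * e        ∎)
    where
    open ≤-Reasoning
    shuffle : ∀ D → 3 * D ≡ D + 2 * D
    shuffle = solve-∀

  light-neighbour : ∃ λ y → codegree G x y ≤ e
  light-neighbour with witness (adj G x ∩ (not ∘ heavy G e x)) (n≢0⇒n>0 λ none → <⇒≱ (m<n+m e (≤-<-trans z≤n e<D))
    (≤-trans (deg x) (≤-trans (#-∪ {r = adj G x ∩ (not ∘ heavy G e x)} (λ u xu → split (heavy G e x u) xu))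
      (≤-trans (+-mono-≤ (heavy≤e x) (≤-reflexive none)) (≤-reflexive (+-identityʳ e))))))
    where
    split : ∀ {c} h → c ≡ true → h ≡ true ⊎ c ∧ not h ≡ true
    split true  c = inj₁ refl
    split false c = inj₂ (cong (_∧ true) c)
  ... | y , eq = y , <ᵇ-false⁻ (subst (λ b → b ∧ (e <ᵇ codegree G x y) ≡ false) (∧-conicalˡ _ _ eq) (not-true⁻ (∧-conicalʳ (adj G x y) _ eq)))

  y : Fin n
  y = proj₁ light-neighbour

  side : Fin n → Bool
  side w = 2 * e <ᵇ codegree G w x

  base : Bool → Fin n
  base true  = x
  base false = y

  -- Since `x` and `y` have small codegree, a vertex with small codegree to both would give three
  -- large, nearly disjoint neighbourhoods, too many for `n` vertices.
  near-base : ∀ w b → side w ≡ b → 2 * e < codegree G w (base b)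
  near-base w true  sw = <ᵇ-true⁻ sw
  near-base w false sw = ≰⇒> λ wy≤ → <⇒≱ n+2e<3D (+-cancelʳ-≤ (3 * e) (3 * D) (n + 2 * e) (begin
    3 * D + 3 * e                                ≡⟨ shuffle D e ⟩
    D + e + (D + e + (D + e))                    ≤⟨ +-mono-≤ (deg w) (+-mono-≤ (deg x) (deg y)) ⟩
    _                                            ≤⟨ #-3-cycle (adj G w) (adj G x) (adj G y) ⟩
    1 * n + (codegree G w x + (codegree G x y + codegree G y w))
      ≤⟨ +-monoʳ-≤ (1 * n) (+-mono-≤ (<ᵇ-false⁻ {2 * e} {codegree G w x} sw) (+-mono-≤ (proj₂ light-neighbour) (subst (_≤ 2 * e) (codegree-sym G w y) wy≤))) ⟩
    1 * n + (2 * e + (e + 2 * e))                ≡⟨ shuffle′ n e ⟩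
    n + 2 * e + 3 * e                            ∎))
    where
    open ≤-Reasoning
    shuffle : ∀ D e → 3 * D + 3 * e ≡ D + e + (D + e + (D + e))
    shuffle = solve-∀
    shuffle′ : ∀ n e → 1 * n + (2 * e + (e + 2 * e)) ≡ n + 2 * e + 3 * e
    shuffle′ = solve-∀

  side-base : ∀ b → side (base b) ≡ b
  side-base true  = <ᵇ-true (<-≤-trans (begin-strict
      2 * e             ≡⟨ cong (e ℕ.+_) (+-identityʳ e) ⟩
      e + e             <⟨ +-monoˡ-< e e<D ⟩
      D + e             ∎) (≤-trans (deg x) (≤-reflexive (#-cong (λ u → sym (∧-idem (adj G x u)))))))
    where open ≤-Reasoning
  side-base false = ≢true⇒false λ far → <⇒≱ (<ᵇ-true⁻ far) (≤-trans (≤-reflexive (codegree-sym G y x)) (≤-trans (proj₂ light-neighbour) (m≤m+n e _)))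

  allies : Fin n → Fin n → Bool
  allies w w′ = same (side w) (side w′)

  -- Allies are near the same base vertex, so `close` makes every edge between them heavy.
  few-allied-neighbours : ∀ w → # (adj G w ∩ allies w) ≤ e
  few-allied-neighbours w = ≤-trans (#-mono sub) (heavy≤e w)
    where
    sub : adj G w ∩ allies w ⊑ heavy G e w
    sub u wu = cong₂ _∧_ (∧-conicalˡ _ _ wu) (<ᵇ-true (close (base (side w)) (near-base w (side w) refl)
      (near-base u (side w) (sym (same⇒≡ (∧-conicalʳ (adj G w u) _ wu))))))

  opposite-degree : ∀ w → D ≤ # (adj G w ∩ (not ∘ allies w))
  opposite-degree w = +-cancelʳ-≤ e D _ (≤-trans (deg w) (begin
    # (adj G w)                                                     ≡⟨ #-split (adj G w) (allies w) ⟩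
    # (adj G w ∩ allies w) + # (adj G w ∩ (not ∘ allies w))         ≤⟨ +-monoˡ-≤ (# (adj G w ∩ (not ∘ allies w))) (few-allied-neighbours w) ⟩
    e + # (adj G w ∩ (not ∘ allies w))                              ≡⟨ +-comm e _ ⟩
    # (adj G w ∩ (not ∘ allies w)) + e                              ∎))
    where open ≤-Reasoning

  opposite : Bool → Fin n → Bool
  opposite b w = not (same b (side w))

  -- The base vertex of the opposite side has at least `D` neighbours on side `b`.
  opposite-size : ∀ b → # (opposite b) + D ≤ n
  opposite-size b = begin
    # (opposite b) + D                          ≤⟨ +-monoʳ-≤ (# (opposite b)) D≤ ⟩
    # (opposite b) + # (λ w → same b (side w))  ≡⟨ +-comm (# (opposite b)) _ ⟩
    # (λ w → same b (side w)) + # (opposite b)  ≡⟨ #-split (λ _ → true) (λ w → same b (side w)) ⟨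
    # {n} (λ _ → true)                          ≤⟨ #≤n {n} (λ _ → true) ⟩
    n                                           ∎
    where
    open ≤-Reasoning
    flip : ∀ b c → not (same (not b) c) ≡ true → same b c ≡ true
    flip true  true  _ = refl
    flip false false _ = refl
    D≤ : D ≤ # (λ w → same b (side w))
    D≤ = ≤-trans (opposite-degree (base (not b))) (#-mono λ u eq →
      flip b (side u) (subst (λ c → not (same c (side u)) ≡ true) (side-base (not b)) (∧-conicalʳ (adj G (base (not b)) u) _ eq)))

  -- Origin of `s/(2s+1)`: `w` and `s` allied neighbours each see at least `D` of the `o ≤ n - D`
  -- opposite vertices, so they have at least `(s+1) D - s o ≥ (2s+1) D - s n ≥ t` common neighbours
  -- there, completing `K 1 s t`.
  allied-degree : ∀ w → # (adj G w ∩ allies w) ≤ s₀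
  allied-degree w = ≮⇒≥ λ s₀< → refute (pick (adj G w ∩ allies w) s₀<)
    where
    O : Fin n → Bool
    O = opposite (side w)
    refute : (∃ λ (g : Fin (suc s₀) → Fin n) → Injective _≡_ _≡_ g × (∀ i → (adj G w ∩ allies w) (g i) ≡ true)) → ⊥
    refute (g , g-inj , wg) = count (common-lower (suc (suc s₀)) O D star star-degree)
      where
      star : Fin (suc (suc s₀)) → Fin n → Bool
      star zero    = adj G w
      star (suc i) = adj G (g i)
      star-degree : ∀ i → D ≤ # (star i ∩ O)
      star-degree zero    = opposite-degree w
      star-degree (suc i) = subst (λ b → D ≤ # (adj G (g i) ∩ opposite b)) (sym (same⇒≡ {side w} {side (g i)} (∧-conicalʳ (adj G w (g i)) _ (wg i)))) (opposite-degree (g i))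
      count : (∃ λ c → (∀ u → c u ≡ true → O u ≡ true × (∀ i → star i u ≡ true)) × # O + suc (suc s₀) * D ≤ # c + suc (suc s₀) * # O) → ⊥
      count (c , c-common , c-size) = free (star-copy G w g g-inj (λ i → ∧-conicalˡ _ _ (wg i)) c t≤#c
        (λ u cu → let _ , all = c-common u cu in all zero , all ∘ suc))
        where
        open ≤-Reasoning
        expand : ∀ s D o → (2 * s + 1) * D + (s * o + o) ≡ o + suc s * D + s * (o + D)
        expand = solve-∀
        shuffle : ∀ s c o n → c + suc s * o + s * n ≡ s * n + c + (s * o + o)
        shuffle = solve-∀
        t≤#c : suc t₀ ≤ # c
        t≤#c = +-cancelˡ-≤ (suc s₀ * n) _ _ (≤-trans sn+t≤ (+-cancelʳ-≤ (suc s₀ * # O + # O) _ _ (begin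
          (2 * suc s₀ + 1) * D + (suc s₀ * # O + # O)     ≡⟨ expand (suc s₀) D (# O) ⟩
          # O + suc (suc s₀) * D + suc s₀ * (# O + D)     ≤⟨ +-mono-≤ c-size (*-monoʳ-≤ (suc s₀) (opposite-size (side w))) ⟩
          # c + suc (suc s₀) * # O + suc s₀ * n           ≡⟨ shuffle (suc s₀) (# c) (# O) n ⟩
          suc s₀ * n + # c + (suc s₀ * # O + # O)         ∎)))

-- For t ≥ 2s - 2, a nonadjacent pair across the two sides cannot be
-- completed to K 1 s t: the side of the centre holds at most s - 1 further
-- vertices of the copy, the other side at most s - 1 of each class.
cross-complete : ∀ {s₀ t₀} (G : Graph n) → MaximalFree (K 1 (suc s₀) (suc t₀)) G → s₀ ≤ t₀ → 2 * s₀ ≤ suc t₀ →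
  (side : Fin n → Bool) → (∀ w → # (adj G w ∩ (same (side w) ∘ side)) ≤ s₀) →
  ∀ u v → same (side u) (side v) ≡ false → adj G u v ≡ true
cross-complete {n} {s₀} {t₀} G maxG s₀≤t₀ 2s₀≤t side allied-degree u v uv≢ with adj G u v in uv
... | true  = refl
... | false = ⊥-elim (refute (MaximalFree.maximal maxG u v u≢v uv))
  where
  s = suc s₀
  t = suc t₀
  H = K 1 s t
  u≢v : u ≢ v
  u≢v refl = true≢false (≡⇒same {side u} refl) uv≢

  refute : ¬ Contains H (addEdge G u v u≢v)
  refute (f , f-inj , hom) = contradict
    (witness (inPart 1 s t zero) (subst (0 <_) (sym (#inPart 1 s t zero)) (s≤s z≤n)))
    where
    P : Fin 3 → Fin (1 + s + t) → Bool
    P = inPart 1 s t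

    allied : Fin (1 + s + t) → Fin (1 + s + t) → Bool
    allied h h′ = same (side (f h)) (side (f h′))

    -- The added edge crosses between the sides, so the edges of the copy inside a side already
    -- belong to `G`.
    allied-edge : ∀ h h′ → part 1 s t h ≢ part 1 s t h′ → allied h h′ ≡ true → adj G (f h) (f h′) ≡ true
    allied-edge h h′ h≢h′ al with addEdge⁻ G u v u≢v (hom h h′ (K-edge 1 s t h h′ h≢h′))
    ... | inj₁ e = e
    ... | inj₂ (inj₁ (refl , refl)) = ⊥-elim (true≢false al uv≢)
    ... | inj₂ (inj₂ (refl , refl)) = ⊥-elim (true≢false al (differ-sym {side u} uv≢))

    few : ∀ h {q} → (∀ h′ → q h′ ≡ true → part 1 s t h ≢ part 1 s t h′ × allied h h′ ≡ true) → # q ≤ s₀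
    few h {q} q⇒ = ≤-trans (#-injection {p = q} f (λ _ _ → f-inj) (λ h′ qh′ → let h≢h′ , al = q⇒ h′ qh′ in
      cong₂ _∧_ (allied-edge h h′ h≢h′ al) al)) (allied-degree (f h))

    contradict : ¬ ∃ λ h → P zero h ≡ true
    -- Besides the centre there are `s + t` vertices: at most `s₀` on its side and at most `s₀` of
    -- each class across. But `3 s₀ < s + t` is the hypothesis `t ≥ 2s - 2`.
    contradict (c , Pc) = <⇒≱ (s≤s 2s₀≤t) (+-cancelˡ-≤ s _ _ (begin
        s + suc t
          ≡⟨ +-suc s t ⟩
        suc (s + t)
          ≡⟨ cong suc (cong₂ _+_ (size (suc zero)) (size (suc (suc zero)))) ⟩
        suc (# near₁ + # far₁ + (# near₂ + # far₂))
          ≡⟨ cong suc (shuffle (# near₁) (# far₁) (# near₂) (# far₂)) ⟩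
        suc (# near₁ + # near₂ + (# far₁ + # far₂))
          ≤⟨ s≤s (+-mono-≤ near≤ (+-mono-≤ far₁≤ far₂≤)) ⟩
        suc (s₀ + (s₀ + s₀))
          ≡⟨ cong (λ y → suc (s₀ + (s₀ + y))) (sym (+-identityʳ s₀)) ⟩
        s + 2 * s₀ ∎))
      where
      open ≤-Reasoning
      shuffle : ∀ a b c d → a + b + (c + d) ≡ a + c + (b + d)
      shuffle = solve-∀

      near far : Fin 3 → Fin (1 + s + t) → Bool
      near i = P i ∩ allied c
      far  i = P i ∩ (not ∘ allied c)
      near₁ = near (suc zero)
      near₂ = near (suc (suc zero))
      far₁  = far (suc zero)
      far₂  = far (suc (suc zero))

      part-c : part 1 s t c ≡ zero
      part-c = inPart⇒ 1 s t c Pc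

      size : ∀ i → partSize 1 s t i ≡ # (near i) + # (far i)
      size i = trans (sym (#inPart 1 s t i)) (#-split (P i) (allied c))

      near≤ : # near₁ + # near₂ ≤ s₀
      near≤ = ≤-trans (≤-trans (+-mono-≤ (#-mono in₁) (#-mono in₂)) (≤-reflexive (sym (#-split q (P (suc zero))))))
        (few c {q} λ h qh → (λ eq → true≢false (⇒inPart 1 s t h (trans (sym eq) part-c)) (not-true⁻ (∧-conicalˡ _ _ qh)))
                          , ∧-conicalʳ (not (P zero h)) _ qh)
        where
        q : Fin (1 + s + t) → Bool
        q = (not ∘ P zero) ∩ allied c
        other : ∀ i j h → i ≢ j → P i h ≡ true → P j h ≡ false
        other i j h i≢j Pi = ≢true⇒false λ Pj → i≢j (trans (sym (inPart⇒ 1 s t h Pi)) (inPart⇒ 1 s t h Pj))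
        in₁ : near₁ ⊑ q ∩ P (suc zero)
        in₁ h eq = cong₂ _∧_ (cong₂ _∧_ (cong not (other (suc zero) zero h (λ ()) Ph)) (∧-conicalʳ (P (suc zero) h) _ eq)) Ph
          where Ph = ∧-conicalˡ _ _ eq
        in₂ : near₂ ⊑ q ∩ (not ∘ P (suc zero))
        in₂ h eq = cong₂ _∧_ (cong₂ _∧_ (cong not (other (suc (suc zero)) zero h (λ ()) Ph)) (∧-conicalʳ (P (suc (suc zero)) h) _ eq))
                             (cong not (other (suc (suc zero)) (suc zero) h (λ ()) Ph))
          where Ph = ∧-conicalˡ _ _ eq

      -- One far vertex of class `i` is joined to all far vertices of class `j`, and these are its
      -- allies as there are only two sides.
      far-few : ∀ i j → i ≢ j → 0 < # (far i) → # (far j) ≤ s₀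
      far-few i j i≢j 0<far with witness (far i) 0<far
      ... | h , fh = few h {far j} λ h′ fh′ →
          (λ eq → i≢j (trans (sym (inPart⇒ 1 s t h (∧-conicalˡ _ _ fh))) (trans eq (inPart⇒ 1 s t h′ (∧-conicalˡ _ _ fh′)))))
        , differ⇒same {side (f c)} (not-true⁻ (∧-conicalʳ (P i h) _ fh)) (not-true⁻ (∧-conicalʳ (P j h′) _ fh′))

      far-nonempty : ∀ i → # (near i) < partSize 1 s t i → 0 < # (far i)
      far-nonempty i lt = n≢0⇒n>0 λ far≡0 → <-irrefl (sym (trans (size i) (trans (cong (# (near i) ℕ.+_) far≡0) (+-identityʳ _)))) lt

      far₁≤ : # far₁ ≤ s₀
      far₁≤ = far-few (suc (suc zero)) (suc zero) (λ ()) (far-nonempty (suc (suc zero)) (s≤s (≤-trans (≤-trans (m≤n+m _ (# near₁)) near≤) s₀≤t₀)))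
      far₂≤ : # far₂ ≤ s₀
      far₂≤ = far-few (suc zero) (suc (suc zero)) (λ ()) (far-nonempty (suc zero) (s≤s (≤-trans (m≤m+n _ (# near₂)) near≤)))

-- Nonadjacent vertices lie on the same side. A vertex missing all of `S` puts `S` on one side, and
-- a vertex missing only `x zero` is on that side too, with more than `s₀` neighbours there.
cross-complete⇒shattered≤ : ∀ {s₀} (G : Graph n) (side : Fin n → Bool) →
  (∀ w → # (adj G w ∩ (same (side w) ∘ side)) ≤ s₀) → (∀ u v → same (side u) (side v) ≡ false → adj G u v ≡ true) →
  ∀ S → Shattered G S → ∣ S ∣ ≤ suc s₀
cross-complete⇒shattered≤ {n} {s₀} G side allied-degree cross S shattered =
  ≮⇒≥ λ s<∣S∣ → refute (pick (lookup S) (subst (suc (suc s₀) ≤_) (∣∣≡# S) s<∣S∣))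
  where
  nonadjacent : ∀ {u v} → adj G u v ≡ false → side u ≡ side v
  nonadjacent {u} {v} uv with same (side u) (side v) in eq
  ... | true  = same⇒≡ eq
  ... | false = ⊥-elim (true≢false (cross u v eq) uv)
  refute : (∃ λ (x : Fin (suc (suc s₀)) → Fin n) → Injective _≡_ _≡_ x × (∀ i → lookup S (x i) ≡ true)) → ⊥
  refute (x , x-inj , Sx) with realise G shattered (λ _ → false) | realise G shattered (λ u → not ⌊ u ≟ᶠ x zero ⌋)
  ... | v₀ , none | v , all-but = <⇒≱ (≤# {q = adj G v ∩ (same (side v) ∘ side)} (x ∘ suc) (suc-injective ∘ x-inj) in-allies) (allied-degree v)
    where
    v-x₀ : adj G v (x zero) ≡ false
    v-x₀ with x zero ≟ᶠ x zero | all-but (x zero) (Sx zero)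
    ... | yes _ | eq = eq
    ... | no ¬p | _  = ⊥-elim (¬p refl)
    in-allies : ∀ i → (adj G v ∩ (same (side v) ∘ side)) (x (suc i)) ≡ true
    in-allies i = cong₂ _∧_ adjacent (≡⇒same (trans (nonadjacent v-x₀) (trans (sym (nonadjacent (none (x zero) (Sx zero)))) (nonadjacent (none (x (suc i)) (Sx (suc i)))))))
      where
      adjacent : adj G v (x (suc i)) ≡ true
      adjacent with x (suc i) ≟ᶠ x zero | all-but (x (suc i)) (Sx (suc i))
      ... | yes p | _  = ⊥-elim (0≢1+n (sym (x-inj p)))
      ... | no _  | eq = eq

quotient : ∀ n L → 0 < L → ∃ λ e → L * e ≤ n × n < L * suc e
quotient n L@(suc _) _ = n ℕ./ L , subst (_≤ n) (*-comm (n ℕ./ L) L) (m/n*n≤m n L) , (begin-strict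
  n                      ≡⟨ m≡m%n+[m/n]*n n L ⟩
  n % L + n ℕ./ L * L      <⟨ +-monoˡ-< (n ℕ./ L * L) (m%n<n n L) ⟩
  L + n ℕ./ L * L          ≡⟨ *-comm (suc (n ℕ./ L)) L ⟩
  L * suc (n ℕ./ L)        ∎)
  where open ≤-Reasoning

upper-star : ∀ {s₀ t₀} → 1 ≤ s₀ → s₀ ≤ t₀ → 2 * s₀ ≤ suc t₀ →
  UpperBound (K 1 (suc s₀) (suc t₀)) (suc s₀) (suc (2 * suc s₀))
upper-star {s₀} {t₀} 1≤s₀ s₀≤t₀ 2s₀≤t = large⇒UpperBound (K 1 s t) s b λ m →
  _ , s , λ n G → bound (suc m) (s≤s z≤n) n G (2 * (suc m * b)) refl (2 * (suc m * b) * s) refl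
  where
  s = suc s₀
  t = suc t₀
  b = suc (2 * s)

  -- The heaviness bound is `e = n/L` rounded down. `L = 2μb` makes the loss `b e` at most half of
  -- the slack `n/μ`, the other half absorbing `t`; `M = L s` gives `M (e+1) > s n`, as `few-heavy`
  -- demands.
  bound : ∀ μ → 1 ≤ μ → ∀ n (G : Graph n) L → L ≡ 2 * (μ * b) → ∀ M → M ≡ L * s →
    2 * (μ * t) + t₀ * 2 ^ M * M + L * M < n → MaximalFree (K 1 s t) G →
    (s * μ + 1) * n ≤ b * μ * δ G → ∀ S → Shattered G S → ∣ S ∣ ≤ s
  bound μ@(suc _) 1≤μ n G L L≡ M M≡ N₀<n maxG dense = go (quotient n L (≤-trans (s≤s z≤n) 10≤L))
    where
    open ≤-Reasoning

    10≤L : 10 ≤ L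
    10≤L = subst (10 ≤_) (sym L≡) (*-monoʳ-≤ 2 (*-mono-≤ 1≤μ (s≤s (*-monoʳ-≤ 2 (s≤s 1≤s₀)))))

    go : (∃ λ e → L * e ≤ n × n < L * suc e) → ∀ S → Shattered G S → ∣ S ∣ ≤ s
    go (e , Le≤n , n<L[1+e]) = cross-complete⇒shattered≤ G side allied-degree
      (cross-complete G maxG s₀≤t₀ 2s₀≤t side allied-degree)
      where
      free = MaximalFree.free maxG

      M≤e : M ≤ e
      M≤e = ≤-pred (*-cancelˡ-< L M (suc e) (≤-<-trans (≤-trans (m≤n+m (L * M) _) (<⇒≤ N₀<n)) n<L[1+e]))

      few : ∀ w → # (heavy G e w) ≤ e
      few = few-heavy M G e free M≤e (begin-strict
        n * s₀ + t₀ * 2 ^ M * M     <⟨ +-monoʳ-< (n * s₀) (≤-<-trans (≤-trans (m≤n+m _ (2 * (μ * t))) (m≤m+n _ (L * M))) N₀<n) ⟩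
        n * s₀ + n                  ≡⟨ trans (+-comm (n * s₀) n) (trans (sym (*-suc n s₀)) (*-comm n s)) ⟩
        s * n                       ≤⟨ *-monoʳ-≤ s (<⇒≤ n<L[1+e]) ⟩
        s * (L * suc e)             ≡⟨ trans (sym (*-assoc s L (suc e))) (cong (_* suc e) (trans (*-comm s L) (sym M≡))) ⟩
        M * suc e                   ∎)

      slack : μ * (b * e) + μ * t ≤ n
      slack = *-cancelˡ-≤ 2 (begin
        2 * (μ * (b * e) + μ * t)        ≡⟨ shuffle μ b e t ⟩
        2 * (μ * b) * e + 2 * (μ * t)    ≡⟨ cong (λ y → y * e + 2 * (μ * t)) L≡ ⟨
        L * e + 2 * (μ * t)              ≤⟨ +-mono-≤ Le≤n (≤-trans (≤-trans (m≤m+n _ _) (m≤m+n _ (L * M))) (<⇒≤ N₀<n)) ⟩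
        n + n                            ≡⟨ cong (n ℕ.+_) (+-identityʳ n) ⟨
        2 * n                            ∎)
        where
        shuffle : ∀ m b e t → 2 * (m * (b * e) + m * t) ≡ 2 * (m * b) * e + 2 * (m * t)
        shuffle = solve-∀

      dense′ : s * n + t + b * e ≤ b * δ G
      dense′ = *-cancelˡ-≤ μ (begin
        μ * (s * n + t + b * e)              ≡⟨ shuffle μ s n t (b * e) ⟩
        s * μ * n + (μ * (b * e) + μ * t)    ≤⟨ +-monoʳ-≤ (s * μ * n) slack ⟩
        s * μ * n + n                        ≡⟨ shuffle′ (s * μ) n ⟩
        (s * μ + 1) * n                      ≤⟨ dense ⟩
        b * μ * δ G                          ≡⟨ trans (cong (_* δ G) (*-comm b μ)) (*-assoc μ b (δ G)) ⟩
        μ * (b * δ G)                        ∎)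
        where
        shuffle : ∀ m s n t x → m * (s * n + t + x) ≡ s * m * n + (m * x + m * t)
        shuffle = solve-∀
        shuffle′ : ∀ a n → a * n + n ≡ (a + 1) * n
        shuffle′ = solve-∀

      e≤δ : e ≤ δ G
      e≤δ = *-cancelˡ-≤ b (≤-trans (m≤n+m (b * e) (s * n + t)) dense′)

      D : ℕ
      D = δ G ∸ e

      D+e≡δ : D + e ≡ δ G
      D+e≡δ = m∸n+n≡m e≤δ

      sn+t≤ : s * n + t ≤ b * D
      sn+t≤ = +-cancelʳ-≤ (b * e) _ _ (≤-trans dense′ (≤-reflexive (trans (cong (b *_) (sym D+e≡δ)) (*-distribˡ-+ b D e))))

      -- Here `s ≥ 2` enters, through `2/5 ≤ s/(2s+1)`.
      2n<5D : 2 * n < 5 * D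
      2n<5D = ≰⇒> λ 5D≤2n → <⇒≱ (m<m+n (2 * n) {5 * t} (s≤s z≤n)) (+-cancelˡ-≤ (4 * (s * n)) _ _ (begin
        4 * (s * n) + (2 * n + 5 * t)      ≤⟨ +-monoʳ-≤ (4 * (s * n)) (+-monoˡ-≤ (5 * t) (*-monoˡ-≤ n (s≤s 1≤s₀))) ⟩
        4 * (s * n) + (s * n + 5 * t)      ≡⟨ shuffle (s * n) t ⟩
        5 * (s * n + t)                    ≤⟨ *-monoʳ-≤ 5 sn+t≤ ⟩
        5 * (b * D)                        ≡⟨ swap 5 b D ⟩
        b * (5 * D)                        ≤⟨ *-monoʳ-≤ b 5D≤2n ⟩
        b * (2 * n)                        ≡⟨ expand s n ⟩
        4 * (s * n) + 2 * n                ∎))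
        where
        shuffle : ∀ x t → 4 * x + (x + 5 * t) ≡ 5 * (x + t)
        shuffle = solve-∀
        swap : ∀ a b c → a * (b * c) ≡ b * (a * c)
        swap = solve-∀
        expand : ∀ s n → suc (2 * s) * (2 * n) ≡ 4 * (s * n) + 2 * n
        expand = solve-∀

      -- From `10 e ≤ n`, that is `L ≥ 10`: `5 (n + 2e) ≤ 6n`, which is below `15 D`.
      n+2e<3D : n + 2 * e < 3 * D
      n+2e<3D = *-cancelˡ-< 5 _ _ (begin-strict
        5 * (n + 2 * e)        ≡⟨ shuffle n e ⟩
        5 * n + 10 * e         ≤⟨ +-monoʳ-≤ (5 * n) (≤-trans (*-monoˡ-≤ e 10≤L) Le≤n) ⟩
        5 * n + n              ≡⟨ shuffle′ n ⟩
        3 * (2 * n)            <⟨ *-monoʳ-< 3 2n<5D ⟩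
        3 * (5 * D)            ≡⟨ swap 3 5 D ⟩
        5 * (3 * D)            ∎)
        where
        shuffle : ∀ n e → 5 * (n + 2 * e) ≡ 5 * n + 10 * e
        shuffle = solve-∀
        shuffle′ : ∀ n → 5 * n + n ≡ 3 * (2 * n)
        shuffle′ = solve-∀
        swap : ∀ a b c → a * (b * c) ≡ b * (a * c)
        swap = solve-∀

      open NearlyBipartite G s₀ t₀ e D free (λ v → ≤-trans (≤-reflexive D+e≡δ) (δ≤# G v)) few 2n<5D n+2e<3D
        (≤-trans sn+t≤ (≤-reflexive (cong (_* D) (sym (+-comm (2 * s) 1))))) (fromℕ< (≤-<-trans z≤n N₀<n))

-- Lower bounds

≟-true : (i : Fin n) → ⌊ i ≟ᶠ i ⌋ ≡ true
≟-true i with i ≟ᶠ i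
... | yes _ = refl
... | no ¬p = ⊥-elim (¬p refl)

≟-true⁻ : {i j : Fin n} → ⌊ i ≟ᶠ j ⌋ ≡ true → i ≡ j
≟-true⁻ {i = i} {j} eq with i ≟ᶠ j
... | yes p = p

≟-false : {i j : Fin n} → i ≢ j → ⌊ i ≟ᶠ j ⌋ ≡ false
≟-false {i = i} {j} i≢j with i ≟ᶠ j
... | yes p = ⊥-elim (i≢j p)
... | no _  = refl

≟-sym : (i j : Fin n) → ⌊ i ≟ᶠ j ⌋ ≡ ⌊ j ≟ᶠ i ⌋
≟-sym i j with i ≟ᶠ j | j ≟ᶠ i
... | yes _ | yes _ = refl
... | no _  | no _  = refl
... | yes p | no ¬q = ⊥-elim (¬q (sym p))
... | no ¬p | yes q = ⊥-elim (¬p (sym q))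

addEdge-⊆ : {G G′ : Graph n} → G ⊆ᴳ G′ → ∀ u v (u≢v : u ≢ v) → adj G′ u v ≡ true → addEdge G u v u≢v ⊆ᴳ G′
addEdge-⊆ {G = G} {G′} G⊆ u v u≢v uv x y xy with addEdge⁻ G u v u≢v {x} {y} xy
... | inj₁ e                    = G⊆ x y e
... | inj₂ (inj₁ (refl , refl)) = uv
... | inj₂ (inj₂ (refl , refl)) = edge-sym G′ uv

-- The nonedges xᵢ y_w are saturated, hence survive in every maximal
-- H-free extension, which therefore still shatters {x₁, …, x_d}.
shattering-extension : ∀ {d} (H : Graph m) (G : Graph n) → H -Free G →
  (x : Fin d → Fin n) → Injective _≡_ _≡_ x → (y : (Fin d → Bool) → Fin n) →
  (∀ f i → f i ≡ true → adj G (x i) (y f) ≡ true) →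
  (∀ f i → f i ≡ false → ∃ λ (x≢y : x i ≢ y f) → Contains H (addEdge G (x i) (y f) x≢y)) →
  ∃ λ G′ → G ⊆ᴳ G′ × MaximalFree H G′ × d ≤ VC G′
shattering-extension {d = d} H G free x x-inj y edge nonedge with maximal-extension H G free
... | G′ , G⊆ , maxG′ = G′ , G⊆ , maxG′ , ≤VC G′ x x-inj (λ f → y f , λ i → trans (adj-sym G′ (y f) (x i)) (value f i))
  where
  value : ∀ f i → adj G′ (x i) (y f) ≡ f i
  value f i with f i in fi
  ... | true  = G⊆ _ _ (edge f i fi)
  ... | false = ≢true⇒false λ xy → let x≢y , cont = nonedge f i fi in
    MaximalFree.free maxG′ (Contains-mono H {addEdge G (x i) (y f) x≢y} {G′} (addEdge-⊆ {G = G} {G′} G⊆ (x i) (y f) x≢y xy) cont)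

pattern big₁ b  = inj₁ (inj₁ b)
pattern inQ i j = inj₁ (inj₂ (i , j))
pattern big₂ b  = inj₂ (inj₁ b)
pattern inR w l = inj₂ (inj₂ (w , l))

-- Two sides, each consisting of many isolated vertices and of some disjoint
-- copies of a small gadget graph (Q on the first side, R on the second).
-- Copies of Q are indexed by i < d and copies of R by the subsets w of
-- {0, …, d-1}; whether i ∈ w decides how they are linked.
module Gadgets (q ρ β₁ β₂ d : ℕ) (Q : Graph q) (R : Graph ρ)
  (type : Fin q → Fin β₂ → Bool) (link : Bool → Fin q → Fin ρ → Bool) where

  V : Set
  V = (Fin β₁ ⊎ (Fin d × Fin q)) ⊎ (Fin β₂ ⊎ (Fin (2 ^ d) × Fin ρ))

  order : ℕ
  order = (β₁ + d * q) + (β₂ + 2 ^ d * ρ)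

  -- Kept opaque so that vertices do not unfold into index arithmetic; the two inverse laws suffice.
  abstract
    iso : Fin order ↔ V
    iso = ↔-trans +↔⊎ (↔-trans +↔⊎ (↔-refl ⊎-↔ *↔×) ⊎-↔ ↔-trans +↔⊎ (↔-refl ⊎-↔ *↔×))

  dec : Fin order → V
  dec = Inverse.to iso

  enc : V → Fin order
  enc = Inverse.from iso

  dec-enc : ∀ v → dec (enc v) ≡ v
  dec-enc = Inverse.strictlyInverseˡ iso

  enc-dec : ∀ u → enc (dec u) ≡ u
  enc-dec = Inverse.strictlyInverseʳ iso

  enc-injective : ∀ {u v} → enc u ≡ enc v → u ≡ v
  enc-injective {u} {v} eq = trans (sym (dec-enc u)) (trans (cong dec eq) (dec-enc v))

  dec-injective : ∀ {u v} → dec u ≡ dec v → u ≡ v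
  dec-injective {u} {v} eq = trans (sym (enc-dec u)) (trans (cong enc eq) (enc-dec v))

  isOne : Fin 2 → Bool
  isOne zero    = false
  isOne (suc _) = true

  bit : Fin (2 ^ d) → Fin d → Bool
  bit w i = isOne (finToFun {2} {d} w i)

  subset : (Fin d → Bool) → Fin (2 ^ d)
  subset f = funToFin {d} {2} (λ i → if f i then suc zero else zero)

  bit-subset : ∀ f i → bit (subset f) i ≡ f i
  bit-subset f i = trans (cong isOne (finToFun-funToFin {d} {2} (λ i → if f i then suc zero else zero) i)) (back (f i))
    where
    back : ∀ b → isOne (if b then suc zero else zero) ≡ b
    back true  = refl
    back false = refl

  adjⱽ : V → V → Bool
  adjⱽ (big₁ _)  (big₁ _)    = false
  adjⱽ (big₁ _)  (inQ _ _)   = false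
  adjⱽ (big₁ _)  (big₂ _)    = true
  adjⱽ (big₁ _)  (inR _ _)   = true
  adjⱽ (inQ _ _) (big₁ _)    = false
  adjⱽ (inQ i j) (inQ i′ j′) = ⌊ i ≟ᶠ i′ ⌋ ∧ adj Q j j′
  adjⱽ (inQ i j) (big₂ b)    = type j b
  adjⱽ (inQ i j) (inR w l)   = link (bit w i) j l
  adjⱽ (big₂ _)  (big₁ _)    = true
  adjⱽ (big₂ b)  (inQ i j)   = type j b
  adjⱽ (big₂ _)  (big₂ _)    = false
  adjⱽ (big₂ _)  (inR _ _)   = false
  adjⱽ (inR _ _) (big₁ _)    = true
  adjⱽ (inR w l) (inQ i j)   = link (bit w i) j l
  adjⱽ (inR _ _) (big₂ _)    = false
  adjⱽ (inR w l) (inR w′ l′) = ⌊ w ≟ᶠ w′ ⌋ ∧ adj R l l′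

  adjⱽ-sym : ∀ u v → adjⱽ u v ≡ adjⱽ v u
  adjⱽ-sym (big₁ _)  (big₁ _)    = refl
  adjⱽ-sym (big₁ _)  (inQ _ _)   = refl
  adjⱽ-sym (big₁ _)  (big₂ _)    = refl
  adjⱽ-sym (big₁ _)  (inR _ _)   = refl
  adjⱽ-sym (inQ _ _) (big₁ _)    = refl
  adjⱽ-sym (inQ i j) (inQ i′ j′) = cong₂ _∧_ (≟-sym i i′) (adj-sym Q j j′)
  adjⱽ-sym (inQ i j) (big₂ b)    = refl
  adjⱽ-sym (inQ i j) (inR w l)   = refl
  adjⱽ-sym (big₂ _)  (big₁ _)    = refl
  adjⱽ-sym (big₂ b)  (inQ i j)   = refl
  adjⱽ-sym (big₂ _)  (big₂ _)    = refl
  adjⱽ-sym (big₂ _)  (inR _ _)   = refl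
  adjⱽ-sym (inR _ _) (big₁ _)    = refl
  adjⱽ-sym (inR w l) (inQ i j)   = refl
  adjⱽ-sym (inR _ _) (big₂ _)    = refl
  adjⱽ-sym (inR w l) (inR w′ l′) = cong₂ _∧_ (≟-sym w w′) (adj-sym R l l′)

  adjⱽ-irrefl : ∀ v → adjⱽ v v ≡ false
  adjⱽ-irrefl (big₁ _)  = refl
  adjⱽ-irrefl (inQ i j) = trans (cong (⌊ i ≟ᶠ i ⌋ ∧_) (adj-irrefl Q j)) (∧-zeroʳ _)
  adjⱽ-irrefl (big₂ _)  = refl
  adjⱽ-irrefl (inR w l) = trans (cong (⌊ w ≟ᶠ w ⌋ ∧_) (adj-irrefl R l)) (∧-zeroʳ _)

  G : Graph order
  G = record
    { adj        = λ u v → adjⱽ (dec u) (dec v)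
    ; adj-sym    = λ u v → adjⱽ-sym (dec u) (dec v)
    ; adj-irrefl = λ v → adjⱽ-irrefl (dec v)
    }

  -- Only vertices in copies of `Q` may miss isolated vertices of the opposite side, so `φ` is asked
  -- for them alone.
  degree≥ : k ≤ β₁ → k ≤ β₂ →
    (∀ j → ∃ λ (φ : Fin k → Fin β₂) → Injective _≡_ _≡_ φ × (∀ b → type j (φ b) ≡ true)) →
    ∀ v → k ≤ # (adj G v)
  degree≥ {k} k≤β₁ k≤β₂ φ v = by-kind (dec v) refl
    where
    injected : (g : Fin k → V) → (∀ {a b} → g a ≡ g b → a ≡ b) → (∀ b → adjⱽ (dec v) (g b) ≡ true) → k ≤ # (adj G v)
    injected g g-inj v~g = ≤# (enc ∘ g) (λ eq → g-inj (enc-injective eq)) (λ b → trans (cong (adjⱽ (dec v)) (dec-enc (g b))) (v~g b))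
    to-big₁ : (∀ b → adjⱽ (dec v) (big₁ b) ≡ true) → k ≤ # (adj G v)
    to-big₁ v~ = injected (λ b → big₁ (inject≤ b k≤β₁)) (λ eq → inject≤-injective k≤β₁ k≤β₁ _ _ (inj₁-injective (inj₁-injective eq))) (λ b → v~ _)
    by-kind : ∀ u → dec v ≡ u → k ≤ # (adj G v)
    by-kind (big₁ _) eq = injected (λ b → big₂ (inject≤ b k≤β₂)) (λ e → inject≤-injective k≤β₂ k≤β₂ _ _ (inj₁-injective (inj₂-injective e)))
                            (λ b → cong (λ u → adjⱽ u (big₂ (inject≤ b k≤β₂))) eq)
    by-kind (big₂ _) eq = to-big₁ (λ b → cong (λ u → adjⱽ u (big₁ b)) eq)
    by-kind (inR _ _) eq = to-big₁ (λ b → cong (λ u → adjⱽ u (big₁ b)) eq)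
    by-kind (inQ i j) eq = let f , f-inj , typed = φ j in
      injected (λ b → big₂ (f b)) (λ e → f-inj (inj₁-injective (inj₂-injective e))) (λ b → trans (cong (λ u → adjⱽ u (big₂ (f b))) eq) (typed b))

  NoCopy : Graph m → Set
  NoCopy {m} H = ∀ (F : Fin m → V) → Injective _≡_ _≡_ F → (∀ u v → adj H u v ≡ true → adjⱽ (F u) (F v) ≡ true) → ⊥

  module _ (x₀ : Fin q) (y₀ : Fin ρ) where

    Joined : Fin d → Fin (2 ^ d) → V → V → Set
    Joined i w u v = adjⱽ u v ≡ true ⊎ (u ≡ inQ i x₀ × v ≡ inR w y₀) ⊎ (u ≡ inR w y₀ × v ≡ inQ i x₀)

    record Completion (r s t : ℕ) (i : Fin d) (w : Fin (2 ^ d)) : Set where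
      field
        f₀ : Fin r → V
        f₁ : Fin s → V
        f₂ : Fin t → V
        f₀-inj : Injective _≡_ _≡_ f₀
        f₁-inj : Injective _≡_ _≡_ f₁
        f₂-inj : Injective _≡_ _≡_ f₂
        e₀₁ : ∀ a b → Joined i w (f₀ a) (f₁ b)
        e₀₂ : ∀ a b → Joined i w (f₀ a) (f₂ b)
        e₁₂ : ∀ a b → Joined i w (f₁ a) (f₂ b)

    lower-bound : ∀ {r s t} → k ≤ β₁ → k ≤ β₂ →
      (∀ j → ∃ λ (φ : Fin k → Fin β₂) → Injective _≡_ _≡_ φ × (∀ b → type j (φ b) ≡ true)) →
      link true x₀ y₀ ≡ true → NoCopy (K r s t) → (∀ i w → bit w i ≡ false → Completion r s t i w) →
      ∃ λ G′ → MaximalFree (K r s t) G′ × d ≤ VC G′ × k ≤ δ {order} G′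
    lower-bound {k} {r} {s} {t} k≤β₁ k≤β₂ φ linked no-copy completion =
      let G′ , G⊆ , maxG′ , d≤VC = shattering-extension (K r s t) G free x x-inj y edge nonedge
      in  G′ , maxG′ , d≤VC , ≤δ G′ (≤-trans k≤β₁ (≤-trans (m≤m+n β₁ (d * q)) (m≤m+n _ _))) (λ v → ≤-trans (degree≥ k≤β₁ k≤β₂ φ v) (#-mono (G⊆ v)))
      where
      free : K r s t -Free G
      free (f , f-inj , hom) = no-copy (dec ∘ f) (λ eq → f-inj (dec-injective eq)) hom
      x : Fin d → Fin order
      x i = enc (inQ i x₀)
      x-inj : Injective _≡_ _≡_ x
      x-inj eq = cong proj₁ (inj₂-injective (inj₁-injective (enc-injective eq)))
      y : (Fin d → Bool) → Fin order
      y f = enc (inR (subset f) y₀)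
      edge : ∀ f i → f i ≡ true → adj G (x i) (y f) ≡ true
      edge f i fi = trans (cong₂ adjⱽ (dec-enc (inQ i x₀)) (dec-enc (inR (subset f) y₀)))
        (trans (cong (λ b → link b x₀ y₀) (trans (bit-subset f i) fi)) linked)
      x≢y : ∀ i f → x i ≢ y f
      x≢y i f eq with () ← enc-injective eq
      nonedge : ∀ f i → f i ≡ false → ∃ λ (x≢y : x i ≢ y f) → Contains (K r s t) (addEdge G (x i) (y f) x≢y)
      nonedge f i fi = x≢y i f , K-copy G⁺ (enc ∘ f₀) (enc ∘ f₁) (enc ∘ f₂) (f₀-inj ∘ enc-injective) (f₁-inj ∘ enc-injective) (f₂-inj ∘ enc-injective)
        (λ a b → joined (e₀₁ a b)) (λ a b → joined (e₀₂ a b)) (λ a b → joined (e₁₂ a b))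
        where
        G⁺ = addEdge G (x i) (y f) (x≢y i f)
        open Completion (completion i (subset f) (trans (bit-subset f i) fi))
        joined : ∀ {u v} → Joined i (subset f) u v → adj G⁺ (enc u) (enc v) ≡ true
        joined {u} {v} (inj₁ uv) = addEdge-⊇ G (x i) (y f) (x≢y i f) (enc u) (enc v) (trans (cong₂ adjⱽ (dec-enc u) (dec-enc v)) uv)
        joined (inj₂ (inj₁ (refl , refl))) = addEdge-new G (x i) (y f) (x≢y i f)
        joined (inj₂ (inj₂ (refl , refl))) = edge-sym G⁺ {x i} {y f} (addEdge-new G (x i) (y f) (x≢y i f))

#-complement : (p : Fin n → Bool) → # p + # (not ∘ p) ≡ n
#-complement {n} p = trans (sym (#-split (λ _ → true) p)) (#-full {n} (λ _ → refl))

hits : {p : Fin m → Bool} (f : Fin m → Fin n) → (∀ {h h′} → p h ≡ true → p h′ ≡ true → f h ≡ f h′ → h ≡ h′) →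
  n ≤ # p → ∀ j → ∃ λ h → p h ≡ true × f h ≡ j
hits {n = n} {p = p} f f-inj n≤#p j with any? (λ h → (p h ≟ᵇ true) ×-dec (f h ≟ᶠ j))
... | yes found = found
... | no none = ⊥-elim (<⇒≱ fewer (≤-trans n≤#p (#-injection {p = p} f f-inj (λ h ph → cong not (≟-false (λ eq → none (h , ph , eq)))))))
  where
  fewer : # (λ j′ → not ⌊ j′ ≟ᶠ j ⌋) < n
  fewer = subst (# (λ j′ → not ⌊ j′ ≟ᶠ j ⌋) <_) (#-complement (λ j′ → ⌊ j′ ≟ᶠ j ⌋)) (m<n+m _ (0<# {p = λ j′ → ⌊ j′ ≟ᶠ j ⌋} j (≟-true j)))

others : ∀ (c : Fin 3) → ∃₂ λ d e → d ≢ c × e ≢ c × d ≢ e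
others zero             = suc zero , suc (suc zero) , (λ ()) , (λ ()) , λ ()
others (suc zero)       = zero , suc (suc zero) , (λ ()) , (λ ()) , λ ()
others (suc (suc zero)) = zero , suc zero , (λ ()) , (λ ()) , λ ()

-- Colour classes of a copy and its position among the gadgets

module Parts (r s t : ℕ) where

  order : ℕ
  order = r + s + t

  Mono : (Fin order → Bool) → Set
  Mono Z = ∃ λ c → ∀ h → Z h ≡ true → part r s t h ≡ c

  Mixed : (Fin order → Bool) → Set
  Mixed Z = ∃₂ λ g g′ → Z g ≡ true × Z g′ ≡ true × part r s t g ≢ part r s t g′

  mono-or-mixed : ∀ Z → Mono Z ⊎ Mixed Z
  mono-or-mixed Z with any? (λ h → Z h ≟ᵇ true)
  ... | no none = inj₁ (zero , λ h Zh → ⊥-elim (none (h , Zh)))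
  ... | yes (g , Zg) with any? (λ h → (Z h ≟ᵇ true) ×-dec ¬? (part r s t g ≟ᶠ part r s t h))
  ...   | yes (g′ , Zg′ , ≢) = inj₂ (g , g′ , Zg , Zg′ , ≢)
  ...   | no none = inj₁ (part r s t g , λ h Zh → same-part h Zh (part r s t g ≟ᶠ part r s t h))
    where
    same-part : ∀ h → Z h ≡ true → Dec (part r s t g ≡ part r s t h) → part r s t h ≡ part r s t g
    same-part h Zh (yes eq) = sym eq
    same-part h Zh (no ≢)   = ⊥-elim (none (h , Zh , ≢))

  mono-size : ∀ {Z} ((c , _) : Mono Z) → # Z ≤ partSize r s t c
  mono-size (c , mono) = ≤-trans (#-mono (λ h Zh → ⇒inPart r s t h (mono h Zh))) (≤-reflexive (#inPart r s t c))

  other-parts : ∀ {Z} ((c , _) : Mono Z) {h} → part r s t h ≢ c → not (Z h) ≡ true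
  other-parts {Z} (c , mono) {h} ≢ with Z h in eq
  ... | false = refl
  ... | true  = ⊥-elim (≢ (mono h eq))

  member : ∀ c → 0 < partSize r s t c → ∃ λ h → part r s t h ≡ c
  member c 0<size with witness (inPart r s t c) (subst (0 <_) (sym (#inPart r s t c)) 0<size)
  ... | h , Ph = h , inPart⇒ r s t h Ph

  second-member : ∀ c → 2 ≤ partSize r s t c → ∀ h → ∃ λ h′ → part r s t h′ ≡ c × h′ ≢ h
  second-member c 2≤size h with pick {k = 2} (inPart r s t c) (subst (2 ≤_) (sym (#inPart r s t c)) 2≤size)
  ... | f , f-inj , Pf with f zero ≟ᶠ h
  ...   | no ≢     = f zero , inPart⇒ r s t _ (Pf zero) , ≢
  ...   | yes refl = f (suc zero) , inPart⇒ r s t _ (Pf (suc zero)) , λ eq → 0≢1+n (sym (f-inj eq))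

  -- Two classes cannot cover three nonempty ones.
  complement-mixed : (∀ c → 0 < partSize r s t c) → ∀ {Z} → Mono Z → ¬ Mono (not ∘ Z)
  complement-mixed nonempty mono@(c , _) (c′ , mono′) = go (others c)
    where
    in-c′ : ∀ {d} → d ≢ c → d ≡ c′
    in-c′ {d} d≢c with member d (nonempty d)
    ... | h , refl = mono′ h (other-parts mono d≢c)
    go : (∃₂ λ d e → d ≢ c × e ≢ c × d ≢ e) → ⊥
    go (d , e , d≢c , e≢c , d≢e) = d≢e (trans (in-c′ d≢c) (sym (in-c′ e≢c)))

-- A hypothetical copy splits into `X` on the first side and `Y` on the second. A part meeting two
-- classes is confined to one gadget; a part inside one class has bounded size. The constructions
-- are all checked by these four cases.
module GadgetCopy (q ρ β₁ β₂ d : ℕ) (Q : Graph q) (R : Graph ρ)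
  (type : Fin q → Fin β₂ → Bool) (link : Bool → Fin q → Fin ρ → Bool) (x₀ : Fin q) (y₀ : Fin ρ) (r s t : ℕ)
  (F : Fin (r + s + t) → Gadgets.V q ρ β₁ β₂ d Q R type link) (F-inj : Injective _≡_ _≡_ F)
  (hom : ∀ u v → adj (K r s t) u v ≡ true → Gadgets.adjⱽ q ρ β₁ β₂ d Q R type link (F u) (F v) ≡ true) where

  open Gadgets q ρ β₁ β₂ d Q R type link
  open Parts r s t hiding (order)

  p : Fin (r + s + t) → Fin 3
  p = part r s t

  X Y : Fin (r + s + t) → Bool
  X h = [ const true , const false ]′ (F h)
  Y h = not (X h)

  edge : ∀ {h h′} → p h ≢ p h′ → adjⱽ (F h) (F h′) ≡ true
  edge {h} {h′} ≢ = hom h h′ (K-edge r s t h h′ ≢)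

  -- Outside the gadgets, toQ and toR take the junk values x₀ and y₀.
  toQ : V → Fin q
  toQ (inQ _ j) = j
  toQ _         = x₀

  toR : V → Fin ρ
  toR (inR _ l) = l
  toR _         = y₀

  ℓQ : Fin (r + s + t) → Fin q
  ℓQ = toQ ∘ F

  ℓR : Fin (r + s + t) → Fin ρ
  ℓR = toR ∘ F

  InQ : Fin d → Set
  InQ i = ∀ h → X h ≡ true → F h ≡ inQ i (ℓQ h)

  InR : Fin (2 ^ d) → Set
  InR w = ∀ h → Y h ≡ true → F h ≡ inR w (ℓR h)

  ℓQ-inj : ∀ {i} → InQ i → ∀ {h h′} → X h ≡ true → X h′ ≡ true → ℓQ h ≡ ℓQ h′ → h ≡ h′
  ℓQ-inj inQi Xh Xh′ eq = F-inj (trans (inQi _ Xh) (trans (cong (λ j → inQ _ j) eq) (sym (inQi _ Xh′))))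

  ℓR-inj : ∀ {w} → InR w → ∀ {h h′} → Y h ≡ true → Y h′ ≡ true → ℓR h ≡ ℓR h′ → h ≡ h′
  ℓR-inj inRw Yh Yh′ eq = F-inj (trans (inRw _ Yh) (trans (cong (λ l → inR _ l) eq) (sym (inRw _ Yh′))))

  edgeQ : ∀ {i} → InQ i → ∀ {h h′} → X h ≡ true → X h′ ≡ true → p h ≢ p h′ → adj Q (ℓQ h) (ℓQ h′) ≡ true
  edgeQ {i} inQi Xh Xh′ ≢ = ∧-conicalʳ ⌊ i ≟ᶠ i ⌋ _ (trans (sym (cong₂ adjⱽ (inQi _ Xh) (inQi _ Xh′))) (edge ≢))

  edgeR : ∀ {w} → InR w → ∀ {h h′} → Y h ≡ true → Y h′ ≡ true → p h ≢ p h′ → adj R (ℓR h) (ℓR h′) ≡ true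
  edgeR {w} inRw Yh Yh′ ≢ = ∧-conicalʳ ⌊ w ≟ᶠ w ⌋ _ (trans (sym (cong₂ adjⱽ (inRw _ Yh) (inRw _ Yh′))) (edge ≢))

  edgeQR : ∀ {i w} → InQ i → InR w → ∀ {h h′} → X h ≡ true → Y h′ ≡ true → p h ≢ p h′ → link (bit w i) (ℓQ h) (ℓR h′) ≡ true
  edgeQR inQi inRw Xh Yh′ ≢ = trans (sym (cong₂ adjⱽ (inQi _ Xh) (inRw _ Yh′))) (edge ≢)

  -- A complete multipartite graph meeting two classes is connected.
  mixed⇒InQ : Mixed X → ∃ InQ
  mixed⇒InQ (g , g′ , Xg , Xg′ , g≢g′) with F g in Fg | F g′ in Fg′ | edge g≢g′
  ... | big₁ _  | big₁ _    | ()
  ... | big₁ _  | inQ _ _   | ()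
  ... | inQ _ _ | big₁ _    | ()
  ... | inQ i j | inQ i′ j′ | gg′ with ≟-true⁻ {i = i} {i′} (∧-conicalˡ _ _ gg′)
  ...   | refl = i , inside
    where
    near : ∀ {u h j} → F u ≡ inQ i j → p u ≢ p h → X h ≡ true → F h ≡ inQ i (ℓQ h)
    near {u} {h} Fu u≢h Xh with F h | edge {u} {h} u≢h
    ... | inj₂ _     | _ with () ← Xh
    ... | big₁ _     | uh rewrite Fu with () ← uh
    ... | inQ i″ _   | uh rewrite Fu = cong (λ i → inQ i _) (sym (≟-true⁻ (∧-conicalˡ ⌊ i ≟ᶠ i″ ⌋ _ uh)))
    inside : InQ i
    inside h Xh with p g ≟ᶠ p h
    ... | no g≢h  = near Fg g≢h Xh
    ... | yes g≡h = near Fg′ (λ g′≡h → g≢g′ (trans g≡h (sym g′≡h))) Xh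

  mixed⇒InR : Mixed Y → ∃ InR
  mixed⇒InR (g , g′ , Yg , Yg′ , g≢g′) with F g in Fg | F g′ in Fg′ | edge g≢g′
  ... | big₂ _  | big₂ _    | ()
  ... | big₂ _  | inR _ _   | ()
  ... | inR _ _ | big₂ _    | ()
  ... | inR i j | inR i′ j′ | gg′ with ≟-true⁻ {i = i} {i′} (∧-conicalˡ _ _ gg′)
  ...   | refl = i , inside
    where
    near : ∀ {u h j} → F u ≡ inR i j → p u ≢ p h → Y h ≡ true → F h ≡ inR i (ℓR h)
    near {u} {h} Fu u≢h Yh with F h | edge {u} {h} u≢h
    ... | inj₁ _     | _ with () ← Yh
    ... | big₂ _     | uh rewrite Fu with () ← uh
    ... | inR i″ _   | uh rewrite Fu = cong (λ i → inR i _) (sym (≟-true⁻ (∧-conicalˡ ⌊ i ≟ᶠ i″ ⌋ _ uh)))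
    inside : InR i
    inside h Yh with p g ≟ᶠ p h
    ... | no g≢h  = near Fg g≢h Yh
    ... | yes g≡h = near Fg′ (λ g′≡h → g≢g′ (trans g≡h (sym g′≡h))) Yh

  #X+#Y : # X + # Y ≡ r + s + t
  #X+#Y = #-complement X

  #X≤q : ∀ {i} → InQ i → # X ≤ q
  #X≤q inQi = ≤-trans (#-injection {p = X} {λ _ → true} ℓQ (ℓQ-inj inQi) (λ _ _ → refl)) (#≤n {q} (λ _ → true))

  #Y≤ρ : ∀ {w} → InR w → # Y ≤ ρ
  #Y≤ρ inRw = ≤-trans (#-injection {p = Y} {λ _ → true} ℓR (ℓR-inj inRw) (λ _ _ → refl)) (#≤n {ρ} (λ _ → true))

-- The three gadget constructions

complete : ∀ n → Graph n
complete n = record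
  { adj        = λ u v → not ⌊ u ≟ᶠ v ⌋
  ; adj-sym    = λ u v → cong not (≟-sym u v)
  ; adj-irrefl = λ v → cong not (≟-true v)
  }

bicoloured : (Fin n → Bool) → Graph n
bicoloured c = record
  { adj        = λ u v → not (same (c u) (c v))
  ; adj-sym    = λ u v → cong not (same-sym (c u) (c v))
  ; adj-irrefl = λ v → cong not (≡⇒same {c v} refl)
  }
  where
  same-sym : ∀ a b → same a b ≡ same b a
  same-sym true  true  = refl
  same-sym true  false = refl
  same-sym false true  = refl
  same-sym false false = refl

isLeft : ∀ a {b} → Fin (a + b) → Bool
isLeft a l = [ const true , const false ]′ (splitAt a l)

isLeft-↑ˡ : ∀ a b (i : Fin a) → isLeft a (i ↑ˡ b) ≡ true
isLeft-↑ˡ a b i rewrite splitAt-↑ˡ a i b = refl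

isLeft-↑ʳ : ∀ a b (i : Fin b) → isLeft a (a ↑ʳ i) ≡ false
isLeft-↑ʳ a b i rewrite splitAt-↑ʳ a b i = refl

left≢right : ∀ a b (i : Fin a) (j : Fin b) → i ↑ˡ b ≢ a ↑ʳ j
left≢right a b i j eq = true≢false (isLeft-↑ˡ a b i) (trans (cong (isLeft a) eq) (isLeft-↑ʳ a b j))

left-right-edge : ∀ a b (i : Fin a) (j : Fin b) → adj (bicoloured (isLeft a)) (i ↑ˡ b) (a ↑ʳ j) ≡ true
left-right-edge a b i j = cong₂ (λ x y → not (same x y)) (isLeft-↑ˡ a b i) (isLeft-↑ʳ a b j)

no-bicoloured-triangle : (c : Fin n → Bool) → ∀ u v w → adj (bicoloured c) u v ≡ true → adj (bicoloured c) u w ≡ true →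
  ¬ adj (bicoloured c) v w ≡ true
no-bicoloured-triangle c u v w uv uw vw =
  true≢false (differ⇒same {c u} (not-true⁻ uv) (not-true⁻ uw)) (not-true⁻ vw)

-- Sides of about `s N` and `(s+1) N` vertices: missing one block out of `s + 1` leaves a gadget
-- vertex degree at least `s N` in order about `(2s+1) N`. A gadget is a complete graph on `s + 1`
-- vertices whose common neighbours on the second side are only `t - 1` in number.
module Star (s₀ t₀ N d : ℕ) (s₀≤t₀ : s₀ ≤ t₀) where
  s t q β₁ β₂ : ℕ
  s  = suc s₀
  t  = suc t₀
  q  = suc s
  β₁ = s * N
  β₂ = q * N + t₀

  -- Each gadget vertex sees s of the s + 1 blocks of the second side, but no
  -- vertex of a block sees a whole gadget; the last t₀ vertices see all of it.
  type : Fin q → Fin β₂ → Bool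
  type j b = [ (λ b′ → not ⌊ proj₁ (remQuot {q} N b′) ≟ᶠ j ⌋) , const true ]′ (splitAt (q * N) b)

  omitted : Bool → Fin q
  omitted b = if b then suc zero else zero

  link : Bool → Fin q → Fin 1 → Bool
  link b j _ = not ⌊ j ≟ᶠ omitted b ⌋

  open Gadgets q 1 β₁ β₂ d (complete q) (complete 1) type link

  spread : ∀ j → ∃ λ (φ : Fin (s * N) → Fin β₂) → Injective _≡_ _≡_ φ × (∀ b → type j (φ b) ≡ true)
  spread j = φ , φ-inj , typed
    where
    block : Fin (s * N) → Fin (q * N)
    block b = combine (punchIn j (proj₁ (remQuot {s} N b))) (proj₂ (remQuot {s} N b))
    φ : Fin (s * N) → Fin β₂
    φ b = block b ↑ˡ t₀
    φ-inj : Injective _≡_ _≡_ φ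
    φ-inj {a} {b} eq =
      let quot≡ , rem≡ = combine-injective (punchIn j (proj₁ (remQuot {s} N a))) (proj₂ (remQuot {s} N a))
                           (punchIn j (proj₁ (remQuot {s} N b))) (proj₂ (remQuot {s} N b)) (↑ˡ-injective t₀ _ _ eq)
      in  trans (sym (combine-remQuot {s} N a)) (trans (cong₂ combine (punchIn-injective j _ _ quot≡) rem≡) (combine-remQuot {s} N b))
    typed : ∀ b → type j (φ b) ≡ true
    typed b = trans (cong [ (λ b′ → not ⌊ proj₁ (remQuot {q} N b′) ≟ᶠ j ⌋) , const true ]′ (splitAt-↑ˡ (q * N) (block b) t₀))
      (cong not (≟-false λ eq → punchInᵢ≢i j _ (trans (sym (cong proj₁ (remQuot-combine {q} {N} _ _))) eq)))

  size≤t : ∀ c → partSize 1 s t c ≤ t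
  size≤t zero             = s≤s z≤n
  size≤t (suc zero)       = s≤s s₀≤t₀
  size≤t (suc (suc zero)) = ≤-refl

  size>0 : ∀ c → 0 < partSize 1 s t c
  size>0 zero             = s≤s z≤n
  size>0 (suc zero)       = s≤s z≤n
  size>0 (suc (suc zero)) = s≤s z≤n

  no-copy : NoCopy (K 1 s t)
  no-copy F F-inj hom = go (mono-or-mixed X) (mono-or-mixed Y)
    where
    open GadgetCopy q 1 β₁ β₂ d (complete q) (complete 1) type link zero zero 1 s t F F-inj hom
    open Parts 1 s t hiding (order)

    common : V → Set
    common v = ∃ λ k → v ≡ big₂ ((q * N) ↑ʳ k)

    full⇒common : ∀ i v → [ const true , const false ]′ v ≡ false → (∀ j → adjⱽ (inQ i j) v ≡ true) → common v
    full⇒common i (inR w l) _ all = ⊥-elim (true≢false (all (omitted (bit w i))) (cong not (≟-true (omitted (bit w i)))))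
    full⇒common i (big₂ b) _ all with splitAt (q * N) b in eq
    ... | inj₁ b′ = ⊥-elim (true≢false (all quot) (cong not (≟-true quot)))
      where quot = proj₁ (remQuot {q} N b′)
    ... | inj₂ k  = k , cong (λ b → big₂ b) (trans (sym (join-splitAt (q * N) t₀ b)) (cong [ _↑ˡ t₀ , (q * N) ↑ʳ_ ]′ eq))

    z : V → Fin (suc t₀)
    z (big₂ b) = [ const zero , suc ]′ (splitAt (q * N) b)
    z _        = zero

    z-common : ∀ k → z (big₂ ((q * N) ↑ʳ k)) ≡ suc k
    z-common k = cong [ const zero , suc ]′ (splitAt-↑ʳ (q * N) t₀ k)

    positive : Fin (suc t₀) → Bool
    positive zero    = false
    positive (suc _) = true

    few-common : (∀ h → Y h ≡ true → common (F h)) → # Y ≤ t₀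
    few-common com = ≤-trans (#-injection {p = Y} {positive} (z ∘ F) z-inj z-pos) (≤-reflexive (#-full {t₀} (λ _ → refl)))
      where
      z-inj : ∀ {h h′} → Y h ≡ true → Y h′ ≡ true → z (F h) ≡ z (F h′) → h ≡ h′
      z-inj {h} {h′} Yh Yh′ eq with com h Yh | com h′ Yh′
      ... | k , Fh | k′ , Fh′ = F-inj (trans Fh (trans (cong (λ k → big₂ ((q * N) ↑ʳ k))
        (suc-injective (trans (sym (z-common k)) (trans (cong z (sym Fh)) (trans eq (trans (cong z Fh′) (z-common k′))))))) (sym Fh′)))
      z-pos : ∀ h → Y h ≡ true → positive (z (F h)) ≡ true
      z-pos h Yh with com h Yh
      ... | k , Fh = cong positive (trans (cong z Fh) (z-common k))

    go : Mono X ⊎ Mixed X → Mono Y ⊎ Mixed Y → ⊥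
    go _ (inj₂ mixed@(g , g′ , Yg , Yg′ , g≢g′)) with mixed⇒InR mixed
    ... | w , inRw = g≢g′ (cong p (ℓR-inj inRw Yg Yg′ (unique (ℓR g) (ℓR g′))))
      where
      unique : (i j : Fin 1) → i ≡ j
      unique zero zero = refl
    go (inj₁ monoX) (inj₁ monoY) = complement-mixed size>0 monoX monoY
    -- A gadget holds at most `s + 1` vertices and one class at most `t`, so both bounds are
    -- attained. Then `Y` is a whole class of size `t`, joined to an entire gadget, which has only
    -- `t₀` common neighbours.
    go (inj₂ mixed) (inj₁ monoY@(c , mono)) with mixed⇒InQ mixed
    ... | i , inQi = <⇒≱ t≤#Y (few-common all-common)
      where
      q≤#X : q ≤ # X
      q≤#X = +-cancelʳ-≤ t q (# X) (≤-trans (≤-reflexive (sym #X+#Y)) (+-monoʳ-≤ (# X) (≤-trans (mono-size monoY) (size≤t c))))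
      t≤#Y : t ≤ # Y
      t≤#Y = +-cancelˡ-≤ q t (# Y) (≤-trans (≤-reflexive (sym #X+#Y)) (+-monoˡ-≤ (# Y) (#X≤q inQi)))
      X-avoids : ∀ g → X g ≡ true → p g ≢ c
      X-avoids g Xg pg = <⇒≱ (begin-strict
        t                                              ≤⟨ t≤#Y ⟩
        # Y                                            ≤⟨ #-mono (λ h Yh → cong₂ _∧_ (⇒inPart 1 s t h (mono h Yh)) Yh) ⟩
        # (inPart 1 s t c ∩ Y)                         <⟨ m<m+n _ (0<# {p = inPart 1 s t c ∩ (not ∘ Y)} g (cong₂ _∧_ (⇒inPart 1 s t g pg) (cong (not ∘ not) Xg))) ⟩
        # (inPart 1 s t c ∩ Y) + # (inPart 1 s t c ∩ (not ∘ Y)) ≡⟨ #-split (inPart 1 s t c) Y ⟨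
        # (inPart 1 s t c)                             ∎) (≤-trans (≤-reflexive (#inPart 1 s t c)) (size≤t c))
        where open ≤-Reasoning
      all-common : ∀ h → Y h ≡ true → common (F h)
      all-common h Yh = full⇒common i (F h) (not-true⁻ Yh) λ j → joined (hits {p = X} ℓQ (ℓQ-inj inQi) q≤#X j)
        where
        joined : ∀ {j} → (∃ λ g → X g ≡ true × ℓQ g ≡ j) → adjⱽ (inQ i j) (F h) ≡ true
        joined (g , Xg , refl) = subst (λ v → adjⱽ v (F h) ≡ true) (inQi g Xg) (edge (λ eq → X-avoids g Xg (trans eq (mono h Yh))))

  completion : ∀ i w → bit w i ≡ false → Completion zero zero 1 s t i w
  completion i w w∌i = record
    { f₀ = λ _ → inQ i zero
    ; f₁ = λ j → inQ i (suc j)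
    ; f₂ = f₂
    ; f₀-inj = λ { {zero} {zero} _ → refl }
    ; f₁-inj = λ eq → suc-injective (cong proj₂ (inj₂-injective (inj₁-injective eq)))
    ; f₂-inj = f₂-inj
    ; e₀₁ = λ _ j → inj₁ (cong₂ _∧_ (≟-true i) refl)
    ; e₀₂ = λ { _ zero → inj₂ (inj₁ (refl , refl)) ; _ (suc k) → inj₁ (typed zero k) }
    ; e₁₂ = λ { j zero → inj₁ (cong (λ b → link b (suc j) zero) w∌i) ; j (suc k) → inj₁ (typed (suc j) k) }
    }
    where
    f₂ : Fin t → V
    f₂ zero    = inR w zero
    f₂ (suc k) = big₂ ((q * N) ↑ʳ k)
    f₂-inj : Injective _≡_ _≡_ f₂
    f₂-inj {zero}  {zero}  _  = refl
    f₂-inj {suc k} {suc l} eq = cong suc (↑ʳ-injective (q * N) _ _ (inj₁-injective (inj₂-injective eq)))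
    typed : ∀ j k → type j ((q * N) ↑ʳ k) ≡ true
    typed j k rewrite splitAt-↑ʳ (q * N) t₀ k = refl

  result : ∃ λ G′ → MaximalFree (K 1 s t) G′ × d ≤ VC G′ × s * N ≤ δ {order} G′
  result = lower-bound zero zero ≤-refl (≤-trans (*-monoˡ-≤ N (n≤1+n s)) (m≤m+n (q * N) t₀)) spread refl no-copy completion

  order≤ : order ≤ suc (2 * s) * N + (d * q + t₀ + 2 ^ d * 1)
  order≤ = ≤-reflexive (shuffle s N (d * q) t₀ (2 ^ d * 1))
    where
    shuffle : ∀ s N a b c → (s * N + a) + (suc s * N + b + c) ≡ suc (2 * s) * N + (a + b + c)
    shuffle = solve-∀

lower-star : ∀ {s₀ t₀} → s₀ ≤ t₀ → LowerBound (K 1 (suc s₀) (suc t₀)) (suc s₀) (suc (2 * suc s₀))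
lower-star {s₀} {t₀} s₀≤t₀ d = d * suc (suc s₀) + t₀ + 2 ^ d * 1 , λ N →
  let open Star s₀ t₀ N d s₀≤t₀
      G′ , maxG′ , d≤VC , k≤δ = result
  in  _ , G′ , maxG′ , d≤VC , k≤δ , order≤

-- K r s t is the join of the star K 1 t and of K (r-1) s; for r ≥ 2 neither
-- of these contains K r s, so only a star and a K (r-1) s fully linked to each
-- other can produce a copy.
module Multi (r₁ s₁ t₁ N d : ℕ) (r≤t : r₁ ≤ t₁) (s≤t : s₁ ≤ t₁) where
  r₀ r s t q ρ : ℕ
  r₀ = suc r₁
  r  = suc r₀
  s  = suc (suc s₁)
  t  = suc (suc t₁)
  q  = suc t
  ρ  = r₀ + s

  centre : Fin q → Bool
  centre zero    = true
  centre (suc _) = false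

  Q : Graph q
  Q = bicoloured centre

  R : Graph ρ
  R = bicoloured (isLeft r₀)

  leaf : Fin q
  leaf = suc zero

  omitted : Bool → Fin ρ
  omitted b = r₀ ↑ʳ (if b then suc zero else zero)

  link : Bool → Fin q → Fin ρ → Bool
  link b j l = not (⌊ j ≟ᶠ leaf ⌋ ∧ ⌊ l ≟ᶠ omitted b ⌋)

  type : Fin q → Fin N → Bool
  type _ _ = true

  open Gadgets q ρ N N d Q R type link

  size≤t : ∀ c → partSize r s t c ≤ t
  size≤t zero             = s≤s (s≤s r≤t)
  size≤t (suc zero)       = s≤s (s≤s s≤t)
  size≤t (suc (suc zero)) = ≤-refl

  size≥2 : ∀ c → 2 ≤ partSize r s t c
  size≥2 zero             = s≤s (s≤s z≤n)
  size≥2 (suc zero)       = s≤s (s≤s z≤n)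
  size≥2 (suc (suc zero)) = s≤s (s≤s z≤n)

  size>0 : ∀ c → 0 < partSize r s t c
  size>0 c = ≤-trans (s≤s z≤n) (size≥2 c)

  no-copy : NoCopy (K r s t)
  no-copy F F-inj hom = go (mono-or-mixed X) (mono-or-mixed Y)
    where
    open GadgetCopy q ρ N N d Q R type link leaf (omitted false) r s t F F-inj hom
    open Parts r s t hiding (order)

    is-centre : ∀ {j} → centre j ≡ true → j ≡ zero
    is-centre {zero} _ = refl

    differ : ∀ {j j′} → adj Q j j′ ≡ true → centre j ≡ false → j′ ≡ zero
    differ {suc _} {zero} _ _ = refl

    go : Mono X ⊎ Mixed X → Mono Y ⊎ Mixed Y → ⊥
    go (inj₁ monoX) (inj₁ monoY) = complement-mixed size>0 monoX monoY
    -- One vertex too few: `t` from a single class and `ρ = r + s - 1` from the gadget.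
    go (inj₁ monoX@(c , _)) (inj₂ mixedY) with mixed⇒InR mixedY
    ... | w , inRw = <⇒≱ (≤-reflexive #X+#Y≡) (+-mono-≤ (≤-trans (mono-size monoX) (size≤t c)) (#Y≤ρ inRw))
      where
      #X+#Y≡ : suc (t + ρ) ≡ # X + # Y
      #X+#Y≡ = trans (cong suc (+-comm t ρ)) (sym #X+#Y)
    -- Two whole classes lie in the star, and two vertices of each, available as `r ≥ 2`, form a
    -- 4-cycle, which a star does not contain.
    go (inj₂ mixedX) (inj₁ monoY@(c , _)) with mixed⇒InQ mixedX
    ... | i , inQi = square (others c)
      where
      inX : ∀ {h} → p h ≢ c → X h ≡ true
      inX {h} ≢ = trans (sym (not-involutive (X h))) (other-parts monoY ≢)
      square : (∃₂ λ d e → d ≢ c × e ≢ c × d ≢ e) → ⊥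
      square (d , e , d≢c , e≢c , d≢e) = corners (member d (size>0 d)) (member e (size>0 e))
        where
        path : ∀ g → p g ≡ d → ∀ h → p h ≡ e → (∃ λ g′ → p g′ ≡ d × g′ ≢ g) → (∃ λ h′ → p h′ ≡ e × h′ ≢ h) → ⊥
        path g g≡ h h≡ (g′ , g′≡ , g′≢g) (h′ , h′≡ , h′≢h) = by-centre (centre (ℓQ g)) refl
          where
          inX-d : ∀ k → p k ≡ d → X k ≡ true
          inX-d k k≡ = inX {k} (d≢c ∘ trans (sym k≡))
          inX-e : ∀ k → p k ≡ e → X k ≡ true
          inX-e k k≡ = inX {k} (e≢c ∘ trans (sym k≡))
          joined : ∀ k l → p k ≡ d → p l ≡ e → adj Q (ℓQ k) (ℓQ l) ≡ true
          joined k l k≡ l≡ = edgeQ inQi (inX-d k k≡) (inX-e l l≡) (λ eq → d≢e (trans (sym k≡) (trans eq l≡)))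
          by-centre : ∀ b → centre (ℓQ g) ≡ b → ⊥
          by-centre false not-g = h′≢h (ℓQ-inj inQi (inX-e h′ h′≡) (inX-e h h≡) (trans (differ (joined g h′ g≡ h′≡) not-g) (sym (differ (joined g h g≡ h≡) not-g))))
          by-centre true  is-g  = d≢e (trans (sym g≡) (trans (cong p (ℓQ-inj inQi (inX-d g g≡) (inX-e h h≡) (trans (is-centre is-g) (sym (differ (joined g′ h g′≡ h≡) not-g′))))) h≡))
            where
            not-g′ : centre (ℓQ g′) ≡ false
            not-g′ = ≢true⇒false λ is-g′ → g′≢g (ℓQ-inj inQi (inX-d g′ g′≡) (inX-d g g≡) (trans (is-centre is-g′) (sym (is-centre is-g))))
        corners : (∃ λ g → p g ≡ d) → (∃ λ h → p h ≡ e) → ⊥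
        corners (g , g≡) (h , h≡) = path g g≡ h h≡ (second-member d (size≥2 d) g) (second-member e (size≥2 e) h)
    -- Both gadgets are used up, so the nonadjacent pair `leaf` and `omitted` lies in one class.
    -- Outside this class the star offers only its centre `k`, which leaves in `R` a vertex of each
    -- class: a triangle in a bipartite graph.
    go (inj₂ mixedX@(g , g′ , Xg , Xg′ , g≢g′)) (inj₂ mixedY) with mixed⇒InQ mixedX | mixed⇒InR mixedY
    ... | i , inQi | w , inRw = full (hits {p = X} ℓQ (ℓQ-inj inQi) q≤#X leaf) (hits {p = Y} ℓR (ℓR-inj inRw) ρ≤#Y (omitted (bit w i)))
      where
      q+ρ≤ : q + ρ ≤ # X + # Y
      q+ρ≤ = ≤-reflexive (trans (cong suc (+-comm t ρ)) (sym #X+#Y))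
      q≤#X : q ≤ # X
      q≤#X = +-cancelʳ-≤ ρ q (# X) (≤-trans q+ρ≤ (+-monoʳ-≤ (# X) (#Y≤ρ inRw)))
      ρ≤#Y : ρ ≤ # Y
      ρ≤#Y = +-cancelˡ-≤ q ρ (# Y) (≤-trans q+ρ≤ (+-monoˡ-≤ (# Y) (#X≤q inQi)))
      full : (∃ λ h → X h ≡ true × ℓQ h ≡ leaf) → (∃ λ h → Y h ≡ true × ℓR h ≡ omitted (bit w i)) → ⊥
      full (h , Xh , ℓh) (h′ , Yh′ , ℓh′) = triangle another
        where
        same-part : p h ≡ p h′
        same-part with p h ≟ᶠ p h′
        ... | yes eq = eq
        ... | no ≢ = ⊥-elim (true≢false (edgeQR inQi inRw Xh Yh′ ≢)
                (cong not (cong₂ _∧_ (trans (cong (λ j → ⌊ j ≟ᶠ leaf ⌋) ℓh) (≟-true leaf)) (trans (cong (λ l → ⌊ l ≟ᶠ omitted (bit w i) ⌋) ℓh′) (≟-true (omitted (bit w i)))))))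
        centred : ∀ {k} → X k ≡ true → p k ≢ p h → ℓQ k ≡ zero
        centred Xk k≢h = differ {leaf} (subst (λ j → adj Q j _ ≡ true) ℓh (edgeQ inQi Xh Xk (k≢h ∘ sym))) refl
        another : ∃ λ k → X k ≡ true × p k ≢ p h
        another with p g ≟ᶠ p h
        ... | no ≢  = g , Xg , ≢
        ... | yes eq = g′ , Xg′ , λ eq′ → g≢g′ (trans eq (sym eq′))
        triangle : (∃ λ k → X k ≡ true × p k ≢ p h) → ⊥
        triangle (k , Xk , k≢h) = in-three (third (p k) (p h) k≢h)
          where
          in-Y : ∀ {m} → p m ≢ p h → m ≢ k → Y m ≡ true
          in-Y {m} m≢h m≢k = cong not (≢true⇒false λ Xm → m≢k (ℓQ-inj inQi Xm Xk (trans (centred Xm m≢h) (sym (centred Xk k≢h)))))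
          vertices : ∀ c → c ≢ p k → c ≢ p h → (∃ λ l → p l ≡ c) → (∃ λ k′ → p k′ ≡ p k × k′ ≢ k) → ⊥
          vertices c c≢k c≢h (l , l≡) (k′ , k′≡ , k′≢k) = no-bicoloured-triangle (isLeft r₀) (ℓR h′) (ℓR l) (ℓR k′)
            (edgeR inRw Yh′ Yl (λ eq → c≢h (trans (sym l≡) (trans (sym eq) (sym same-part)))))
            (edgeR inRw Yh′ Yk′ (λ eq → k≢h (trans (sym k′≡) (trans (sym eq) (sym same-part)))))
            (edgeR inRw Yl Yk′ (λ eq → c≢k (trans (sym l≡) (trans eq k′≡))))
            where
            Yl : Y l ≡ true
            Yl = in-Y {l} (c≢h ∘ trans (sym l≡)) (λ eq → c≢k (trans (sym l≡) (cong p eq)))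
            Yk′ : Y k′ ≡ true
            Yk′ = in-Y {k′} (λ eq → k≢h (trans (sym k′≡) eq)) k′≢k
          in-three : (∃ λ c → c ≢ p k × c ≢ p h) → ⊥
          in-three (c , c≢k , c≢h) = vertices c c≢k c≢h (member c (size>0 c)) (second-member (p k) (size≥2 (p k)) k)

  completion : ∀ i w → bit w i ≡ false → Completion leaf (omitted false) r s t i w
  completion i w w∌i = record
    { f₀ = f₀
    ; f₁ = λ l → inR w (r₀ ↑ʳ l)
    ; f₂ = λ j → inQ i (suc j)
    ; f₀-inj = f₀-inj
    ; f₁-inj = λ eq → ↑ʳ-injective r₀ _ _ (cong proj₂ (inj₂-injective (inj₂-injective eq)))
    ; f₂-inj = λ eq → suc-injective (cong proj₂ (inj₂-injective (inj₁-injective eq)))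
    ; e₀₁ = λ { zero l → inj₁ refl ; (suc a) l → inj₁ (cong₂ _∧_ (≟-true w) (left-right-edge r₀ s a l)) }
    ; e₀₂ = λ { zero j → inj₁ (cong₂ _∧_ (≟-true i) refl)
              ; (suc a) j → inj₁ (cong not (trans (cong (⌊ suc j ≟ᶠ leaf ⌋ ∧_) (≟-false (left≢right r₀ s a _))) (∧-zeroʳ _))) }
    ; e₁₂ = e₁₂
    }
    where
    f₀ : Fin r → V
    f₀ zero    = inQ i zero
    f₀ (suc a) = inR w (a ↑ˡ s)
    f₀-inj : Injective _≡_ _≡_ f₀
    f₀-inj {zero}  {zero}  _  = refl
    f₀-inj {suc a} {suc b} eq = cong suc (↑ˡ-injective s _ _ (cong proj₂ (inj₂-injective (inj₂-injective eq))))
    e₁₂ : ∀ l j → Joined leaf (omitted false) i w (inR w (r₀ ↑ʳ l)) (inQ i (suc j))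
    e₁₂ zero    zero    = inj₂ (inj₂ (refl , refl))
    e₁₂ (suc l) zero    = inj₁ (cong not (trans (cong (λ b → ⌊ r₀ ↑ʳ suc l ≟ᶠ omitted b ⌋) w∌i) (≟-false (λ eq → 0≢1+n (sym (↑ʳ-injective r₀ (suc l) zero eq))))))
    e₁₂ l       (suc j) = inj₁ refl

  linked : link true leaf (omitted false) ≡ true
  linked = cong not (≟-false (λ eq → 0≢1+n (↑ʳ-injective r₀ zero (suc zero) eq)))

  result : ∃ λ G′ → MaximalFree (K r s t) G′ × d ≤ VC G′ × N ≤ δ {order} G′
  result = lower-bound leaf (omitted false) ≤-refl ≤-refl (λ _ → id , id , λ _ → refl) linked no-copy completion

half-order : ∀ N a b → (N + a) + (N + b) ≤ 2 * N + (a + b)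
half-order N a b = ≤-reflexive (shuffle N a b)
  where
  shuffle : ∀ N a b → (N + a) + (N + b) ≡ 2 * N + (a + b)
  shuffle = solve-∀

lower-multi : ∀ {r s t} → 2 ≤ r → 2 ≤ s → r ≤ t → s ≤ t → LowerBound (K r s t) 1 2
lower-multi {suc (suc r₁)} {suc (suc s₁)} {suc (suc t₁)} (s≤s (s≤s _)) (s≤s (s≤s _)) (s≤s (s≤s r≤t)) (s≤s (s≤s s≤t)) d = _ , λ N →
  let open Multi r₁ s₁ t₁ N d r≤t s≤t
      G′ , maxG′ , d≤VC , k≤δ = result
  in  _ , G′ , maxG′ , d≤VC , ≤-trans (≤-reflexive (*-identityˡ N)) k≤δ , half-order N (d * q) (2 ^ d * ρ)

balanced-degree : ∀ a (l : Fin (a + a)) → # (adj (bicoloured (isLeft a)) l) ≤ a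
balanced-degree a l = ≤-trans (≤-reflexive (#-+ a {a} (adj R l))) (by-colour (isLeft a l) refl)
  where
  R : Graph (a + a)
  R = bicoloured (isLeft a)
  left right : Fin a → Bool
  left  i = adj R l (i ↑ˡ a)
  right i = adj R l (a ↑ʳ i)
  none : (f : Fin a → Fin (a + a)) (b : Bool) → (∀ i → isLeft a (f i) ≡ b) → isLeft a l ≡ b → # (λ i → adj R l (f i)) ≡ 0
  none f b side l≡ = trans (#-cong {a} {q = λ _ → false} (λ i → cong not (≡⇒same (trans l≡ (sym (side i))))))
    (trans (sum-const a 0) (*-zeroʳ a))
  by-colour : ∀ b → isLeft a l ≡ b → # left + # right ≤ a
  by-colour true  l≡ = ≤-trans (≤-reflexive (cong (_+ # right) (none (_↑ˡ a) true (isLeft-↑ˡ a a) l≡))) (#≤n right)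
  by-colour false l≡ = ≤-trans (+-mono-≤ (#≤n left) (≤-reflexive (none (a ↑ʳ_) false (isLeft-↑ʳ a a) l≡))) (≤-reflexive (+-identityʳ a))

-- Here s = s₂ + 3 and t = s + a.  K 1 s t embeds in the join of K (s-1) (s-1)
-- and of a complete graph on a + 3 vertices, and both of these have maximum
-- degree below s exactly when t ≤ 2s - 3.
module Thin (a s₂ N d : ℕ) (a≤s₂ : a ≤ s₂) where
  s₁ s t q ρ : ℕ
  s₁ = suc (suc s₂)
  s  = suc s₁
  t  = suc a + s₁
  q  = suc (suc (suc a))
  ρ  = s₁ + s₁

  Q : Graph q
  Q = complete q

  R : Graph ρ
  R = bicoloured (isLeft s₁)

  x₀ : Fin q
  x₀ = suc zero

  omitted : Bool → Fin ρ
  omitted b = s₁ ↑ʳ (if b then suc zero else zero)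

  -- All gadget vertices but `zero` miss the omitted vertex; otherwise one of them could be the
  -- centre with `x₀` in the class of that vertex. In `completion`, those other than `x₀` and `zero`
  -- are in that class, so only one edge is lacking.
  link : Bool → Fin q → Fin ρ → Bool
  link b zero    l = true
  link b (suc _) l = not ⌊ l ≟ᶠ omitted b ⌋

  type : Fin q → Fin N → Bool
  type _ _ = true

  open Gadgets q ρ N N d Q R type link

  s≤t : s ≤ t
  s≤t = s≤s (m≤n+m s₁ a)

  q≤s : q ≤ s
  q≤s = s≤s (s≤s (s≤s a≤s₂))

  size≤t : ∀ c → partSize 1 s t c ≤ t
  size≤t zero             = s≤s z≤n
  size≤t (suc zero)       = s≤t
  size≤t (suc (suc zero)) = ≤-refl

  size>0 : ∀ c → 0 < partSize 1 s t c
  size>0 zero             = s≤s z≤n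
  size>0 (suc zero)       = s≤s z≤n
  size>0 (suc (suc zero)) = s≤s z≤n

  s≤size : ∀ c → c ≢ zero → s ≤ partSize 1 s t c
  s≤size zero             ≢ = ⊥-elim (≢ refl)
  s≤size (suc zero)       _ = ≤-refl
  s≤size (suc (suc zero)) _ = s≤t

  no-copy : NoCopy (K 1 s t)
  no-copy F F-inj hom = go (mono-or-mixed X) (mono-or-mixed Y)
    where
    open GadgetCopy q ρ N N d Q R type link x₀ (omitted false) 1 s t F F-inj hom
    open Parts 1 s t hiding (order)

    P : Fin 3 → Fin (1 + s + t) → Bool
    P = inPart 1 s t

    -- A vertex of `R` has only `s - 1` neighbours in `R`, fewer than a class of size at least `s`.
    no-large-part : ∀ {w} → InR w → ∀ {h} c → Y h ≡ true → p h ≢ c → c ≢ zero → ¬ (∀ k → p k ≡ c → Y k ≡ true)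
    no-large-part inRw {h} c Yh h≢c c≢0 inY = <⇒≱ (s≤size c c≢0) (begin
      partSize 1 s t c      ≡⟨ #inPart 1 s t c ⟨
      # (P c)               ≤⟨ #-injection {p = P c} {adj R (ℓR h)} ℓR
                                 (λ {k} {k′} Pk Pk′ → ℓR-inj inRw (inY k (inPart⇒ 1 s t k Pk)) (inY k′ (inPart⇒ 1 s t k′ Pk′)))
                                 (λ k Pk → edgeR inRw Yh (inY k (inPart⇒ 1 s t k Pk)) (λ eq → h≢c (trans eq (inPart⇒ 1 s t k Pk)))) ⟩
      # (adj R (ℓR h))      ≤⟨ balanced-degree s₁ (ℓR h) ⟩
      s₁                    ∎)
      where open ≤-Reasoning

    go : Mono X ⊎ Mixed X → Mono Y ⊎ Mixed Y → ⊥
    go (inj₁ monoX) (inj₁ monoY) = complement-mixed size>0 monoX monoY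
    go (inj₁ monoX@(c , _)) (inj₂ mixedY) with mixed⇒InR mixedY
    ... | w , inRw = choose (others c)
      where
      inY : ∀ d → d ≢ c → ∀ k → p k ≡ d → Y k ≡ true
      inY d d≢c k k≡ = other-parts monoX (d≢c ∘ trans (sym k≡))
      large : ∀ d e → d ≢ c → e ≢ c → d ≢ e → e ≢ zero → (∃ λ h → p h ≡ d) → ⊥
      large d e d≢c e≢c d≢e e≢0 (h , h≡) = no-large-part inRw {h} e (inY d d≢c h h≡) (d≢e ∘ trans (sym h≡)) e≢0 (inY e e≢c)
      choose : (∃₂ λ d e → d ≢ c × e ≢ c × d ≢ e) → ⊥
      choose (d , e , d≢c , e≢c , d≢e) with e ≟ᶠ zero
      ... | no e≢0   = large d e d≢c e≢c d≢e e≢0 (member d (size>0 d))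
      ... | yes refl = large e d e≢c d≢c (d≢e ∘ sym) d≢e (member e (size>0 e))
    go (inj₂ mixedX) (inj₁ monoY@(c , _)) with mixed⇒InQ mixedX
    ... | i , inQi = <⇒≱ (s≤s (≤-trans (#X≤q inQi) q≤s)) (+-cancelʳ-≤ t (1 + s) (# X)
        (≤-trans (≤-reflexive (sym #X+#Y)) (+-monoʳ-≤ (# X) (≤-trans (mono-size monoY) (size≤t c)))))
    go (inj₂ mixedX@(g , g′ , Xg , Xg′ , g≢g′)) (inj₂ mixedY) with mixed⇒InQ mixedX | mixed⇒InR mixedY
    ... | i , inQi | w , inRw = by-side (member zero (size>0 zero))
      where
      q+ρ≤ : q + ρ ≤ # X + # Y
      q+ρ≤ = ≤-reflexive (trans (total a s₂) (sym #X+#Y))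
        where
        total : ∀ a s₂ → suc (suc (suc a)) + (suc (suc s₂) + suc (suc s₂)) ≡ 1 + suc (suc (suc s₂)) + (suc a + suc (suc s₂))
        total = solve-∀
      ρ≤#Y : ρ ≤ # Y
      ρ≤#Y = +-cancelˡ-≤ q ρ (# Y) (≤-trans q+ρ≤ (+-monoˡ-≤ (# Y) (#X≤q inQi)))

      unique : ∀ {h h′} → p h ≡ zero → p h′ ≡ zero → h ≡ h′
      unique {h} {h′} h≡ h′≡ with h′ ≟ᶠ h
      ... | yes eq = sym eq
      ... | no ≢ = ⊥-elim (<⇒≱ two (≤-reflexive (#inPart 1 s t zero)))
        where
        two : 1 < # (P zero)
        two = ≤# {q = P zero} pair pair-inj λ { zero → ⇒inPart 1 s t h h≡ ; (suc zero) → ⇒inPart 1 s t h′ h′≡ }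
          where
          pair : Fin 2 → Fin (1 + s + t)
          pair zero    = h
          pair (suc _) = h′
          pair-inj : Injective _≡_ _≡_ pair
          pair-inj {zero}     {zero}     _  = refl
          pair-inj {zero}     {suc _}    eq = ⊥-elim (≢ (sym eq))
          pair-inj {suc _}    {zero}     eq = ⊥-elim (≢ eq)
          pair-inj {suc zero} {suc zero} _  = refl

      centre-in-X : ∀ h → p h ≡ zero → X h ≡ true → (∃ λ k → Y k ≡ true × ℓR k ≡ omitted (bit w i)) → ⊥
      -- Here `k` sits at the omitted vertex. Outside its class, `X` can only contain the gadget
      -- vertex `zero`, taken by the centre, so a whole large class lies in `Y` and is joined to
      -- `k`.
      centre-in-X h h≡ Xh (k , Yk , ℓk) = in-third (third (p k) zero k≢0)
        where
        k≢0 : p k ≢ zero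
        k≢0 k≡ = true≢false Xh (not-true⁻ (subst (λ h → Y h ≡ true) (unique k≡ h≡) Yk))
        blocked : ∀ m → X m ≡ true → p m ≢ p k → ℓQ m ≡ zero
        blocked m Xm m≢k with ℓQ m | edgeQR inQi inRw Xm Yk m≢k
        ... | zero  | _ = refl
        ... | suc _ | linked = ⊥-elim (true≢false linked (cong not (trans (cong (λ l → ⌊ l ≟ᶠ omitted (bit w i) ⌋) ℓk) (≟-true (omitted (bit w i))))))
        in-third : (∃ λ c → c ≢ p k × c ≢ zero) → ⊥
        in-third (c , c≢k , c≢0) = no-large-part inRw {k} c Yk (c≢k ∘ sym) c≢0 λ m m≡ →
          cong not (≢true⇒false λ Xm → c≢0 (trans (sym m≡) (trans (cong p (ℓQ-inj inQi Xm Xh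
            (trans (blocked m Xm (λ eq → c≢k (trans (sym m≡) eq))) (sym (blocked h Xh (λ eq → k≢0 (trans (sym eq) h≡))))))) h≡)))

      centre-in-Y : ∀ h → p h ≡ zero → Y h ≡ true → ⊥
      -- As `R` has no triangle through the centre, `Y` meets at most one large class. The other
      -- lies in `X` with a further vertex, making more than `s ≥ q` vertices in the gadget.
      centre-in-Y h h≡ Yh = whole-part (mono-or-mixed outside)
        where
        outside : Fin (1 + s + t) → Bool
        outside k = Y k ∧ not (P zero k)
        not-zero : ∀ {k} → X k ≡ true → p k ≢ zero
        not-zero {k} Xk k≡ = true≢false Xk (not-true⁻ (subst (λ h → Y h ≡ true) (unique h≡ k≡) Yh))
        nonzero : ∀ k → outside k ≡ true → p k ≢ zero
        nonzero k ok k≡ = true≢false (⇒inPart 1 s t k k≡) (not-true⁻ (∧-conicalʳ (Y k) _ ok))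
        in-X : ∀ c → c ≢ zero → (∀ k → outside k ≡ true → p k ≢ c) → ∀ k → p k ≡ c → X k ≡ true
        in-X c c≢0 avoid k k≡ with X k in Xk
        ... | true  = refl
        ... | false = ⊥-elim (avoid k (cong₂ _∧_ (cong not Xk) (cong not (≢true⇒false (λ P0 → c≢0 (trans (sym k≡) (inPart⇒ 1 s t k P0)))))) k≡)
        too-many : ∀ c → c ≢ zero → (∀ k → p k ≡ c → X k ≡ true) → ∀ m → X m ≡ true → p m ≢ c → ⊥
        too-many c c≢0 inX m Xm m≢c = <⇒≱ (begin-strict
          s                                        ≤⟨ s≤size c c≢0 ⟩
          partSize 1 s t c                         ≡⟨ #inPart 1 s t c ⟨
          # (P c)                                  ≤⟨ #-mono (λ k Pk → cong₂ _∧_ (inX k (inPart⇒ 1 s t k Pk)) Pk) ⟩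
          # (X ∩ P c)                              <⟨ m<m+n _ (0<# {p = X ∩ (not ∘ P c)} m (cong₂ _∧_ Xm (cong not (≢true⇒false (m≢c ∘ inPart⇒ 1 s t m))))) ⟩
          # (X ∩ P c) + # (X ∩ (not ∘ P c))        ≡⟨ #-split X (P c) ⟨
          # X                                      ∎) (≤-trans (#X≤q inQi) q≤s)
          where open ≤-Reasoning
        conclude : ∀ c → c ≢ zero → (∀ k → outside k ≡ true → p k ≢ c) → ⊥
        conclude c c≢0 avoid with p g ≟ᶠ c
        ... | no g≢c  = too-many c c≢0 (in-X c c≢0 avoid) g Xg g≢c
        ... | yes g≡c = too-many c c≢0 (in-X c c≢0 avoid) g′ Xg′ (λ g′≡c → g≢g′ (trans g≡c (sym g′≡c)))
        avoiding : ∀ c → (∀ k → outside k ≡ true → p k ≡ c) → (∃ λ d → d ≢ c × d ≢ zero) → ⊥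
        avoiding c mono (d , d≢c , d≢0) = conclude d d≢0 (λ k ok k≡d → d≢c (trans (sym k≡d) (mono k ok)))
        whole-part : Mono outside ⊎ Mixed outside → ⊥
        whole-part (inj₂ (k , l , ok , ol , k≢l)) = no-bicoloured-triangle (isLeft s₁) (ℓR h) (ℓR k) (ℓR l)
          (edgeR inRw Yh (∧-conicalˡ _ _ ok) (λ eq → nonzero k ok (trans (sym eq) h≡)))
          (edgeR inRw Yh (∧-conicalˡ _ _ ol) (λ eq → nonzero l ol (trans (sym eq) h≡)))
          (edgeR inRw (∧-conicalˡ _ _ ok) (∧-conicalˡ _ _ ol) k≢l)
        whole-part (inj₁ (c , mono)) with c ≟ᶠ zero
        ... | no c≢0   = avoiding c mono (third c zero c≢0)
        ... | yes refl = avoiding zero mono (suc zero , (λ ()) , λ ())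

      by-side : (∃ λ h → p h ≡ zero) → ⊥
      by-side (h , h≡) with X h in Xh
      ... | true  = centre-in-X h h≡ Xh (hits {p = Y} ℓR (ℓR-inj inRw) ρ≤#Y (omitted (bit w i)))
      ... | false = centre-in-Y h h≡ (cong not Xh)

  completion : ∀ i w → bit w i ≡ false → Completion x₀ (omitted false) 1 s t i w
  completion i w w∌i = record
    { f₀ = λ _ → inQ i x₀
    ; f₁ = f₁
    ; f₂ = f₂ ∘ splitAt (suc a)
    ; f₀-inj = λ { {zero} {zero} _ → refl }
    ; f₁-inj = f₁-inj
    ; f₂-inj = λ {k} {l} eq → trans (sym (join-splitAt (suc a) s₁ k)) (trans (cong [ _↑ˡ s₁ , suc a ↑ʳ_ ]′ (f₂-inj (splitAt (suc a) k) (splitAt (suc a) l) eq)) (join-splitAt (suc a) s₁ l))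
    ; e₀₁ = e₀₁
    ; e₀₂ = λ _ k → e₀₂ (splitAt (suc a) k)
    ; e₁₂ = λ j k → e₁₂ j (splitAt (suc a) k)
    }
    where
    f₁ : Fin s → V
    f₁ zero    = inQ i zero
    f₁ (suc l) = inR w (l ↑ˡ s₁)
    f₂ : Fin (suc a) ⊎ Fin s₁ → V
    f₂ (inj₁ j) = inQ i (suc (suc j))
    f₂ (inj₂ l) = inR w (s₁ ↑ʳ l)
    f₁-inj : Injective _≡_ _≡_ f₁
    f₁-inj {zero}  {zero}  _  = refl
    f₁-inj {suc k} {suc l} eq = cong suc (↑ˡ-injective s₁ _ _ (cong proj₂ (inj₂-injective (inj₂-injective eq))))
    f₂-inj : ∀ k l → f₂ k ≡ f₂ l → k ≡ l
    f₂-inj (inj₁ k) (inj₁ l) eq = cong inj₁ (suc-injective (suc-injective (cong proj₂ (inj₂-injective (inj₁-injective eq)))))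
    f₂-inj (inj₂ k) (inj₂ l) eq = cong inj₂ (↑ʳ-injective s₁ _ _ (cong proj₂ (inj₂-injective (inj₂-injective eq))))
    link-left : ∀ b j (l : Fin s₁) → link b j (l ↑ˡ s₁) ≡ true
    link-left b zero    l = refl
    link-left b (suc _) l = cong not (≟-false (left≢right s₁ s₁ l (if b then suc zero else zero)))
    e₀₁ : ∀ c j → Joined x₀ (omitted false) i w (inQ i x₀) (f₁ j)
    e₀₁ _ zero    = inj₁ (cong₂ _∧_ (≟-true i) refl)
    e₀₁ _ (suc l) = inj₁ (link-left (bit w i) x₀ l)
    e₀₂ : ∀ k → Joined x₀ (omitted false) i w (inQ i x₀) (f₂ k)
    e₀₂ (inj₁ j)       = inj₁ (cong₂ _∧_ (≟-true i) refl)
    e₀₂ (inj₂ zero)    = inj₂ (inj₁ (refl , refl))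
    e₀₂ (inj₂ (suc l)) = inj₁ (cong not (trans (cong (λ b → ⌊ s₁ ↑ʳ suc l ≟ᶠ omitted b ⌋) w∌i) (≟-false (λ eq → 0≢1+n (sym (↑ʳ-injective s₁ (suc l) zero eq))))))
    e₁₂ : ∀ j k → Joined x₀ (omitted false) i w (f₁ j) (f₂ k)
    e₁₂ zero    (inj₁ j) = inj₁ (cong₂ _∧_ (≟-true i) refl)
    e₁₂ zero    (inj₂ l) = inj₁ refl
    e₁₂ (suc l) (inj₁ j) = inj₁ (link-left (bit w i) (suc (suc j)) l)
    e₁₂ (suc l) (inj₂ m) = inj₁ (cong₂ _∧_ (≟-true w) (left-right-edge s₁ s₁ l m))

  linked : link true x₀ (omitted false) ≡ true
  linked = cong not (≟-false (λ eq → 0≢1+n (↑ʳ-injective s₁ zero (suc zero) eq)))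

  result : ∃ λ G′ → MaximalFree (K 1 s t) G′ × d ≤ VC G′ × N ≤ δ {order} G′
  result = lower-bound x₀ (omitted false) ≤-refl ≤-refl (λ _ → id , id , λ _ → refl) linked no-copy completion

lower-thin : ∀ a s₂ → a ≤ s₂ → LowerBound (K 1 (3 + s₂) (suc a + (2 + s₂))) 1 2
lower-thin a s₂ a≤s₂ d = _ , λ N →
  let open Thin a s₂ N d a≤s₂
      G′ , maxG′ , d≤VC , k≤δ = result
  in  _ , G′ , maxG′ , d≤VC , ≤-trans (≤-reflexive (*-identityˡ N)) k≤δ , half-order N (d * q) (2 ^ d * ρ)

-- Assembling the three cases

lower-half : ∀ r s t → 1 ≤ r → r ≤ s → s ≤ t → ¬ (r ≡ 1 × s ≡ 1) → ¬ (r ≡ 1 × 2 ≤ s × 2 * s ∸ 2 ≤ t) →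
  LowerBound (K r s t) 1 2
lower-half (suc (suc r)) s t _ r≤s s≤t _ _ = lower-multi {suc (suc r)} {s} {t} (s≤s (s≤s z≤n)) (≤-trans (s≤s (s≤s z≤n)) r≤s) (≤-trans r≤s s≤t) s≤t
lower-half 1 1 t _ _ _ ¬triangle _ = ⊥-elim (¬triangle (refl , refl))
-- For `s = 2`, the condition `2s - 2 ≤ t` is just `s ≤ t`.
lower-half 1 2 t _ _ 2≤t _ ¬star = ⊥-elim (¬star (refl , ≤-refl , 2≤t))
lower-half 1 (suc (suc (suc s₂))) t _ _ s≤t _ ¬star = subst (λ t → LowerBound (K 1 (3 + s₂) t) 1 2) t≡ (lower-thin a s₂ a≤s₂)
  where
  a = t ∸ (3 + s₂)
  t≡ : suc a + (2 + s₂) ≡ t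
  t≡ = trans (cong suc (+-comm a (2 + s₂))) (m+[n∸m]≡n s≤t)
  -- With `a = t - s` and `s₂ = s - 3`, this is the failure of `2s - 2 ≤ t`.
  a≤s₂ : a ≤ s₂
  a≤s₂ = ≮⇒≥ λ s₂<a → ¬star (refl , s≤s (s≤s z≤n) , (begin
    2 * (3 + s₂) ∸ 2      ≡⟨ cong (_∸ 2) (expand s₂) ⟩
    suc (suc s₂) + (2 + s₂) ≤⟨ +-monoˡ-≤ (2 + s₂) (s≤s s₂<a) ⟩
    suc a + (2 + s₂)      ≡⟨ t≡ ⟩
    t                     ∎))
    where
    open ≤-Reasoning
    expand : ∀ s₂ → 2 * (3 + s₂) ≡ 2 + (suc (suc s₂) + (2 + s₂))
    expand = solve-∀

theorem1p4 : (r s t : ℕ) → 1 ≤ r → r ≤ s → s ≤ t →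
    (r ≡ 1 × s ≡ 1 → δ-VC K r s t ≐ fromℚ (+ 1 / 3))
    × (r ≡ 1 × 2 ≤ s × 2 * s ∸ 2 ≤ t → δ-VC K r s t ≐ fromℚ (+ s / suc (2 * s)))
    × (¬ (r ≡ 1 × s ≡ 1) × ¬ (r ≡ 1 × 2 ≤ s × 2 * s ∸ 2 ≤ t) → δ-VC K r s t ≐ fromℚ (+ 1 / 2))
theorem1p4 r s t 1≤r r≤s s≤t = third-case t s≤t , star-case t s≤t , half-case
  where
  third-case : ∀ t → s ≤ t → r ≡ 1 × s ≡ 1 → δ-VC K r s t ≐ fromℚ (+ 1 / 3)
  -- The star construction at `s = 1` has density `s/(2s+1) = 1/3`.
  third-case (suc t₀) 1≤t (refl , refl) = threshold (K 1 1 (suc t₀)) 1 2 (+ 1 / 3) refl (s≤s z≤n) (upper-third {suc t₀} 1≤t) (lower-star {0} {t₀} z≤n)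
  star-case : ∀ t → s ≤ t → r ≡ 1 × 2 ≤ s × 2 * s ∸ 2 ≤ t → δ-VC K r s t ≐ fromℚ (+ s / suc (2 * s))
  star-case (suc t₀) (s≤s {m = s₀} s₀≤t₀) (refl , s≤s 1≤s₀ , 2s∸2≤t) =
    threshold (K 1 (suc s₀) (suc t₀)) (suc s₀) (2 * suc s₀) (+ suc s₀ / suc (2 * suc s₀)) refl (s≤s z≤n)
      (upper-star {s₀} {t₀} 1≤s₀ s₀≤t₀ (subst (_≤ suc t₀) (cong (_∸ 1) (+-suc s₀ (s₀ + 0))) 2s∸2≤t)) (lower-star {s₀} {t₀} s₀≤t₀)
  half-case : ¬ (r ≡ 1 × s ≡ 1) × ¬ (r ≡ 1 × 2 ≤ s × 2 * s ∸ 2 ≤ t) → δ-VC K r s t ≐ fromℚ (+ 1 / 2)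
  half-case (¬triangle , ¬star) =
    threshold (K r s t) 1 1 (+ 1 / 2) refl (s≤s z≤n) (upper-half {r} {s} {t} (≤-trans 1≤r (≤-trans r≤s s≤t)) (≤-trans r≤s s≤t) s≤t)
      (lower-half r s t 1≤r r≤s s≤t ¬triangle ¬star)
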